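{- Let $n\ge 3$ and let $G$ be a connected well-covered unicyclic graph of order $2n$. Then $C_n^{\ast}\preceq G\preceq U_n^{\ast}$.
   Context: All graphs are finite, simple and undirected. A graph is well-covered if all of its maximal independent sets have the same size. A connected unicyclic graph is a connected graph containing exactly one cycle. The independence polynomial of a graph $G$ is $I(G,x)=\sum_{k\ge 0} i_kx^k$, where $i_k$ is the number of independent sets of size $k$ in $G$. It is known that the root of $I(G,x)$ of smallest modulus is real and lies in $[-1,0)$; it is denoted $\xi(G)$ (equivalently, the largest real root of $I(G,x)$). For graphs $G,H$, write $H\preceq G$ if and only if $I(H,x)\ge I(G,x)$ for all $x\in[\xi(G),0]$. For a graph $G$, the graph star $G^{\ast}$ is obtained from $G$ by attaching, for each vertex $v$ of $G$, a new vertex $v^{\ast}$ joined by an edge to $v$ only. $C_n$ is the cycle on $n$ vertices. $U_n$ is the graph on $n$ vertices obtained from a triangle by attaching $n-3$ pendant vertices (leaves) to one fixed vertex of the triangle. -}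

module Defs where

open import Data.Nat.Base as ℕ using (ℕ; zero; suc)
import Data.Nat.Properties as ℕ
open import Data.Integer.Base using (+_)
open import Data.Rational.Base as ℚ using (ℚ; 0ℚ; 1ℚ; ½; ∣_∣)
import Data.Rational.Properties as ℚ
open import Data.Rational.Solver using (module +-*-Solver)
open import Data.Fin.Base using (Fin; toℕ; splitAt)
import Data.Fin.Properties as Fin
open import Data.Fin.Subset as Subset using (Subset; inside; outside; _∈_; _⊆_)
open import Data.Fin.Subset.Properties using (_∈?_)
open import Data.List.Base using (List; []; _∷_; _++_; map; filter; length; foldr; upTo)
open import Data.Vec.Base as Vec using ()
open import Data.Product.Base using (_×_; _,_; ∃; proj₁; proj₂)
open import Data.Sum.Base using (_⊎_; inj₁; inj₂)
import Data.Sum.Base as Sum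
open import Data.Empty using (⊥)
open import Function.Base using (_∘_)
open import Function.Bundles using (_⇔_)
open import Function.Definitions using (Injective)
open import Level using (0ℓ)
open import Relation.Binary.Core using (Rel)
open import Relation.Binary.Definitions using (Decidable; Symmetric)
open import Relation.Binary.Construct.Closure.ReflexiveTransitive using (Star)
open import Relation.Binary.PropositionalEquality
  using (_≡_; _≢_; refl; sym; trans; cong; cong₂; subst)
open import Relation.Nullary using (¬_; Dec; yes; no)
open import Relation.Nullary.Decidable using (_×-dec_; _⊎-dec_; _→-dec_; ¬?)

record Graph (n : ℕ) : Set₁ where
  infix 4 _~_ _~?_
  field
    _~_      : Rel (Fin n) 0ℓ
    _~?_     : Decidable _~_
    ~-sym    : Symmetric _~_
    ~-irrefl : ∀ {v} → ¬ (v ~ v)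

Connected : ∀ {n} → Graph n → Set
Connected {n} G = Fin n × (∀ u v → Star (Graph._~_ G) u v)

-- The cycle 0 - 1 - ⋯ - (n-1) - 0, for n ≥ 3.  (For smaller n the relation
-- below is that of a path; `i ≢ j` only matters for n = 1.)
cycle : ∀ n → Graph n
cycle n = record
  { _~_      = λ i j → i ≢ j × (Next i j ⊎ Next j i)
  ; _~?_     = λ i j → ¬? (i Fin.≟ j) ×-dec (next? i j ⊎-dec next? j i)
  ; ~-sym    = λ (i≢j , adj) → i≢j ∘ sym , Sum.swap adj
  ; ~-irrefl = λ (v≢v , _) → v≢v refl
  }
  where
  Next : Rel (Fin n) 0ℓ
  Next i j = suc (toℕ i) ≡ toℕ j ⊎ (suc (toℕ i) ≡ n × toℕ j ≡ 0)

  next? : Decidable Next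
  next? i j = (suc (toℕ i) ℕ.≟ toℕ j) ⊎-dec ((suc (toℕ i) ℕ.≟ n) ×-dec (toℕ j ℕ.≟ 0))

-- The triangle 0 - 1 - 2 - 0 with leaves 3, …, n-1 at vertex 0, for n ≥ 3.
U : ∀ n → Graph n
U n = record
  { _~_      = λ i j → i ≢ j × (Edge i j ⊎ Edge j i)
  ; _~?_     = λ i j → ¬? (i Fin.≟ j) ×-dec (edge? i j ⊎-dec edge? j i)
  ; ~-sym    = λ (i≢j , adj) → i≢j ∘ sym , Sum.swap adj
  ; ~-irrefl = λ (v≢v , _) → v≢v refl
  }
  where
  Edge : Rel (Fin n) 0ℓ
  Edge i j = toℕ i ≡ 0 ⊎ (toℕ i ≡ 1 × toℕ j ≡ 2)

  edge? : Decidable Edge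
  edge? i j = (toℕ i ℕ.≟ 0) ⊎-dec ((toℕ i ℕ.≟ 1) ×-dec (toℕ j ℕ.≟ 2))

-- The graph star: under Fin (n + n) ≅ Fin n ⊎ Fin n the left summand is G
-- and inj₂ v is the new vertex v*.
infix 30 _⋆
_⋆ : ∀ {n} → Graph n → Graph (n ℕ.+ n)
_⋆ {n} G = record
  { _~_      = λ i j → Adj (splitAt n i) (splitAt n j)
  ; _~?_     = λ i j → adj? (splitAt n i) (splitAt n j)
  ; ~-sym    = λ {i} {j} → adj-sym (splitAt n i) (splitAt n j)
  ; ~-irrefl = λ {i} → adj-irrefl (splitAt n i)
  }
  where
  open Graph G

  Adj : Rel (Fin n ⊎ Fin n) 0ℓ
  Adj (inj₁ u) (inj₁ v) = u ~ v
  Adj (inj₁ u) (inj₂ v) = u ≡ v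
  Adj (inj₂ u) (inj₁ v) = u ≡ v
  Adj (inj₂ u) (inj₂ v) = ⊥

  adj? : Decidable Adj
  adj? (inj₁ u) (inj₁ v) = u ~? v
  adj? (inj₁ u) (inj₂ v) = u Fin.≟ v
  adj? (inj₂ u) (inj₁ v) = u Fin.≟ v
  adj? (inj₂ u) (inj₂ v) = no λ ()

  adj-sym : ∀ a b → Adj a b → Adj b a
  adj-sym (inj₁ u) (inj₁ v) = ~-sym
  adj-sym (inj₁ u) (inj₂ v) = sym
  adj-sym (inj₂ u) (inj₁ v) = sym

  adj-irrefl : ∀ a → ¬ Adj a a
  adj-irrefl (inj₁ u) = ~-irrefl

-- A cycle of G: an injective homomorphism from C_k, k ≥ 3, that is, a
-- subgraph isomorphic to C_k together with a parametrisation of it.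
record Cycle {n} (G : Graph n) : Set where
  open Graph
  field
    len       : ℕ
    3≤len     : 3 ℕ.≤ len
    vertex    : Fin len → Fin n
    injective : Injective _≡_ _≡_ vertex
    adjacent  : ∀ {i j} → _~_ (cycle len) i j → _~_ G (vertex i) (vertex j)

  HasEdge : Rel (Fin n) 0ℓ
  HasEdge u v = ∃ λ i → ∃ λ j → _~_ (cycle len) i j × vertex i ≡ u × vertex j ≡ v

-- Parametrisations differing by a rotation or a reflection give the same
-- cycle, so cycles are compared through their edge sets.
SameCycle : ∀ {n} {G : Graph n} → Rel (Cycle G) 0ℓ
SameCycle c d = ∀ u v → Cycle.HasEdge c u v ⇔ Cycle.HasEdge d u v

Unicyclic : ∀ {n} → Graph n → Set
Unicyclic G = ∃ λ (c : Cycle G) → ∀ (d : Cycle G) → SameCycle c d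

module _ {n} (G : Graph n) where
  open Graph G

  Independent : Subset n → Set
  Independent S = ∀ u v → u ∈ S → v ∈ S → ¬ (u ~ v)

  independent? : ∀ S → Dec (Independent S)
  independent? S = Fin.all? λ u → Fin.all? λ v →
    (u ∈? S) →-dec ((v ∈? S) →-dec ¬? (u ~? v))

  MaximalIndependent : Subset n → Set
  MaximalIndependent S = Independent S × (∀ T → Independent T → S ⊆ T → T ⊆ S)

  WellCovered : Set
  WellCovered = ∀ S T → MaximalIndependent S → MaximalIndependent T →
                Subset.∣ S ∣ ≡ Subset.∣ T ∣

-- Every subset, listed exactly once.
subsets : ∀ n → List (Subset n)
subsets zero    = Vec.[] ∷ []
subsets (suc n) = map (outside Vec.∷_) (subsets n) ++ map (inside Vec.∷_) (subsets n)

#independent : ∀ {n} → Graph n → ℕ → ℕ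
#independent {n} G k =
  length (filter (λ S → independent? G S ×-dec (Subset.∣ S ∣ ℕ.≟ k)) (subsets n))

-- The reals are Cauchy sequences of rationals, with equality the setoid
-- relation _≈_ below and arithmetic termwise.
IsCauchy : (ℕ → ℚ) → Set
IsCauchy s = ∀ ε → 0ℚ ℚ.< ε →
  ∃ λ N → ∀ {m n} → N ℕ.≤ m → N ℕ.≤ n → ∣ s m ℚ.- s n ∣ ℚ.≤ ε

record ℝ : Set where
  constructor mkℝ
  field
    seq    : ℕ → ℚ
    cauchy : IsCauchy seq
open ℝ

infix 4 _≤_ _≈_

-- Eventually seq x ≤ seq y + ε, for every ε > 0: this is the order of the limits.
_≤_ : Rel ℝ 0ℓ
x ≤ y = ∀ ε → 0ℚ ℚ.< ε → ∃ λ N → ∀ {m} → N ℕ.≤ m → seq x m ℚ.≤ seq y m ℚ.+ ε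

_≈_ : Rel ℝ 0ℓ
x ≈ y = x ≤ y × y ≤ x

private
  halves : ∀ ε → ½ ℚ.* ε ℚ.+ ½ ℚ.* ε ≡ ε
  halves ε = trans (sym (ℚ.*-distribʳ-+ ε ½ ½)) (ℚ.*-identityˡ ε)

  *-pos : ∀ p q → 0ℚ ℚ.< p → 0ℚ ℚ.< q → 0ℚ ℚ.< p ℚ.* q
  *-pos p q 0<p 0<q =
    ℚ.positive⁻¹ (p ℚ.* q) {{ℚ.pos*pos⇒pos p {{ℚ.positive 0<p}} q {{ℚ.positive 0<q}}}}

  *-mono-≤ : ∀ {p q r s} → 0ℚ ℚ.≤ r → 0ℚ ℚ.≤ q → p ℚ.≤ q → r ℚ.≤ s → p ℚ.* r ℚ.≤ q ℚ.* s
  *-mono-≤ {p} {q} {r} {s} 0≤r 0≤q p≤q r≤s = ℚ.≤-trans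
    (ℚ.*-monoʳ-≤-nonNeg r {{ℚ.nonNegative 0≤r}} p≤q)
    (ℚ.*-monoˡ-≤-nonNeg q {{ℚ.nonNegative 0≤q}} r≤s)

  half-pos : ∀ {ε} → 0ℚ ℚ.< ε → 0ℚ ℚ.< ½ ℚ.* ε
  half-pos {ε} = *-pos ½ ε (ℚ.positive⁻¹ ½)

  bounded : ∀ {s} → IsCauchy s → ∃ λ B → 0ℚ ℚ.< B × ∃ λ N → ∀ {m} → N ℕ.≤ m → ∣ s m ∣ ℚ.≤ B
  bounded {s} c with c 1ℚ (ℚ.positive⁻¹ 1ℚ)
  ... | N , close = 1ℚ ℚ.+ ∣ s N ∣ , 0<B , N , bound
    where
    0<B : 0ℚ ℚ.< 1ℚ ℚ.+ ∣ s N ∣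
    0<B = ℚ.+-mono-<-≤ (ℚ.positive⁻¹ 1ℚ) (ℚ.0≤∣p∣ (s N))

    split : ∀ a b → a ≡ (a ℚ.- b) ℚ.+ b
    split = solve 2 (λ a b → a := (a :- b) :+ b) refl where open +-*-Solver

    bound : ∀ {m} → N ℕ.≤ m → ∣ s m ∣ ℚ.≤ 1ℚ ℚ.+ ∣ s N ∣
    bound {m} N≤m = subst (ℚ._≤ _) (cong ∣_∣ (sym (split (s m) (s N))))
      (ℚ.≤-trans (ℚ.∣p+q∣≤∣p∣+∣q∣ (s m ℚ.- s N) (s N))
                 (ℚ.+-monoˡ-≤ ∣ s N ∣ (close N≤m ℕ.≤-refl)))

  +-cauchy : ∀ {s t} → IsCauchy s → IsCauchy t → IsCauchy (λ n → s n ℚ.+ t n)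
  +-cauchy {s} {t} cs ct ε 0<ε with cs (½ ℚ.* ε) (half-pos 0<ε) | ct (½ ℚ.* ε) (half-pos 0<ε)
  ... | M , closeˢ | N , closeᵗ = M ℕ.⊔ N , λ {m} {n} ≤m ≤n →
    subst (ℚ._≤ ε) (cong ∣_∣ (sym (regroup (s m) (t m) (s n) (t n))))
      (subst (_ ℚ.≤_) (halves ε)
        (ℚ.≤-trans (ℚ.∣p+q∣≤∣p∣+∣q∣ (s m ℚ.- s n) (t m ℚ.- t n))
          (ℚ.+-mono-≤ (closeˢ (ℕ.m⊔n≤o⇒m≤o M N ≤m) (ℕ.m⊔n≤o⇒m≤o M N ≤n))
                      (closeᵗ (ℕ.m⊔n≤o⇒n≤o M N ≤m) (ℕ.m⊔n≤o⇒n≤o M N ≤n)))))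
    where
    regroup : ∀ a b c d → (a ℚ.+ b) ℚ.- (c ℚ.+ d) ≡ (a ℚ.- c) ℚ.+ (b ℚ.- d)
    regroup = solve 4 (λ a b c d → (a :+ b) :- (c :+ d) := (a :- c) :+ (b :- d)) refl
      where open +-*-Solver

  shrink : ∀ B → 0ℚ ℚ.< B → ∀ ε → 0ℚ ℚ.< ε → ∃ λ δ → 0ℚ ℚ.< δ × B ℚ.* δ ≡ ½ ℚ.* ε
  shrink B 0<B ε 0<ε = B⁻¹ ℚ.* (½ ℚ.* ε) , *-pos B⁻¹ (½ ℚ.* ε) 0<B⁻¹ (half-pos 0<ε) ,
    trans (sym (ℚ.*-assoc B B⁻¹ (½ ℚ.* ε)))
      (trans (cong (ℚ._* (½ ℚ.* ε)) (ℚ.*-inverseʳ B)) (ℚ.*-identityˡ (½ ℚ.* ε)))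
    where
    instance
      B-pos : ℚ.Positive B
      B-pos = ℚ.positive 0<B
      B-nonZero : ℚ.NonZero B
      B-nonZero = ℚ.pos⇒nonZero B
    B⁻¹ = ℚ.1/ B
    0<B⁻¹ : 0ℚ ℚ.< B⁻¹
    0<B⁻¹ = ℚ.positive⁻¹ B⁻¹ {{ℚ.1/pos⇒pos B}}

  product-close : ∀ a b c d {A B δ η ε} → 0ℚ ℚ.< A → 0ℚ ℚ.< B →
    A ℚ.* δ ≡ ½ ℚ.* ε → B ℚ.* η ≡ ½ ℚ.* ε →
    ∣ a ∣ ℚ.≤ A → ∣ d ∣ ℚ.≤ B → ∣ a ℚ.- c ∣ ℚ.≤ η → ∣ b ℚ.- d ∣ ℚ.≤ δ →
    ∣ a ℚ.* b ℚ.- c ℚ.* d ∣ ℚ.≤ ε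
  product-close a b c d {A} {B} {δ} {η} {ε} 0<A 0<B Aδ Bη ∣a∣≤A ∣d∣≤B a-c b-d =
    begin
      ∣ a ℚ.* b ℚ.- c ℚ.* d ∣
        ≡⟨ cong ∣_∣ (regroup a b c d) ⟩
      ∣ a ℚ.* (b ℚ.- d) ℚ.+ d ℚ.* (a ℚ.- c) ∣
        ≤⟨ ℚ.∣p+q∣≤∣p∣+∣q∣ (a ℚ.* (b ℚ.- d)) (d ℚ.* (a ℚ.- c)) ⟩
      ∣ a ℚ.* (b ℚ.- d) ∣ ℚ.+ ∣ d ℚ.* (a ℚ.- c) ∣
        ≡⟨ cong₂ ℚ._+_ (ℚ.∣p*q∣≡∣p∣*∣q∣ a (b ℚ.- d)) (ℚ.∣p*q∣≡∣p∣*∣q∣ d (a ℚ.- c)) ⟩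
      ∣ a ∣ ℚ.* ∣ b ℚ.- d ∣ ℚ.+ ∣ d ∣ ℚ.* ∣ a ℚ.- c ∣
        ≤⟨ ℚ.+-mono-≤ (*-mono-≤ {∣ a ∣} {A} {∣ b ℚ.- d ∣} {δ} (ℚ.0≤∣p∣ (b ℚ.- d)) (ℚ.<⇒≤ 0<A) ∣a∣≤A b-d)
                      (*-mono-≤ {∣ d ∣} {B} {∣ a ℚ.- c ∣} {η} (ℚ.0≤∣p∣ (a ℚ.- c)) (ℚ.<⇒≤ 0<B) ∣d∣≤B a-c) ⟩
      A ℚ.* δ ℚ.+ B ℚ.* η
        ≡⟨ cong₂ ℚ._+_ Aδ Bη ⟩
      ½ ℚ.* ε ℚ.+ ½ ℚ.* ε
        ≡⟨ halves ε ⟩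
      ε ∎
    where
    open ℚ.≤-Reasoning
    regroup : ∀ a b c d → a ℚ.* b ℚ.- c ℚ.* d ≡ a ℚ.* (b ℚ.- d) ℚ.+ d ℚ.* (a ℚ.- c)
    regroup = solve 4 (λ a b c d → a :* b :- c :* d := a :* (b :- d) :+ d :* (a :- c)) refl
      where open +-*-Solver

  *-cauchy : ∀ {s t} → IsCauchy s → IsCauchy t → IsCauchy (λ n → s n ℚ.* t n)
  *-cauchy {s} {t} cs ct ε 0<ε =
    let A , 0<A , M₁ , bdˢ = bounded cs
        B , 0<B , N₁ , bdᵗ = bounded ct
        δ , 0<δ , Aδ       = shrink A 0<A ε 0<ε
        η , 0<η , Bη       = shrink B 0<B ε 0<ε
        M₂ , closeˢ        = cs η 0<η
        N₂ , closeᵗ        = ct δ 0<δ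
        M = M₁ ℕ.⊔ M₂
        N = N₁ ℕ.⊔ N₂
    in M ℕ.⊔ N , λ {m} {n} ≤m ≤n →
      let M≤m = ℕ.m⊔n≤o⇒m≤o M N ≤m
          N≤m = ℕ.m⊔n≤o⇒n≤o M N ≤m
          M≤n = ℕ.m⊔n≤o⇒m≤o M N ≤n
          N≤n = ℕ.m⊔n≤o⇒n≤o M N ≤n
      in product-close (s m) (t m) (s n) (t n) {A} {B} {δ} {η} {ε} 0<A 0<B Aδ Bη
           (bdˢ (ℕ.m⊔n≤o⇒m≤o M₁ M₂ M≤m))
           (bdᵗ (ℕ.m⊔n≤o⇒m≤o N₁ N₂ N≤n))
           (closeˢ (ℕ.m⊔n≤o⇒n≤o M₁ M₂ M≤m) (ℕ.m⊔n≤o⇒n≤o M₁ M₂ M≤n))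
           (closeᵗ (ℕ.m⊔n≤o⇒n≤o N₁ N₂ N≤m) (ℕ.m⊔n≤o⇒n≤o N₁ N₂ N≤n))

infixl 6 _+_
infixl 7 _*_
infixr 8 _^_

fromℚ : ℚ → ℝ
fromℚ q = mkℝ (λ _ → q) λ ε 0<ε → 0 , λ _ _ →
  subst (ℚ._≤ ε) (cong ∣_∣ (sym (ℚ.+-inverseʳ q))) (ℚ.<⇒≤ 0<ε)

fromℕ : ℕ → ℝ
fromℕ k = fromℚ (+ k ℚ./ 1)

0ℝ 1ℝ : ℝ
0ℝ = fromℕ 0
1ℝ = fromℕ 1

_+_ : ℝ → ℝ → ℝ
x + y = mkℝ (λ n → seq x n ℚ.+ seq y n) (+-cauchy {seq x} {seq y} (cauchy x) (cauchy y))

_*_ : ℝ → ℝ → ℝ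
x * y = mkℝ (λ n → seq x n ℚ.* seq y n) (*-cauchy {seq x} {seq y} (cauchy x) (cauchy y))

_^_ : ℝ → ℕ → ℝ
x ^ zero  = 1ℝ
x ^ suc k = x * x ^ k

-- There are no independent sets of size greater than n.
I : ∀ {n} → Graph n → ℝ → ℝ
I {n} G x = foldr _+_ 0ℝ (map (λ k → fromℕ (#independent G k) * x ^ k) (upTo (suc n)))

-- ξ = ξ(G), the largest real root of I(G,x); it is also the root of smallest
-- modulus among all complex roots.
IsLargestRoot : ∀ {n} → Graph n → ℝ → Set
IsLargestRoot G ξ = I G ξ ≈ 0ℝ × (∀ y → I G y ≈ 0ℝ → y ≤ ξ)

-- ξ(G) exists for every graph with at least one vertex, and IsLargestRoot
-- determines it up to ≈, so the quantifier over ξ just names ξ(G).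
infix 4 _≼_
_≼_ : ∀ {m n} → Graph m → Graph n → Set
H ≼ G = ∀ ξ → IsLargestRoot G ξ → ∀ x → ξ ≤ x → x ≤ 0ℝ → I G x ≤ I H x

-- As I(H⋆, x) = (1 + x)ⁿ I(H, x/(1 + x)), graph stars are compared through their base graphs at
-- −t = x/(1 + x).  Stripping leaves from G shows that it has a perfect matching and an independent
-- set of size n, so Favaron's exchange property holds for the matched edges: they are pendant, with at
-- most one exception ab, which lies on a 4-cycle a b y x with a and b of degree 2.  Replacing ax
-- by bx then keeps the independence polynomial, so that G may be taken to be H⋆ with H unicyclic.
--
-- Beyond ξ all induced subgraphs have positive polynomials, since otherwise bisection
-- produces a larger root.  Write f(S) = I(H[S], −t).  Then f(S) decreases in S, and
-- the ratio f(S ∖ x)/f(S) of a connected set S is least for an end of a path, or for a vertex of a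
-- cycle if S contains one; adding to the cycle of H the other vertices one by one gives
-- I(H) ≤ I(Cₙ).  For I(H) ≥ I(Uₙ) one removes vertices of degree at most 1.
--
-- I has rational coefficients, so by continuity it is enough to compare at rational points.

module Submission where

open import Data.Bool.Base using (Bool; true; false; _∧_; _∨_; not; if_then_else_)
import Data.Bool.Properties as Bool
open import Data.Nat.Base as ℕ using (ℕ; zero; suc)
import Data.Nat.Properties as ℕ
import Data.Integer.Base as ℤ
import Data.Integer.Properties as ℤ
open import Data.Fin.Base as Fin using (Fin; zero; suc; toℕ)
import Data.Fin.Properties as Fin
import Data.Fin.Subset as Subset
import Data.Fin.Subset.Properties as Subset
open import Data.Rational.Base as ℚ using (ℚ; 0ℚ; 1ℚ; ½; _+_; _*_; _-_; -_; _≤_; _<_)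
import Data.Rational.Properties as ℚ
import Data.Rational.Unnormalised.Base as ℚᵘ
import Data.Rational.Unnormalised.Properties as ℚᵘ
open import Data.List.Base as List using (List; []; _∷_)
import Data.List.Properties as List
open import Data.Vec.Base as Vec using (Vec; []; _∷_)
import Data.Vec.Properties as Vec
open import Data.Product.Base using (_×_; _,_; ∃; proj₁; proj₂)
open import Data.Sum.Base as Sum using (_⊎_; inj₁; inj₂)
open import Data.Empty using (⊥; ⊥-elim)
open import Function.Base using (_∘_; id)
open import Relation.Binary.PropositionalEquality
  using (_≡_; _≢_; _≗_; refl; sym; trans; cong; cong₂; subst; subst₂; module ≡-Reasoning)
open import Function.Bundles using (Equivalence)
open import Relation.Binary.Construct.Closure.ReflexiveTransitive as Star using (Star; _◅_)
open import Relation.Nullary using (¬_; Dec; yes; no; does)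
open import Relation.Nullary.Decidable using (dec⇒maybe; _×-dec_; dec-true; dec-false)
open import Tactic.RingSolver using (solve-∀)
open import Tactic.RingSolver.Core.AlmostCommutativeRing using (AlmostCommutativeRing; fromCommutativeRing)
open import Defs as D hiding (_+_; _*_; _^_; _≤_; _≈_)

-- The ratio estimates cannot be proved for connected sets alone, because deleting a vertex may
-- disconnect them. They are stated for pairs `S`, `X` such that every component of `S` meets `X`: a
-- deleted vertex survives only through its neighbourhood `X`. The components are recombined by an
-- identity for the path and cycle polynomials, by which the product of the ratios for the parts is
-- at least the ratio for the total size. The numbers `P t k` and `C t k` are not known to be
-- positive in advance. Each estimate also forces the next number to be positive, so positivity and
-- bound are proved together. In the comparison with `U` the relevant interval is that of the star
-- of `U n`, where positivity is known for that star and not for `G`; the lower bound therefore has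
-- to produce the positivity of the subgraphs of `G` as well, size by size. The exceptional matched
-- edge is unique because two of them would make `G` a 4-cycle, which `3 ≤ n` excludes.

ℚ-ring : AlmostCommutativeRing _ _
ℚ-ring = fromCommutativeRing ℚ.+-*-commutativeRing (λ x → dec⇒maybe (0ℚ ℚ.≟ x))

-- Inequalities between rational numbers

0≤1 : 0ℚ ≤ 1ℚ
0≤1 = ℚ.nonNegative⁻¹ 1ℚ

0<1 : 0ℚ < 1ℚ
0<1 = ℚ.positive⁻¹ 1ℚ

0≤* : ∀ {a b} → 0ℚ ≤ a → 0ℚ ≤ b → 0ℚ ≤ a * b
0≤* {a} {b} 0≤a 0≤b =
  ℚ.nonNegative⁻¹ (a * b) {{ℚ.nonNeg*nonNeg⇒nonNeg a {{ℚ.nonNegative 0≤a}} b {{ℚ.nonNegative 0≤b}}}}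

0<* : ∀ {a b} → 0ℚ < a → 0ℚ < b → 0ℚ < a * b
0<* {a} {b} 0<a 0<b = ℚ.positive⁻¹ (a * b) {{ℚ.pos*pos⇒pos a {{ℚ.positive 0<a}} b {{ℚ.positive 0<b}}}}

0≤+ : ∀ {a b} → 0ℚ ≤ a → 0ℚ ≤ b → 0ℚ ≤ a + b
0≤+ = ℚ.+-mono-≤

0<+ : ∀ {a b} → 0ℚ < a → 0ℚ ≤ b → 0ℚ < a + b
0<+ = ℚ.+-mono-<-≤

≤⇒0≤ : ∀ {a b} → a ≤ b → 0ℚ ≤ b - a
≤⇒0≤ {a} {b} a≤b = subst (_≤ b - a) (ℚ.+-inverseʳ a) (ℚ.+-monoˡ-≤ (- a) a≤b)

<⇒0< : ∀ {a b} → a < b → 0ℚ < b - a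
<⇒0< {a} {b} a<b = subst (_< b - a) (ℚ.+-inverseʳ a) (ℚ.+-monoˡ-< (- a) a<b)

-- Most inequalities below are proved by exhibiting the difference `c` of the two sides: its sign is
-- checked by hand and the remaining identity is left to the ring solver.
≤-via : ∀ {a b} c → 0ℚ ≤ c → b ≡ a + c → a ≤ b
≤-via {a} c 0≤c b≡a+c = ℚ.≤-trans (ℚ.≤-reflexive (sym (ℚ.+-identityʳ a)))
  (subst (a + 0ℚ ≤_) (sym b≡a+c) (ℚ.+-monoʳ-≤ a 0≤c))

<-via : ∀ {a b} c → 0ℚ < c → b ≡ a + c → a < b
<-via {a} c 0<c b≡a+c = ℚ.≤-<-trans (ℚ.≤-reflexive (sym (ℚ.+-identityʳ a)))
  (subst (a + 0ℚ <_) (sym b≡a+c) (ℚ.+-monoʳ-< a 0<c))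

0≤⇒≤ : ∀ {a b} → 0ℚ ≤ b - a → a ≤ b
0≤⇒≤ {a} {b} p = ≤-via (b - a) p (eq a b)
  where
  eq : ∀ a b → b ≡ a + (b - a)
  eq = solve-∀ ℚ-ring

*-monoˡ : ∀ {a x y} → 0ℚ ≤ a → x ≤ y → a * x ≤ a * y
*-monoˡ {a} 0≤a = ℚ.*-monoˡ-≤-nonNeg a {{ℚ.nonNegative 0≤a}}

*-mono : ∀ {a b x y} → 0ℚ ≤ a → 0ℚ ≤ y → a ≤ b → x ≤ y → a * x ≤ b * y
*-mono {a} {b} {x} {y} 0≤a 0≤y a≤b x≤y =
  ℚ.≤-trans (*-monoˡ 0≤a x≤y) (ℚ.*-monoʳ-≤-nonNeg y {{ℚ.nonNegative 0≤y}} a≤b)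

*-cancelˡ : ∀ {a x y} → 0ℚ < a → a * x ≤ a * y → x ≤ y
*-cancelˡ {a} 0<a = ℚ.*-cancelˡ-≤-pos a {{ℚ.positive 0<a}}

0<-cancelˡ : ∀ {a x} → 0ℚ < a → 0ℚ < a * x → 0ℚ < x
0<-cancelˡ {a} {x} 0<a p =
  ℚ.*-cancelˡ-<-nonNeg a {{ℚ.pos⇒nonNeg a {{ℚ.positive 0<a}}}}
    (subst (_< a * x) (sym (ℚ.*-zeroʳ a)) p)

infixr 8 _^_
_^_ : ℚ → ℕ → ℚ
q ^ zero  = 1ℚ
q ^ suc k = q * q ^ k

0<^ : ∀ {q} k → 0ℚ < q → 0ℚ < q ^ k
0<^ zero    0<q = 0<1
0<^ (suc k) 0<q = 0<* 0<q (0<^ k 0<q)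

-- Finite sets

module _ where
  Sub : ℕ → Set
  Sub n = Fin n → Bool

  private variable
    n : ℕ
    R S T S′ T′ : Sub n
    u v x : Fin n

  infix 4 _∈_ _∉_ _⊆_
  record _∈_ {n} (v : Fin n) (S : Sub n) : Set where
    constructor in!
    field holds : S v ≡ true
  record _∉_ {n} (v : Fin n) (S : Sub n) : Set where
    constructor out!
    field fails : S v ≡ false
  open _∈_ public
  open _∉_ public

  _⊆_ : Sub n → Sub n → Set
  S ⊆ T = ∀ {v} → v ∈ S → v ∈ T

  -- Membership is a record and the operations are opaque so that unification can recover
  -- the sets from the types v ∈ S ∖ T.
  infixl 7 _∖_ _∩_
  infixl 6 _∪_
  opaque
    _∖_ _∩_ _∪_ : Sub n → Sub n → Sub n
    (S ∖ T) v = S v ∧ not (T v)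
    (S ∩ T) v = S v ∧ T v
    (S ∪ T) v = S v ∨ T v

    ∁ : Sub n → Sub n
    ∁ S v = not (S v)

  ⁅_⁆ : Fin n → Sub n
  ⁅ x ⁆ v = does (v Fin.≟ x)

  full : Sub n
  full _ = true

  ∈? : ∀ (S : Sub n) v → v ∈ S ⊎ v ∉ S
  ∈? S v with S v in eq
  ... | true  = inj₁ (in! eq)
  ... | false = inj₂ (out! eq)

  ∈-∉ : {A : Set} → v ∈ S → v ∉ S → A
  ∈-∉ (in! p) (out! q) with trans (sym p) q
  ... | ()

  ∈-∉-≢ : u ∈ S → v ∉ S → u ≢ v
  ∈-∉-≢ p q refl = ∈-∉ p q

  ¬∈⇒∉ : ¬ (v ∈ S) → v ∉ S
  ¬∈⇒∉ {v = v} {S} ¬p with ∈? S v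
  ... | inj₁ p = ⊥-elim (¬p p)
  ... | inj₂ q = q

  opaque
    unfolding _∖_

    ∈-∖ : v ∈ S → v ∉ T → v ∈ S ∖ T
    ∈-∖ (in! p) (out! q) = in! (cong₂ (λ a b → a ∧ not b) p q)

    ∖-∈ : v ∈ S ∖ T → v ∈ S × v ∉ T
    ∖-∈ {v = v} {S} {T} (in! p) with S v in eq | T v in eq′
    ... | true | false = in! eq , out! eq′

    ∉-∖ˡ : v ∉ S → v ∉ S ∖ T
    ∉-∖ˡ (out! p) = out! (cong (_∧ _) p)

  ∉-∖ʳ : v ∈ T → v ∉ S ∖ T
  ∉-∖ʳ v∈T = ¬∈⇒∉ λ p → ∈-∉ v∈T (proj₂ (∖-∈ p))

  opaque
    unfolding _∖_

    ∈-∩ : v ∈ S → v ∈ T → v ∈ S ∩ T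
    ∈-∩ (in! p) (in! q) = in! (cong₂ _∧_ p q)

    ∩-∈ : v ∈ S ∩ T → v ∈ S × v ∈ T
    ∩-∈ {v = v} {S} {T} (in! p) with S v in eq | T v in eq′
    ... | true | true = in! eq , in! eq′

    ∈-∪ˡ : v ∈ S → v ∈ S ∪ T
    ∈-∪ˡ (in! p) = in! (cong (_∨ _) p)

    ∈-∪ʳ : v ∈ T → v ∈ S ∪ T
    ∈-∪ʳ {S = S} (in! p) = in! (trans (cong (_ ∨_) p) (Bool.∨-zeroʳ _))

    ∪-∈ : v ∈ S ∪ T → v ∈ S ⊎ v ∈ T
    ∪-∈ {v = v} {S} (in! p) with S v in eq
    ... | true  = inj₁ (in! eq)
    ... | false = inj₂ (in! p)

    ∈-∁ : v ∉ S → v ∈ ∁ S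
    ∈-∁ (out! p) = in! (cong not p)

    ∁-∈ : v ∈ ∁ S → v ∉ S
    ∁-∈ {v = v} {S} (in! p) with S v in eq
    ... | false = out! eq

    ∈-⁅⁆ : ∀ (x : Fin n) → x ∈ ⁅ x ⁆
    ∈-⁅⁆ x = in! (dec-true (x Fin.≟ x) refl)

    ⁅⁆-∈ : v ∈ ⁅ x ⁆ → v ≡ x
    ⁅⁆-∈ {v = v} {x} (in! p) with v Fin.≟ x
    ... | yes v≡x = v≡x

    ∉-⁅⁆ : v ≢ x → v ∉ ⁅ x ⁆
    ∉-⁅⁆ {v = v} {x} v≢x = out! (dec-false (v Fin.≟ x) v≢x)

  ⁅⁆-∉ : v ∉ ⁅ x ⁆ → v ≢ x
  ⁅⁆-∉ {x = x} p refl = ∈-∉ (∈-⁅⁆ x) p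

  ∈-∖x : v ∈ S → v ≢ x → v ∈ S ∖ ⁅ x ⁆
  ∈-∖x p v≢x = ∈-∖ p (∉-⁅⁆ v≢x)

  ∖x-∈ : v ∈ S ∖ ⁅ x ⁆ → v ∈ S × v ≢ x
  ∖x-∈ p = proj₁ (∖-∈ p) , ⁅⁆-∉ (proj₂ (∖-∈ p))

  ∈-full : v ∈ full
  ∈-full = in! refl

  ∖-⊆ : S ∖ T ⊆ S
  ∖-⊆ p = proj₁ (∖-∈ p)

  ∩-⊆ˡ : S ∩ T ⊆ S
  ∩-⊆ˡ p = proj₁ (∩-∈ p)

  ⊆-refl : S ⊆ S
  ⊆-refl p = p

  ⊆-trans : R ⊆ S → S ⊆ T → R ⊆ T
  ⊆-trans R⊆S S⊆T p = S⊆T (R⊆S p)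

  ∖-mono : S ⊆ S′ → T′ ⊆ T → S ∖ T ⊆ S′ ∖ T′
  ∖-mono S⊆S′ T′⊆T p with ∖-∈ p
  ... | v∈S , v∉T = ∈-∖ (S⊆S′ v∈S) (¬∈⇒∉ λ v∈T′ → ∈-∉ (T′⊆T v∈T′) v∉T)

  ⊆-antisym : S ⊆ T → T ⊆ S → S ≗ T
  ⊆-antisym {S = S} {T} S⊆T T⊆S v with ∈? S v | ∈? T v
  ... | inj₁ p | _      = trans (holds p) (sym (holds (S⊆T p)))
  ... | inj₂ p | inj₁ q = trans (holds (T⊆S q)) (sym (holds q))
  ... | inj₂ p | inj₂ q = trans (fails p) (sym (fails q))

  ≗⇒⊆ : S ≗ T → S ⊆ T
  ≗⇒⊆ S≗T (in! p) = in! (trans (sym (S≗T _)) p)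

  some? : ∀ (S : Sub n) → ∃ (_∈ S) ⊎ (∀ v → v ∉ S)
  some? S with Fin.any? (λ v → S v Bool.≟ true)
  ... | yes (v , p) = inj₁ (v , in! p)
  ... | no ¬p       = inj₂ (λ v → ¬∈⇒∉ λ v∈S → ¬p (v , holds v∈S))

  bit : Bool → ℕ
  bit b = if b then 1 else 0

  opaque
    unfolding _∖_

    card : Sub n → ℕ
    card {zero}  S = 0
    card {suc n} S = bit (S zero) ℕ.+ card (S ∘ suc)

    card-cong : S ≗ T → card S ≡ card T
    card-cong {zero}  S≗T = refl
    card-cong {suc n} S≗T = cong₂ ℕ._+_ (cong bit (S≗T zero)) (card-cong (S≗T ∘ suc))

    card-split : ∀ (S T : Sub n) → card S ≡ card (S ∩ T) ℕ.+ card (S ∖ T)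
    card-split {zero}  S T = refl
    card-split {suc n} S T with S zero | T zero
    ... | true  | true  = cong suc (card-split (S ∘ suc) (T ∘ suc))
    ... | true  | false = trans (cong suc (card-split (S ∘ suc) (T ∘ suc))) (sym (ℕ.+-suc _ _))
    ... | false | _     = card-split (S ∘ suc) (T ∘ suc)

    card-remove : ∀ (S : Sub n) x → x ∈ S → card S ≡ suc (card (S ∖ ⁅ x ⁆))
    card-remove S zero    (in! x∈S) rewrite x∈S = cong suc (card-cong λ v → sym (Bool.∧-identityʳ (S (suc v))))
    card-remove S (suc x) (in! x∈S) with S zero
    ... | true  = cong suc (card-remove (S ∘ suc) x (in! x∈S))
    ... | false = card-remove (S ∘ suc) x (in! x∈S)

    card-none : (∀ v → v ∉ S) → card S ≡ 0
    card-none {zero}  none = refl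
    card-none {suc n} none rewrite fails (none zero) = card-none (λ v → out! (fails (none (suc v))))

    card-full : card {n} full ≡ n
    card-full {zero}  = refl
    card-full {suc n} = cong suc card-full

  insert-remove : x ∉ S → (S ∪ ⁅ x ⁆) ∖ ⁅ x ⁆ ≗ S
  insert-remove x∉S = ⊆-antisym
    (λ p → Sum.[ id , (λ v∈x → ∈-∉ v∈x (proj₂ (∖-∈ p))) ]′ (∪-∈ (∖-⊆ p)))
    (λ p → ∈-∖x (∈-∪ˡ p) λ { refl → ∈-∉ p x∉S })

  card-insert : ∀ (S : Sub n) x → x ∉ S → card (S ∪ ⁅ x ⁆) ≡ suc (card S)
  card-insert S x x∉S = trans (card-remove (S ∪ ⁅ x ⁆) x (∈-∪ʳ (∈-⁅⁆ x)))
                              (cong suc (card-cong (insert-remove x∉S)))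

  card-mono : ∀ (S T : Sub n) → S ⊆ T → card S ℕ.≤ card T
  card-mono S T S⊆T = subst (ℕ._≤ card T)
    (card-cong (⊆-antisym (λ p → proj₂ (∩-∈ p)) (λ p → ∈-∩ (S⊆T p) p)))
    (subst (card (T ∩ S) ℕ.≤_) (sym (card-split T S)) (ℕ.m≤m+n (card (T ∩ S)) _))

  card≡0 : ∀ (S : Sub n) → card S ≡ 0 → ∀ v → v ∉ S
  card≡0 S c v = ¬∈⇒∉ λ v∈S → ℕ.1+n≢0 (trans (sym (card-remove S v v∈S)) c)

  card-injection : ∀ {A B : Sub n} (g : Fin n → Fin n) → (∀ {v} → v ∈ A → g v ∈ B) →
    (∀ {u v} → u ∈ A → v ∈ A → g u ≡ g v → u ≡ v) → card A ℕ.≤ card B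
  card-injection {A = A} g maps inj = go (card A) refl maps inj
    where
    go : ∀ k {A B} → card A ≡ k → (∀ {v} → v ∈ A → g v ∈ B) →
      (∀ {u v} → u ∈ A → v ∈ A → g u ≡ g v → u ≡ v) → card A ℕ.≤ card B
    go zero    c maps inj = subst (ℕ._≤ _) (sym c) ℕ.z≤n
    go (suc k) {A} {B} c maps inj with some? A
    ... | inj₂ none = subst (ℕ._≤ card B) (sym (card-none none)) ℕ.z≤n
    ... | inj₁ (x , x∈A) = subst₂ ℕ._≤_ (sym (card-remove A x x∈A)) (sym (card-remove B (g x) (maps x∈A)))
      (ℕ.s≤s (go k (ℕ.suc-injective (trans (sym (card-remove A x x∈A)) c))
        (λ v∈ → let v∈A , v≢x = ∖x-∈ v∈ in ∈-∖x (maps v∈A) (λ e → v≢x (inj v∈A x∈A e)))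
        (λ u∈ v∈ → inj (∖-⊆ u∈) (∖-⊆ v∈))))

  ∪-skip : v ≢ x → (S ∪ ⁅ x ⁆) v ≡ S v
  ∪-skip {v = v} {x = x} {S = S} v≢x with ∈? S v
  ... | inj₁ v∈S = trans (holds (∈-∪ˡ v∈S)) (sym (holds v∈S))
  ... | inj₂ v∉S = trans (fails (¬∈⇒∉ λ p → Sum.[ (λ q → ∈-∉ q v∉S) , (λ q → v≢x (⁅⁆-∈ q)) ]′ (∪-∈ p))) (sym (fails v∉S))

  -- The multivariate independence polynomial

  Adj : ℕ → Set
  Adj n = Fin n → Fin n → Bool

  Sym : Adj n → Set
  Sym E = ∀ u v → E u v ≡ E v u

  shift : Adj (suc n) → Adj n
  shift E i j = E (suc i) (suc j)

  cut : Sub n → (Fin n → ℚ) → Fin n → ℚ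
  cut X w v = if X v then 0ℚ else w v

  -- The multivariate independence polynomial Σ ∏ w(v), summed over the independent sets.
  Z : Adj n → (Fin n → ℚ) → ℚ
  Z {zero}  E w = 1ℚ
  Z {suc n} E w = Z (shift E) (w ∘ suc) + w zero * Z (shift E) (cut (E zero ∘ suc) (w ∘ suc))

  cut-cong : ∀ {X : Sub n} {w w′} → w ≗ w′ → cut X w ≗ cut X w′
  cut-cong {X = X} w≗w′ v with X v
  ... | true  = refl
  ... | false = w≗w′ v

  cut-comm : ∀ (X Y : Sub n) w → cut X (cut Y w) ≗ cut Y (cut X w)
  cut-comm X Y w v with X v | Y v
  ... | true  | true  = refl
  ... | true  | false = refl
  ... | false | _     = refl

  cut-zero : ∀ (X : Sub n) w v → w v ≡ 0ℚ → cut X w v ≡ 0ℚ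
  cut-zero X w v p with X v
  ... | true  = refl
  ... | false = p

  cut-∈ : ∀ {X : Sub n} {w v} → v ∈ X → cut X w v ≡ 0ℚ
  cut-∈ (in! p) rewrite p = refl

  cut-∉ : ∀ {X : Sub n} {w v} → v ∉ X → cut X w v ≡ w v
  cut-∉ (out! p) rewrite p = refl

  Z-cong : ∀ (E : Adj n) {w w′} → w ≗ w′ → Z E w ≡ Z E w′
  Z-cong {zero}  E w≗w′ = refl
  Z-cong {suc n} E {w} {w′} w≗w′ = cong₂ _+_ (Z-cong (shift E) (w≗w′ ∘ suc))
    (cong₂ _*_ (w≗w′ zero) (Z-cong (shift E) (cut-cong {X = E zero ∘ suc} (w≗w′ ∘ suc))))

  -- Only edges between vertices of nonzero activity matter. Two graphs on the same vertices can
  -- thus be compared once the vertices where they differ have been given the activity 0.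
  Z-adj : ∀ (E F : Adj n) w → (∀ i j → E i j ≡ F i j ⊎ w i ≡ 0ℚ ⊎ w j ≡ 0ℚ) → Z E w ≡ Z F w
  Z-adj {zero}  E F w h = refl
  Z-adj {suc n} E F w h = cong₂ _+_ (Z-adj (shift E) (shift F) (w ∘ suc) (λ i j → h (suc i) (suc j))) tail
    where
    tail : w zero * Z (shift E) (cut (E zero ∘ suc) (w ∘ suc)) ≡
           w zero * Z (shift F) (cut (F zero ∘ suc) (w ∘ suc))
    tail with w zero ℚ.≟ 0ℚ
    ... | yes w₀≡0 rewrite w₀≡0 = trans (ℚ.*-zeroˡ (Z (shift E) (cut (E zero ∘ suc) (w ∘ suc)))) (sym (ℚ.*-zeroˡ (Z (shift F) (cut (F zero ∘ suc) (w ∘ suc)))))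
    ... | no  w₀≢0 = cong (w zero *_) (trans
      (Z-adj (shift E) (shift F) _ λ i j → Sum.map₂
        (Sum.map (cut-zero (E zero ∘ suc) (w ∘ suc) i) (cut-zero (E zero ∘ suc) (w ∘ suc) j))
        (h (suc i) (suc j)))
      (Z-cong (shift F) λ v → same v (h zero (suc v))))
      where
      same : ∀ v → E zero (suc v) ≡ F zero (suc v) ⊎ w zero ≡ 0ℚ ⊎ w (suc v) ≡ 0ℚ →
        cut (E zero ∘ suc) (w ∘ suc) v ≡ cut (F zero ∘ suc) (w ∘ suc) v
      same v (inj₁ e)        rewrite e = refl
      same v (inj₂ (inj₁ e)) = ⊥-elim (w₀≢0 e)
      same v (inj₂ (inj₂ e)) =
        trans (cut-zero (E zero ∘ suc) (w ∘ suc) v e) (sym (cut-zero (F zero ∘ suc) (w ∘ suc) v e))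

  -- The definition of `Z` expands at the vertex `zero`; here the vertex is arbitrary. Expanding at
  -- `zero` and at `suc y` in either order gives the same four terms.
  Z-expand : ∀ (E : Adj n) → Sym E → ∀ w x →
    Z E w ≡ Z E (cut ⁅ x ⁆ w) + w x * Z E (cut (E x) (cut ⁅ x ⁆ w))
  Z-expand {suc n} E E-sym w zero = begin
    Z E′ w′ + w zero * Z E′ (cut E₀ w′)
      ≡⟨ cong (Z E′ w′ +_) (cong (w zero *_) inner) ⟩
    Z E′ w′ + w zero * Z E (cut (E zero) (cut ⁅ zero ⁆ w))
      ≡⟨ cong (_+ w zero * Z E (cut (E zero) (cut ⁅ zero ⁆ w))) outer ⟩
    Z E (cut ⁅ zero ⁆ w) + w zero * Z E (cut (E zero) (cut ⁅ zero ⁆ w)) ∎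
    where
    open ≡-Reasoning
    E′ = shift E
    w′ = w ∘ suc
    E₀ = E zero ∘ suc
    drop₀ : ∀ a b c → c ≡ 0ℚ → a ≡ a + c * b
    drop₀ a b c refl = eq a b
      where
      eq : ∀ a b → a ≡ a + 0ℚ * b
      eq = solve-∀ ℚ-ring
    outer : Z E′ w′ ≡ Z E (cut ⁅ zero ⁆ w)
    outer = drop₀ _ (Z E′ (cut E₀ w′)) 0ℚ refl
    inner : Z E′ (cut E₀ w′) ≡ Z E (cut (E zero) (cut ⁅ zero ⁆ w))
    inner = drop₀ _ _ _ (cut-zero (E zero) (cut ⁅ zero ⁆ w) zero refl)
  Z-expand {suc n} E E-sym w (suc y) = begin
    Z E′ w′ + w₀ * Z E′ (cut E₀ w′)
      ≡⟨ cong₂ (λ a b → a + w₀ * b) (Z-expand E′ E′-sym w′ y) (Z-expand E′ E′-sym (cut E₀ w′) y) ⟩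
    (a + w′ y * b) + w₀ * (Z E′ (cut ⁅ y ⁆ (cut E₀ w′)) + cut E₀ w′ y * Z E′ (cut (E′ y) (cut ⁅ y ⁆ (cut E₀ w′))))
      ≡⟨ cong₂ (λ c d → (a + w′ y * b) + w₀ * (c + cut E₀ w′ y * d))
           (Z-cong E′ (cut-comm ⁅ y ⁆ E₀ w′))
           (Z-cong E′ λ v → trans (cut-cong {X = E′ y} (cut-comm ⁅ y ⁆ E₀ w′) v)
                                  (cut-comm (E′ y) E₀ (cut ⁅ y ⁆ w′) v)) ⟩
    (a + w′ y * b) + w₀ * (c + cut E₀ w′ y * d)
      ≡⟨ regroup ⟩
    (a + w₀ * c) + w′ y * (b + cut (E (suc y)) (cut ⁅ suc y ⁆ w) zero * d) ∎
    where
    open ≡-Reasoning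
    E′ = shift E
    w′ = w ∘ suc
    w₀ = w zero
    E₀ = E zero ∘ suc
    E′-sym : Sym E′
    E′-sym u v = E-sym (suc u) (suc v)
    a = Z E′ (cut ⁅ y ⁆ w′)
    b = Z E′ (cut (E′ y) (cut ⁅ y ⁆ w′))
    c = Z E′ (cut E₀ (cut ⁅ y ⁆ w′))
    d = Z E′ (cut E₀ (cut (E′ y) (cut ⁅ y ⁆ w′)))
    eq₀ : ∀ a b c d w₀ wy → (a + wy * b) + w₀ * (c + 0ℚ * d) ≡ (a + w₀ * c) + wy * (b + 0ℚ * d)
    eq₀ = solve-∀ ℚ-ring
    eq₁ : ∀ a b c d w₀ wy → (a + wy * b) + w₀ * (c + wy * d) ≡ (a + w₀ * c) + wy * (b + w₀ * d)
    eq₁ = solve-∀ ℚ-ring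
    -- The term `d`, in which both vertices are chosen, has to vanish on both sides together. The
    -- left side reads the edge from `zero`, the right side from `suc y`, which is where symmetry
    -- enters.
    regroup : (a + w′ y * b) + w₀ * (c + cut E₀ w′ y * d) ≡
              (a + w₀ * c) + w′ y * (b + cut (E (suc y)) (cut ⁅ suc y ⁆ w) zero * d)
    regroup rewrite E-sym (suc y) zero with E zero (suc y)
    ... | true  = eq₀ a b c d w₀ (w′ y)
    ... | false = eq₁ a b c d w₀ (w′ y)

  -- Expanding at `zero` changes only the factor of the side on which `zero` lies. The alternatives
  -- with activity 0 are needed because deleted vertices remain present with activity 0.
  Z-mult : ∀ (E : Adj n) → Sym E → ∀ (A : Sub n) w →
    (∀ i j → i ∈ A → j ∉ A → E i j ≡ false ⊎ w i ≡ 0ℚ ⊎ w j ≡ 0ℚ) →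
    Z E w ≡ Z E (cut (not ∘ A) w) * Z E (cut A w)
  Z-mult {zero}  E E-sym A w h = refl
  Z-mult {suc n} E E-sym A w h = go (A zero) refl
    where
    E′ = shift E
    w′ = w ∘ suc
    A′ = A ∘ suc
    E₀ = E zero ∘ suc
    E′-sym : Sym E′
    E′-sym u v = E-sym (suc u) (suc v)
    u₁ = Z E′ (cut (not ∘ A′) w′)
    u₂ = Z E′ (cut A′ w′)
    u₃ = Z E′ (cut E₀ (cut (not ∘ A′) w′))
    u₄ = Z E′ (cut E₀ (cut A′ w′))
    rec₁ : Z E′ w′ ≡ u₁ * u₂
    rec₁ = Z-mult E′ E′-sym A′ w′ (λ i j i∈A j∉A → h (suc i) (suc j) (in! (holds i∈A)) (out! (fails j∉A)))
    rec₂ : Z E′ (cut E₀ w′) ≡ u₃ * u₄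
    rec₂ = trans (Z-mult E′ E′-sym A′ (cut E₀ w′) λ i j i∈A j∉A → Sum.map₂
                   (Sum.map (cut-zero E₀ w′ i) (cut-zero E₀ w′ j)) (h (suc i) (suc j) (in! (holds i∈A)) (out! (fails j∉A))))
                 (cong₂ _*_ (Z-cong E′ (cut-comm (not ∘ A′) E₀ w′)) (Z-cong E′ (cut-comm A′ E₀ w′)))
    vanish : w zero ≡ 0ℚ → ∀ x y → w zero * x ≡ w zero * y
    vanish e x y rewrite e = trans (ℚ.*-zeroˡ x) (sym (ℚ.*-zeroˡ y))
    eq₁ : ∀ a b c w₀ → a * b + w₀ * (c * b) ≡ (a + w₀ * c) * (b + 0ℚ * c)
    eq₁ = solve-∀ ℚ-ring
    eq₂ : ∀ a b c w₀ → a * b + w₀ * (a * c) ≡ (a + 0ℚ * c) * (b + w₀ * c)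
    eq₂ = solve-∀ ℚ-ring
    -- On the opposite side `zero` has no neighbour of nonzero activity, so that cutting its
    -- neighbourhood changes nothing there. If `w zero` is 0 the whole term disappears instead.
    spare : ∀ (B : Sub n) → (∀ v → v ∉ B → E zero (suc v) ≡ false ⊎ w zero ≡ 0ℚ ⊎ w′ v ≡ 0ℚ) →
      w zero ≢ 0ℚ → Z E′ (cut E₀ (cut B w′)) ≡ Z E′ (cut B w′)
    spare B k w₀≢0 = Z-cong E′ λ v → eq v (∈? B v)
      where
      eq : ∀ v → v ∈ B ⊎ v ∉ B → cut E₀ (cut B w′) v ≡ cut B w′ v
      eq v (inj₁ v∈B) = trans (cut-zero E₀ (cut B w′) v (cut-∈ {X = B} {w′} v∈B)) (sym (cut-∈ {X = B} {w′} v∈B))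
      eq v (inj₂ v∉B) with k v v∉B
      ... | inj₁ e        rewrite e = refl
      ... | inj₂ (inj₁ e) = ⊥-elim (w₀≢0 e)
      ... | inj₂ (inj₂ e) = trans (cut-zero E₀ (cut B w′) v (cut-zero B w′ v e)) (sym (cut-zero B w′ v e))
    go : ∀ b → A zero ≡ b → Z E w ≡ Z E (cut (not ∘ A) w) * Z E (cut A w)
    go true e rewrite e = begin
      Z E′ w′ + w zero * Z E′ (cut E₀ w′) ≡⟨ cong₂ (λ a b → a + w zero * b) rec₁ rec₂ ⟩
      u₁ * u₂ + w zero * (u₃ * u₄)        ≡⟨ cong (u₁ * u₂ +_) merge ⟩
      u₁ * u₂ + w zero * (u₃ * u₂)        ≡⟨ eq₁ u₁ u₂ u₃ (w zero) ⟩
      (u₁ + w zero * u₃) * (u₂ + 0ℚ * u₃) ≡⟨ cong (λ z → (u₁ + w zero * u₃) * (u₂ + z)) (trans (ℚ.*-zeroˡ u₃) (sym (ℚ.*-zeroˡ u₄))) ⟩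
      (u₁ + w zero * u₃) * (u₂ + 0ℚ * u₄) ∎
      where
      open ≡-Reasoning
      merge : w zero * (u₃ * u₄) ≡ w zero * (u₃ * u₂)
      merge with w zero ℚ.≟ 0ℚ
      ... | yes e₀ = vanish e₀ _ _
      ... | no  ne = cong (λ z → w zero * (u₃ * z)) (spare A′ (λ v v∉A → h zero (suc v) (in! e) (out! (fails v∉A))) ne)
    go false e rewrite e = begin
      Z E′ w′ + w zero * Z E′ (cut E₀ w′) ≡⟨ cong₂ (λ a b → a + w zero * b) rec₁ rec₂ ⟩
      u₁ * u₂ + w zero * (u₃ * u₄)        ≡⟨ cong (u₁ * u₂ +_) merge ⟩
      u₁ * u₂ + w zero * (u₁ * u₄)        ≡⟨ eq₂ u₁ u₂ u₄ (w zero) ⟩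
      (u₁ + 0ℚ * u₄) * (u₂ + w zero * u₄) ≡⟨ cong (λ z → (u₁ + z) * (u₂ + w zero * u₄)) (trans (ℚ.*-zeroˡ u₄) (sym (ℚ.*-zeroˡ u₃))) ⟩
      (u₁ + 0ℚ * u₃) * (u₂ + w zero * u₄) ∎
      where
      open ≡-Reasoning
      swap₃ : ∀ {v} → E (suc v) zero ≡ false ⊎ w′ v ≡ 0ℚ ⊎ w zero ≡ 0ℚ →
              E zero (suc v) ≡ false ⊎ w zero ≡ 0ℚ ⊎ w′ v ≡ 0ℚ
      swap₃ {v} (inj₁ p)    = inj₁ (trans (E-sym zero (suc v)) p)
      swap₃ (inj₂ (inj₁ p)) = inj₂ (inj₂ p)
      swap₃ (inj₂ (inj₂ p)) = inj₂ (inj₁ p)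
      not-false : ∀ b → not b ≡ false → b ≡ true
      not-false true _ = refl
      merge : w zero * (u₃ * u₄) ≡ w zero * (u₁ * u₄)
      merge with w zero ℚ.≟ 0ℚ
      ... | yes e₀ = vanish e₀ _ _
      ... | no  ne = cong (λ z → w zero * (z * u₄))
                       (spare (not ∘ A′) (λ v p → swap₃ (h (suc v) zero (in! (not-false _ (fails p))) (out! e))) ne)

  -- Induced subgraphs are encoded by activities: a vertex outside `S` gets the activity 0. All of
  -- them then share the same vertices and the same `E`.
  ind : ℚ → Sub n → Fin n → ℚ
  ind y S v = if S v then y else 0ℚ

  ind-∈ : ∀ {y} {S : Sub n} {v} → v ∈ S → ind y S v ≡ y
  ind-∈ (in! p) rewrite p = refl

  ind-∉ : ∀ {y} {S : Sub n} {v} → v ∉ S → ind y S v ≡ 0ℚ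
  ind-∉ (out! p) rewrite p = refl

  opaque
    unfolding _∖_

    cut-ind : ∀ y (X S : Sub n) → cut X (ind y S) ≗ ind y (S ∖ X)
    cut-ind y X S v with S v | X v
    ... | true  | true  = refl
    ... | true  | false = refl
    ... | false | true  = refl
    ... | false | false = refl

    cut-∁-ind : ∀ y (A S : Sub n) → cut (not ∘ A) (ind y S) ≗ ind y (S ∩ A)
    cut-∁-ind y A S v with S v | A v
    ... | true  | true  = refl
    ... | true  | false = refl
    ... | false | true  = refl
    ... | false | false = refl

  Z-none : ∀ (E : Adj n) {w} → (∀ v → w v ≡ 0ℚ) → Z E w ≡ 1ℚ
  Z-none {zero}  E none = refl
  Z-none {suc n} E {w} none rewrite none zero | Z-none (shift E) (none ∘ suc) = eq (Z (shift E) (cut (E zero ∘ suc) (w ∘ suc)))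
    where
    eq : ∀ z → 1ℚ + 0ℚ * z ≡ 1ℚ
    eq = solve-∀ ℚ-ring

  module Weighted {n} (E : Adj n) (E-sym : Sym E) (t : ℚ) where

    f : Sub n → ℚ
    f S = Z E (ind (- t) S)

    f-cong : ∀ {S T} → S ≗ T → f S ≡ f T
    f-cong S≗T = Z-cong E λ v → cong (λ b → if b then - t else 0ℚ) (S≗T v)

    f-none : ∀ {S} → (∀ v → v ∉ S) → f S ≡ 1ℚ
    f-none none = Z-none E (λ v → ind-∉ (none v))

    f-remove : ∀ {S x} → x ∈ S → f S ≡ f (S ∖ ⁅ x ⁆) - t * f ((S ∖ ⁅ x ⁆) ∖ E x)
    f-remove {S} {x} x∈S = begin
      f S
        ≡⟨ Z-expand E E-sym (ind (- t) S) x ⟩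
      Z E (cut ⁅ x ⁆ (ind (- t) S)) + ind (- t) S x * Z E (cut (E x) (cut ⁅ x ⁆ (ind (- t) S)))
        ≡⟨ cong₂ _+_ (Z-cong E (cut-ind (- t) ⁅ x ⁆ S)) (cong₂ _*_ (ind-∈ x∈S)
             (Z-cong E λ v → trans (cut-cong {X = E x} (cut-ind (- t) ⁅ x ⁆ S) v)
                                   (cut-ind (- t) (E x) (S ∖ ⁅ x ⁆) v))) ⟩
      f (S ∖ ⁅ x ⁆) + (- t) * f ((S ∖ ⁅ x ⁆) ∖ E x)
        ≡⟨ eq (f (S ∖ ⁅ x ⁆)) t (f ((S ∖ ⁅ x ⁆) ∖ E x)) ⟩
      f (S ∖ ⁅ x ⁆) - t * f ((S ∖ ⁅ x ⁆) ∖ E x) ∎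
      where
      open ≡-Reasoning
      eq : ∀ a t b → a + (- t) * b ≡ a - t * b
      eq = solve-∀ ℚ-ring

    f-mult : ∀ {S} A → (∀ {u v} → u ∈ S ∩ A → v ∈ S ∖ A → E u v ≡ false) → f S ≡ f (S ∩ A) * f (S ∖ A)
    f-mult {S} A sep = trans (Z-mult E E-sym A (ind (- t) S) absent) (cong₂ _*_ (Z-cong E (cut-∁-ind (- t) A S)) (Z-cong E (cut-ind (- t) A S)))
      where
      absent : ∀ u v → u ∈ A → v ∉ A → E u v ≡ false ⊎ ind (- t) S u ≡ 0ℚ ⊎ ind (- t) S v ≡ 0ℚ
      absent u v u∈A v∉A with ∈? S u | ∈? S v
      ... | inj₂ u∉S | _        = inj₂ (inj₁ (ind-∉ u∉S))
      ... | inj₁ _   | inj₂ v∉S = inj₂ (inj₂ (ind-∉ v∉S))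
      ... | inj₁ u∈S | inj₁ v∈S = inj₁ (sep (∈-∩ u∈S u∈A) (∈-∖ v∈S v∉A))

    Pos : Sub n → Set
    Pos D = ∀ S → S ⊆ D → 0ℚ < f S

    Pos-⊆ : ∀ {D D′} → D′ ⊆ D → Pos D → Pos D′
    Pos-⊆ D′⊆D pos S S⊆D′ = pos S (⊆-trans S⊆D′ D′⊆D)

    f-remove-≤ : 0ℚ ≤ t → ∀ {D} → Pos D → ∀ {S x} → S ⊆ D → x ∈ S → f S ≤ f (S ∖ ⁅ x ⁆)
    f-remove-≤ 0≤t pos {S} {x} S⊆D x∈S = ≤-via (t * f ((S ∖ ⁅ x ⁆) ∖ E x))
      (0≤* 0≤t (ℚ.<⇒≤ (pos _ (⊆-trans ∖-⊆ (⊆-trans ∖-⊆ S⊆D)))))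
      (trans (eq _ _) (cong (_+ t * f ((S ∖ ⁅ x ⁆) ∖ E x)) (sym (f-remove x∈S))))
      where
      eq : ∀ a b → a ≡ (a - b) + b
      eq = solve-∀ ℚ-ring

    f-mono : 0ℚ ≤ t → ∀ {D} → Pos D → ∀ {S T} → S ⊆ D → T ⊆ S → f S ≤ f T
    f-mono 0≤t {D} pos {S} {T} S⊆D T⊆S = go (card (S ∖ T)) ℕ.≤-refl S⊆D T⊆S
      where
      go : ∀ m {S} → card (S ∖ T) ℕ.≤ m → S ⊆ D → T ⊆ S → f S ≤ f T
      go m {S} c≤m S⊆D T⊆S with some? (S ∖ T)
      ... | inj₂ none = ℚ.≤-reflexive (f-cong (⊆-antisym S⊆T T⊆S))
        where
        S⊆T : S ⊆ T
        S⊆T {v} v∈S with ∈? T v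
        ... | inj₁ v∈T = v∈T
        ... | inj₂ v∉T = ∈-∉ (∈-∖ v∈S v∉T) (none v)
      ... | inj₁ (x , x∈) with m
      ... | zero  = ∈-∉ x∈ (card≡0 _ (ℕ.n≤0⇒n≡0 c≤m) x)
      ... | suc m = ℚ.≤-trans (f-remove-≤ 0≤t pos S⊆D (∖-⊆ x∈))
        (go m smaller (⊆-trans ∖-⊆ S⊆D) λ v∈T → ∈-∖x (T⊆S v∈T) λ { refl → ∈-∉ v∈T (proj₂ (∖-∈ x∈)) })
        where
        smaller : card ((S ∖ ⁅ x ⁆) ∖ T) ℕ.≤ m
        smaller = ℕ.≤-trans
          (card-mono _ _ λ p → let q , v∉T = ∖-∈ p ; v∈S , v≢x = ∖x-∈ q in ∈-∖x (∈-∖ v∈S v∉T) v≢x)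
          (ℕ.≤-pred (subst (ℕ._≤ suc m) (card-remove (S ∖ T) x x∈) c≤m))

-- The polynomials of paths and cycles

-- With p k the independence polynomial of the path on k vertices at −t, P (suc k) = p k; the
-- extra term P 0 = 1 extends the recurrence to p 0 and p (-1).
P : ℚ → ℕ → ℚ
P t zero          = 1ℚ
P t (suc zero)    = 1ℚ
P t (suc (suc k)) = P t (suc k) - t * P t k

-- For k ≥ 3, C t k is the independence polynomial of the cycle on k vertices at −t.
C : ℚ → ℕ → ℚ
C t zero          = 1ℚ + 1ℚ
C t (suc zero)    = 1ℚ
C t (suc (suc k)) = C t (suc k) - t * C t k

module Recurrence (t : ℚ) (s : ℕ → ℚ) (step : ∀ k → s (2 ℕ.+ k) ≡ s (1 ℕ.+ k) - t * s k) where

  -- Both sides obey the same recurrence in `m`. For `s = P` this is the deletion of the vertex of a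
  -- path that separates it into paths on `m` and `k` vertices.
  addition : ∀ m k → s (2 ℕ.+ (m ℕ.+ k)) ≡ s (1 ℕ.+ k) * P t (1 ℕ.+ m) - t * s k * P t m
  addition zero          k = trans (step k) (eq (s (1 ℕ.+ k)) (s k) t)
    where
    eq : ∀ a b t → a - t * b ≡ a * 1ℚ - t * b * 1ℚ
    eq = solve-∀ ℚ-ring
  addition (suc zero)    k = trans (step (suc k)) (trans (cong (_- t * s (suc k)) (step k)) (eq (s (1 ℕ.+ k)) (s k) t))
    where
    eq : ∀ a b t → (a - t * b) - t * a ≡ a * (1ℚ - t * 1ℚ) - t * b * 1ℚ
    eq = solve-∀ ℚ-ring
  addition (suc (suc m)) k = trans (step (2 ℕ.+ (m ℕ.+ k)))
    (trans (cong₂ (λ a b → a - t * b) (addition (suc m) k) (addition m k))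
           (eq (s (1 ℕ.+ k)) (s k) t (P t (2 ℕ.+ m)) (P t (1 ℕ.+ m)) (P t m)))
    where
    eq : ∀ a b t p₂ p₁ p₀ → (a * p₂ - t * b * p₁) - t * (a * p₁ - t * b * p₀)
                          ≡ a * (p₂ - t * p₁) - t * b * (p₁ - t * p₀)
    eq = solve-∀ ℚ-ring

  -- Read as a statement about ratios: if the last term is nonnegative, then the ratio
  -- `s (2 + m + k) / s (3 + m + k)` is at most the product of `s (1 + k) / s (2 + k)` and
  -- `P t (1 + m) / P t (2 + m)`. Splitting a set into two parts therefore only improves a lower
  -- bound of this kind.
  supermultiplicative : ∀ m k →
    s (1 ℕ.+ k) * P t (1 ℕ.+ m) * s (3 ℕ.+ (m ℕ.+ k)) ≡
    s (2 ℕ.+ k) * P t (2 ℕ.+ m) * s (2 ℕ.+ (m ℕ.+ k)) + t * P t m * s k * s (4 ℕ.+ (m ℕ.+ k))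
  supermultiplicative m k = trans
    (cong (s (1 ℕ.+ k) * P t (1 ℕ.+ m) *_) (addition (suc m) k))
    (trans (eq (s (1 ℕ.+ k)) (s k) t (P t (1 ℕ.+ m)) (P t m))
      (sym (cong₂ _+_ (cong₂ _*_ (cong (_* P t (2 ℕ.+ m)) (step k)) (addition m k))
                      (cong (t * P t m * s k *_) (addition (suc (suc m)) k)))))
    where
    eq : ∀ a b t q p → a * q * (a * (q - t * p) - t * b * q) ≡
      (a - t * b) * (q - t * p) * (a * q - t * b * p) +
      t * p * b * (a * ((q - t * p) - t * q) - t * b * (q - t * p))
    eq = solve-∀ ℚ-ring

module P-rec (t : ℚ) = Recurrence t (P t) (λ _ → refl)
module C-rec (t : ℚ) = Recurrence t (C t) (λ _ → refl)

-- Deleting a vertex of a cycle on `2 + j` vertices leaves a path on `1 + j` vertices, and deleting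
-- its two neighbours as well leaves one on `j - 1`. The initial values of `C` are those that extend
-- this combination down to `j = 0`.
C-via-P : ∀ t j → C t (2 ℕ.+ j) ≡ P t (2 ℕ.+ j) - t * P t j
C-via-P t zero = eq t
  where
  eq : ∀ t → 1ℚ - t * (1ℚ + 1ℚ) ≡ (1ℚ - t * 1ℚ) - t * 1ℚ
  eq = solve-∀ ℚ-ring
C-via-P t (suc zero) = eq t
  where
  eq : ∀ t → (1ℚ - t * (1ℚ + 1ℚ)) - t * 1ℚ ≡ ((1ℚ - t * 1ℚ) - t * 1ℚ) - t * 1ℚ
  eq = solve-∀ ℚ-ring
C-via-P t (suc (suc j)) = trans (cong₂ (λ a b → a - t * b) (C-via-P t (suc j)) (C-via-P t j))
  (eq t (P t (3 ℕ.+ j)) (P t (2 ℕ.+ j)) (P t (1 ℕ.+ j)) (P t j))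
  where
  eq : ∀ t p₃ p₂ p₁ p₀ → (p₃ - t * p₁) - t * (p₂ - t * p₀) ≡ (p₃ - t * p₂) - t * (p₁ - t * p₀)
  eq = solve-∀ ℚ-ring

module Sequences (t : ℚ) (0≤t : 0ℚ ≤ t) where

  P⁺ : ℕ → Set
  P⁺ k = ∀ j → j ℕ.≤ k → 0ℚ < P t j

  C⁺ : ℕ → Set
  C⁺ k = ∀ j → j ℕ.≤ k → 0ℚ < C t j

  P-decreasing : ∀ {j k} → P⁺ k → suc j ℕ.≤ k → P t (suc j) ≤ P t j
  P-decreasing {zero}  pos _ = ℚ.≤-refl
  P-decreasing {suc j} pos j<k = ≤-via (t * P t j)
    (0≤* 0≤t (ℚ.<⇒≤ (pos j (ℕ.<⇒≤ (ℕ.<-trans (ℕ.n<1+n j) j<k))))) (eq (P t (suc j)) t (P t j))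
    where
    eq : ∀ a t b → a ≡ (a - t * b) + t * b
    eq = solve-∀ ℚ-ring

  -- Joining two disjoint paths end to end adds an edge and can only lower the value; the difference
  -- is explicit and has the sign of a decrease of `P`.
  P-submultiplicative : ∀ a b → P⁺ (2 ℕ.+ (a ℕ.+ b)) → P t (b ℕ.+ suc a) ≤ P t (suc a) * P t (suc b)
  P-submultiplicative a zero    pos = ℚ.≤-reflexive (sym (ℚ.*-identityʳ _))
  P-submultiplicative a (suc b) pos = ≤-via (t * P t b * (P t a - P t (suc a)))
    (0≤* (0≤* 0≤t (ℚ.<⇒≤ (pos b b≤)))
         (≤⇒0≤ (P-decreasing pos (ℕ.≤-trans (ℕ.m≤m+n (suc a) (suc b)) (ℕ.n≤1+n _)))))
    (trans (eq (P t (suc a)) (P t a) t (P t (suc b)) (P t b))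
           (cong (_+ t * P t b * (P t a - P t (suc a)))
                 (sym (trans (cong (λ i → P t (suc i)) (ℕ.+-suc b a)) (P-rec.addition t b a)))))
    where
    b≤ : b ℕ.≤ 2 ℕ.+ (a ℕ.+ suc b)
    b≤ = ℕ.≤-trans (ℕ.n≤1+n b) (ℕ.≤-trans (ℕ.m≤n+m (suc b) a) (ℕ.m≤n+m _ 2))
    eq : ∀ a₁ a₀ t b₁ b₀ → a₁ * (b₁ - t * b₀) ≡ (a₁ * b₁ - t * a₀ * b₀) + t * b₀ * (a₀ - a₁)
    eq = solve-∀ ℚ-ring

  -- Deleting both ends of a path on `2 + j` vertices has the ratio `P t (1 + j) / P t (3 + j)`. It
  -- is at least `C t (1 + j) / C t (2 + j)`, so an estimate against the path may be weakened to one
  -- against the cycle.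
  P-C-ratio : ∀ j → P⁺ (suc j) → 0ℚ ≤ C t (3 ℕ.+ j) → P t (3 ℕ.+ j) * C t (1 ℕ.+ j) ≤ P t (1 ℕ.+ j) * C t (2 ℕ.+ j)
  P-C-ratio zero    pos _   = ℚ.≤-reflexive (eq t)
    where
    eq : ∀ t → ((1ℚ - t * 1ℚ) - t * 1ℚ) * 1ℚ ≡ 1ℚ * (1ℚ - t * (1ℚ + 1ℚ))
    eq = solve-∀ ℚ-ring
  P-C-ratio (suc j) pos 0≤c = ≤-via (t * P t j * C t (4 ℕ.+ j))
    (0≤* (0≤* 0≤t (ℚ.<⇒≤ (pos j (ℕ.m≤n+m j 2)))) 0≤c)
    (trans (cong (P t (2 ℕ.+ j) *_) (C-via-P t (suc j)))
    (trans (eq t (P t (1 ℕ.+ j)) (P t j))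
           (sym (cong₂ (λ x y → P t (4 ℕ.+ j) * x + t * P t j * y) (C-via-P t j) (C-via-P t (2 ℕ.+ j))))))
    where
    eq : ∀ t p₁ p₀ → let p₂ = p₁ - t * p₀ ; p₃ = p₂ - t * p₁ ; p₄ = p₃ - t * p₂ in
      p₂ * (p₃ - t * p₁) ≡ p₄ * (p₂ - t * p₀) + t * p₀ * (p₄ - t * p₂)
    eq = solve-∀ ℚ-ring

  -- A Cassini identity: the difference of the two sides is multiplied by `t` at each step, hence is
  -- a power of `t`.
  P-log-concave : ∀ j → P⁺ j → P t j * P t (3 ℕ.+ j) ≤ P t (1 ℕ.+ j) * P t (2 ℕ.+ j)
  P-log-concave zero    pos = ≤-via t 0≤t (eq t)
    where
    eq : ∀ t → 1ℚ * (1ℚ - t * 1ℚ) ≡ 1ℚ * ((1ℚ - t * 1ℚ) - t * 1ℚ) + t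
    eq = solve-∀ ℚ-ring
  P-log-concave (suc j) pos = ≤-via (t * (P t (1 ℕ.+ j) * P t (2 ℕ.+ j) - P t j * P t (3 ℕ.+ j)))
    (0≤* 0≤t (≤⇒0≤ (P-log-concave j (λ i i≤j → pos i (ℕ.m≤n⇒m≤1+n i≤j)))))
    (eq t (P t (1 ℕ.+ j)) (P t j))
    where
    eq : ∀ t p₁ p₀ → let p₂ = p₁ - t * p₀ ; p₃ = p₂ - t * p₁ ; p₄ = p₃ - t * p₂ in
      p₂ * p₃ ≡ p₁ * p₄ + t * (p₁ * p₂ - p₀ * p₃)
    eq = solve-∀ ℚ-ring

  -- By log-concavity the quotient of `C t k` by `P t k` decreases in `k` from 2 on, so positivity
  -- passes to the preceding index.
  C-positive-pred : ∀ k → P⁺ (suc k) → 0ℚ < C t (suc k) → 0ℚ < C t k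
  C-positive-pred zero          pos 0<c = 0<+ 0<1 0≤1
  C-positive-pred (suc zero)    pos 0<c = 0<1
  C-positive-pred (suc (suc k)) pos 0<c = 0<-cancelˡ (pos (3 ℕ.+ k) ℕ.≤-refl)
    (ℚ.<-≤-trans (0<* (pos (2 ℕ.+ k) (ℕ.n≤1+n _)) 0<c)
      (≤-via (t * (P t (1 ℕ.+ k) * P t (2 ℕ.+ k) - P t k * P t (3 ℕ.+ k)))
        (0≤* 0≤t (≤⇒0≤ (P-log-concave k (λ i i≤k → pos i (ℕ.≤-trans i≤k (ℕ.m≤n+m k 3))))))
        (trans (cong (P t (3 ℕ.+ k) *_) (C-via-P t k))
          (trans (eq t (P t (3 ℕ.+ k)) (P t (2 ℕ.+ k)) (P t (1 ℕ.+ k)) (P t k))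
            (cong (λ c → P t (2 ℕ.+ k) * c + t * (P t (1 ℕ.+ k) * P t (2 ℕ.+ k) - P t k * P t (3 ℕ.+ k)))
                  (sym (C-via-P t (suc k))))))))
    where
    eq : ∀ t p₃ p₂ p₁ p₀ → p₃ * (p₂ - t * p₀) ≡ p₂ * (p₃ - t * p₁) + t * (p₁ * p₂ - p₀ * p₃)
    eq = solve-∀ ℚ-ring

  C-positive-below : ∀ k → P⁺ k → 0ℚ < C t k → C⁺ k
  C-positive-below zero    pos 0<c zero _ = 0<c
  C-positive-below (suc k) pos 0<c j j≤k = Sum.[ lower , (λ { refl → 0<c }) ]′ (ℕ.m≤n⇒m<n∨m≡n j≤k)
    where
    lower : j ℕ.< suc k → 0ℚ < C t j
    lower j<k = C-positive-below k (λ i i≤ → pos i (ℕ.m≤n⇒m≤1+n i≤)) (C-positive-pred k pos 0<c) j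
                  (ℕ.≤-pred j<k)

-- Connectivity by cuts

module Connectivity {n} (E : Adj n) (E-sym : Sym E) where

  -- Conn X S says that every component of S meets X.
  Conn : Sub n → Sub n → Set
  Conn X S = ∀ {A u} → A ⊆ S → u ∈ A → (∀ {v} → v ∈ A → v ∉ X) →
    ∃ λ a → ∃ λ b → a ∈ A × b ∈ S × b ∉ A × E a b ≡ true

  Closed : Sub n → Sub n → Set
  Closed S A = ∀ {a b} → a ∈ A → b ∈ S → E a b ≡ true → b ∈ A

  -- Reachability inside `S` without paths: no closed set separates `v` from `u`. Paths as lists of
  -- vertices appear only where a cycle has to be constructed.
  Linked : Sub n → Fin n → Fin n → Set
  Linked S u v = ∀ A → Closed S A → u ∈ A → v ∈ A

  flip : ∀ {u v} → E u v ≡ true → E v u ≡ true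
  flip {u} {v} e = trans (E-sym v u) e

  Closed-∁ : ∀ {S A} → Closed S A → Closed S (S ∖ A)
  Closed-∁ closed a∈ b∈S e = ∈-∖ b∈S (¬∈⇒∉ λ b∈A → ∈-∉ (closed b∈A (∖-⊆ a∈) (flip e)) (proj₂ (∖-∈ a∈)))

  Closed-⊆ : ∀ {S T A} → T ⊆ S → Closed S A → Closed T A
  Closed-⊆ T⊆S closed a∈A b∈T e = closed a∈A (T⊆S b∈T) e

  Linked-⊆ : ∀ {S T u v} → T ⊆ S → Linked T u v → Linked S u v
  Linked-⊆ T⊆S linked A closed = linked A (Closed-⊆ T⊆S closed)

  Linked-sym : ∀ {S u v} → u ∈ S → Linked S u v → Linked S v u
  Linked-sym {S} {u} {v} u∈S linked A closed v∈A with ∈? A u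
  ... | inj₁ u∈A = u∈A
  ... | inj₂ u∉A = ∈-∉ v∈A (proj₂ (∖-∈ (linked (S ∖ A) (Closed-∁ closed) (∈-∖ u∈S u∉A))))

  Linked-restrict : ∀ {S A u v} → Closed S A → u ∈ A → Linked S u v → Linked A u v
  Linked-restrict closed u∈A linked B closed-B u∈B =
    ∩-⊆ˡ (linked (B ∩ _) (λ p b∈S e → let p₁ , p₂ = ∩-∈ p ; b∈A = closed p₂ b∈S e in
                                       ∈-∩ (closed-B p₁ b∈A e) b∈A) (∈-∩ u∈B u∈A))

  -- The vertex sets of cycles, and more generally the 2-connected sets.
  record CycleSet (K : Sub n) (c : Fin n) : Set where
    field
      root   : c ∈ K
      joined : ∀ {v} → v ∈ K → Linked K c v
      around : ∀ {x} → x ∈ K → ∃ λ y → ∃ λ z → y ∈ K ∖ ⁅ x ⁆ × z ∈ K ∖ ⁅ x ⁆ × y ≢ z ×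
               E x y ≡ true × E x z ≡ true × (∀ {v} → v ∈ K ∖ ⁅ x ⁆ → Linked (K ∖ ⁅ x ⁆) v y)

  AtMostOne : Sub n → Fin n → Set
  AtMostOne S v = ∀ {x y} → x ∈ S → y ∈ S → E v x ≡ true → E v y ≡ true → x ≡ y

  Forest : Sub n → Set
  Forest D = ∀ {S v} → S ⊆ D → v ∈ S → ∃ λ u → u ∈ S × AtMostOne S u

  -- In a unicyclic graph every nonempty set of vertices has a vertex of degree at most 1 in
  -- it, unless it is the cycle; c is a vertex of the cycle.
  Pseudoforest : Sub n → Fin n → Set
  Pseudoforest D c = ∀ {S v} → S ⊆ D → v ∈ S → (∃ λ u → u ∈ S × AtMostOne S u) ⊎
    (c ∈ S × ∃ λ y → ∃ λ z → y ∈ S × z ∈ S × y ≢ z × y ≢ c × z ≢ c × E c y ≡ true × E c z ≡ true ×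
      (∀ {w} → w ∈ S → E c w ≡ true → w ≡ y ⊎ w ≡ z))

  edge? : ∀ A B → (∃ λ a → ∃ λ b → a ∈ A × b ∈ B × E a b ≡ true) ⊎
                  (∀ {a b} → a ∈ A → b ∈ B → E a b ≡ false)
  edge? A B with Fin.any? (λ a → Fin.any? (λ b → (A a Bool.≟ true) ×-dec ((B b Bool.≟ true) ×-dec (E a b Bool.≟ true))))
  ... | yes (a , b , p , q , e) = inj₁ (a , b , in! p , in! q , e)
  ... | no ¬e = inj₂ λ {a} {b} a∈A b∈B → Bool.¬-not λ e → ¬e (a , b , holds a∈A , holds b∈B , e)

  Conn-⁅⁆ : ∀ {x} → Conn ⁅ x ⁆ ⁅ x ⁆
  Conn-⁅⁆ A⊆ u∈A avoid = ∈-∉ (A⊆ u∈A) (avoid u∈A)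

  Conn-cong : ∀ {X S T} → S ≗ T → Conn X S → Conn X T
  Conn-cong S≗T conn A⊆T u∈A avoid =
    let a , b , a∈A , b∈S , b∉A , e = conn (λ p → ≗⇒⊆ (sym ∘ S≗T) (A⊆T p)) u∈A avoid
    in a , b , a∈A , ≗⇒⊆ S≗T b∈S , b∉A , e

  Conn-restrict : ∀ {X S A} → A ⊆ S → Closed S A → Conn X S → Conn X A
  Conn-restrict A⊆S closed conn B⊆A u∈B avoid =
    let a , b , a∈B , b∈S , b∉B , e = conn (⊆-trans B⊆A A⊆S) u∈B avoid
    in a , b , a∈B , closed (B⊆A a∈B) b∈S e , b∉B , e

  -- The reason for allowing a set of roots: when the single root `x` of a connected set is deleted,
  -- each remaining component contains a neighbour of `x`.
  Conn-remove : ∀ {x S} → Conn ⁅ x ⁆ S → Conn (E x) (S ∖ ⁅ x ⁆)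
  Conn-remove {x} {S} conn {A} A⊆ u∈A avoid =
    let a , b , a∈A , b∈S , b∉A , e = conn (⊆-trans A⊆ ∖-⊆) u∈A (λ v∈A → proj₂ (∖-∈ (A⊆ v∈A)))
    in a , b , a∈A , ∈-∖x b∈S (λ b≡x → ∈-∉ (in! (flip (subst (λ z → E a z ≡ true) b≡x e))) (avoid a∈A)) , b∉A , e

  Conn-grow : ∀ {X A a b} → Conn X A → a ∈ A → b ∉ A → E a b ≡ true → Conn X (A ∪ ⁅ b ⁆)
  Conn-grow {X} {A} {a} {b} conn a∈A b∉A e {B} {u} B⊆ u∈B avoid with some? (B ∩ A)
  ... | inj₁ (v , v∈) =
    let a′ , b′ , a′∈ , b′∈A , b′∉ , e′ = conn {B ∩ A} (λ p → proj₂ (∩-∈ p)) v∈ (λ p → avoid (∩-⊆ˡ p))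
    in a′ , b′ , ∩-⊆ˡ a′∈ , ∈-∪ˡ b′∈A , ¬∈⇒∉ (λ p → ∈-∉ (∈-∩ p b′∈A) b′∉) , e′
  ... | inj₂ none with ∪-∈ (B⊆ u∈B)
  ... | inj₁ u∈A = ∈-∉ (∈-∩ u∈B u∈A) (none u)
  ... | inj₂ u∈b with ⁅⁆-∈ u∈b
  ... | refl = u , a , u∈B , ∈-∪ˡ a∈A , ¬∈⇒∉ (λ a∈B → ∈-∉ (∈-∩ a∈B a∈A) (none a)) , flip e

  -- If `A` contains the old root, the complement of `A` in `S` contains `a` and misses that root,
  -- so it has a leaving edge, which is then read backwards.
  Conn-reroot : ∀ {r a S} → r ∈ S → a ∈ S → Conn ⁅ r ⁆ S → Conn ⁅ a ⁆ S
  Conn-reroot {r} {a} {S} r∈S a∈S conn {A} {u} A⊆S u∈A avoid with ∈? A r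
  ... | inj₂ r∉A = conn A⊆S u∈A λ v∈A → ∉-⁅⁆ (∈-∉-≢ v∈A r∉A)
  ... | inj₁ r∈A =
    let b , c , b∈ , c∈S , c∉ , e = conn {S ∖ A} ∖-⊆ (∈-∖ a∈S a∉A) (λ p → ∉-⁅⁆ (∈-∉-≢ r∈A (proj₂ (∖-∈ p)) ∘ sym))
    in c , b , inside c∈S c∉ , ∖-⊆ b∈ , proj₂ (∖-∈ b∈) , flip e
    where
    a∉A : a ∉ A
    a∉A = ¬∈⇒∉ λ a∈A → ∈-∉ (∈-⁅⁆ a) (avoid a∈A)
    inside : ∀ {c} → c ∈ S → c ∉ S ∖ A → c ∈ A
    inside {c} c∈S c∉ with ∈? A c
    ... | inj₁ c∈A = c∈A
    ... | inj₂ c∉A = ∈-∉ (∈-∖ c∈S c∉A) c∉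

  Conn⇒Linked : ∀ {r S v} → Conn ⁅ r ⁆ S → v ∈ S → Linked S v r
  Conn⇒Linked {r} {S} {v} conn v∈S A closed v∈A with ∈? A r
  ... | inj₁ r∈A = r∈A
  ... | inj₂ r∉A =
    let a , b , a∈ , b∈S , b∉ , e = conn {S ∩ A} ∩-⊆ˡ (∈-∩ v∈S v∈A)
                                      (λ p → ∉-⁅⁆ (∈-∉-≢ (proj₂ (∩-∈ p)) r∉A))
    in ∈-∉ (∈-∩ b∈S (closed (proj₂ (∩-∈ a∈)) b∈S e)) b∉

  Linked⇒Conn : ∀ {r S} → (∀ {v} → v ∈ S → Linked S v r) → Conn ⁅ r ⁆ S
  Linked⇒Conn {r} {S} linked {A} {u} A⊆S u∈A avoid with edge? A (S ∖ A)
  ... | inj₁ (a , b , a∈A , b∈ , e) = a , b , a∈A , ∖-⊆ b∈ , proj₂ (∖-∈ b∈) , e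
  ... | inj₂ none = ∈-∉ (∈-⁅⁆ r) (avoid (linked (A⊆S u∈A) A closed u∈A))
    where
    closed : Closed S A
    closed {a} {b} a∈A b∈S e with ∈? A b
    ... | inj₁ b∈A = b∈A
    ... | inj₂ b∉A with trans (sym e) (none a∈A (∈-∖ b∈S b∉A))
    ... | ()

  -- The induction used for adding vertices one by one: while `T` is not all of `D`, connectedness
  -- supplies an edge from `T` to a new vertex. Sets are functions and agree only pointwise, hence
  -- `Q-cong`.
  grow : ∀ (Q : Sub n → Set) → (∀ {S T} → S ≗ T → Q S → Q T) → ∀ {D r} → Conn ⁅ r ⁆ D →
    (∀ {T a b} → T ⊆ D → r ∈ T → a ∈ T → b ∈ D → b ∉ T → E a b ≡ true → Q T → Q (T ∪ ⁅ b ⁆)) →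
    ∀ {T} → r ∈ T → T ⊆ D → Q T → Q D
  grow Q Q-cong {D} {r} conn step {T} r∈T T⊆D QT = go (card (D ∖ T)) ℕ.≤-refl r∈T T⊆D QT
    where
    go : ∀ m {T} → card (D ∖ T) ℕ.≤ m → r ∈ T → T ⊆ D → Q T → Q D
    go m {T} c≤m r∈T T⊆D QT with some? (D ∖ T)
    ... | inj₂ none = Q-cong (⊆-antisym T⊆D D⊆T) QT
      where
      D⊆T : D ⊆ T
      D⊆T {v} v∈D with ∈? T v
      ... | inj₁ v∈T = v∈T
      ... | inj₂ v∉T = ∈-∉ (∈-∖ v∈D v∉T) (none v)
    ... | inj₁ (u , u∈) with conn {D ∖ T} ∖-⊆ u∈ (λ p → ∉-⁅⁆ (∈-∉-≢ r∈T (proj₂ (∖-∈ p)) ∘ sym))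
    ... | b , a , b∈ , a∈D , a∉ , e with m
    ... | zero  = ∈-∉ b∈ (card≡0 _ (ℕ.n≤0⇒n≡0 c≤m) b)
    ... | suc m = go m smaller (∈-∪ˡ r∈T) T∪b⊆D (step T⊆D r∈T a∈T (∖-⊆ b∈) (proj₂ (∖-∈ b∈)) (flip e) QT)
      where
      a∈T : a ∈ T
      a∈T with ∈? T a
      ... | inj₁ a∈T = a∈T
      ... | inj₂ a∉T = ∈-∉ (∈-∖ a∈D a∉T) a∉
      T∪b⊆D : T ∪ ⁅ b ⁆ ⊆ D
      T∪b⊆D p with ∪-∈ p
      ... | inj₁ v∈T = T⊆D v∈T
      ... | inj₂ v∈b with ⁅⁆-∈ v∈b
      ... | refl = ∖-⊆ b∈
      smaller : card (D ∖ (T ∪ ⁅ b ⁆)) ℕ.≤ m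
      smaller = ℕ.≤-trans
        (card-mono _ _ λ p → let v∈D , v∉ = ∖-∈ p in
          ∈-∖x (∈-∖ v∈D (¬∈⇒∉ λ v∈T → ∈-∉ (∈-∪ˡ v∈T) v∉)) (∈-∉-≢ (∈-∪ʳ (∈-⁅⁆ b)) v∉ ∘ sym))
        (ℕ.≤-pred (subst (ℕ._≤ suc m) (card-remove (D ∖ T) b b∈) c≤m))

  component : ∀ {S x} → x ∈ S → ∃ λ A → x ∈ A × A ⊆ S × Closed S A × Conn ⁅ x ⁆ A
  component {S} {x} x∈S = go (card (S ∖ ⁅ x ⁆)) ℕ.≤-refl (∈-⁅⁆ x) (λ p → subst (_∈ S) (sym (⁅⁆-∈ p)) x∈S) Conn-⁅⁆
    where
    go : ∀ m {A} → card (S ∖ A) ℕ.≤ m → x ∈ A → A ⊆ S → Conn ⁅ x ⁆ A →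
         ∃ λ A → x ∈ A × A ⊆ S × Closed S A × Conn ⁅ x ⁆ A
    go m {A} c≤m x∈A A⊆S conn with edge? A (S ∖ A)
    ... | inj₂ none = A , x∈A , A⊆S , closed , conn
      where
      closed : Closed S A
      closed {a} {b} a∈A b∈S e with ∈? A b
      ... | inj₁ b∈A = b∈A
      ... | inj₂ b∉A with trans (sym e) (none a∈A (∈-∖ b∈S b∉A))
      ... | ()
    ... | inj₁ (a , b , a∈A , b∈ , e) with m
    ... | zero  = ∈-∉ b∈ (card≡0 _ (ℕ.n≤0⇒n≡0 c≤m) b)
    ... | suc m = go m smaller (∈-∪ˡ x∈A) A∪b⊆S (Conn-grow conn a∈A (proj₂ (∖-∈ b∈)) e)
      where
      A∪b⊆S : A ∪ ⁅ b ⁆ ⊆ S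
      A∪b⊆S p with ∪-∈ p
      ... | inj₁ v∈A = A⊆S v∈A
      ... | inj₂ v∈b with ⁅⁆-∈ v∈b
      ... | refl = ∖-⊆ b∈
      smaller : card (S ∖ (A ∪ ⁅ b ⁆)) ℕ.≤ m
      smaller = ℕ.≤-trans
        (card-mono _ _ λ p → let v∈S , v∉ = ∖-∈ p in
          ∈-∖x (∈-∖ v∈S (¬∈⇒∉ λ v∈A → ∈-∉ (∈-∪ˡ v∈A) v∉)) (∈-∉-≢ (∈-∪ʳ (∈-⁅⁆ b)) v∉ ∘ sym))
        (ℕ.≤-pred (subst (ℕ._≤ suc m) (card-remove (S ∖ A) b b∈) c≤m))

-- The upper bound

module UpperBound {n} (E : Adj n) (E-sym : Sym E) (t : ℚ) (0≤t : 0ℚ ≤ t)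
  (D : Sub n) (pos : Weighted.Pos E E-sym t D) where

  open Weighted E E-sym t
  open Connectivity E E-sym
  open Sequences t 0≤t

  private
    f⁺ : ∀ {S} → S ⊆ D → 0ℚ < f S
    f⁺ S⊆D = pos _ S⊆D

    f-mono′ : ∀ {S T} → S ⊆ D → T ⊆ S → f S ≤ f T
    f-mono′ = f-mono 0≤t pos

  -- The recurrence for `f` turns a lower bound `lo / mid` on the ratio lost with the neighbours of
  -- `x` into the upper bound `(mid - t * lo) / mid` on f(S) / f(S without x). If `lo`, `mid` are
  -- consecutive members of `P` or `C`, the new numerator is the next member.
  step-ratio : ∀ {S x} lo mid → x ∈ S → lo * f (S ∖ ⁅ x ⁆) ≤ mid * f ((S ∖ ⁅ x ⁆) ∖ E x) →
    mid * f S ≤ (mid - t * lo) * f (S ∖ ⁅ x ⁆)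
  step-ratio {S} {x} lo mid x∈S h = ≤-via (t * (mid * G - lo * F)) (0≤* 0≤t (≤⇒0≤ h))
    (trans (eq t lo mid F G) (cong (λ a → mid * a + t * (mid * G - lo * F)) (sym (f-remove x∈S))))
    where
    F = f (S ∖ ⁅ x ⁆)
    G = f ((S ∖ ⁅ x ⁆) ∖ E x)
    eq : ∀ t lo mid F G → (mid - t * lo) * F ≡ mid * (F - t * G) + t * (mid * G - lo * F)
    eq = solve-∀ ℚ-ring

  module Split {S A} (A⊆S : A ⊆ S) (closed : Closed S A) where

    S∩A≗A : S ∩ A ≗ A
    S∩A≗A = ⊆-antisym (λ p → proj₂ (∩-∈ p)) (λ p → ∈-∩ (A⊆S p) p)

    card-parts : card S ≡ card A ℕ.+ card (S ∖ A)
    card-parts = trans (card-split S A) (cong (ℕ._+ card (S ∖ A)) (card-cong S∩A≗A))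

    separated : ∀ {u v} → u ∈ A → v ∈ S ∖ A → E u v ≡ false
    separated u∈A v∈ = Bool.¬-not λ e → ∈-∉ (closed u∈A (∖-⊆ v∈) e) (proj₂ (∖-∈ v∈))

    f-parts : ∀ X → f (S ∖ X) ≡ f (A ∖ X) * f ((S ∖ A) ∖ X)
    f-parts X = trans
      (f-mult A λ u∈ v∈ → separated (proj₂ (∩-∈ u∈))
        (let v∈S∖X , v∉A = ∖-∈ v∈ in ∈-∖ (∖-⊆ v∈S∖X) v∉A))
      (cong₂ _*_
        (f-cong (⊆-antisym (λ p → let q , r = ∩-∈ p in ∈-∖ r (proj₂ (∖-∈ q)))
                           (λ p → let q , r = ∖-∈ p in ∈-∩ (∈-∖ (A⊆S q) r) q)))
        (f-cong (⊆-antisym (λ p → let q , r = ∖-∈ p ; q₁ , q₂ = ∖-∈ q in ∈-∖ (∈-∖ q₁ r) q₂)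
                           (λ p → let q , r = ∖-∈ p ; q₁ , q₂ = ∖-∈ q in ∈-∖ (∈-∖ q₁ r) q₂))))

    f-whole : f S ≡ f A * f (S ∖ A)
    f-whole = trans (f-mult A λ u∈ v∈ → separated (proj₂ (∩-∈ u∈)) v∈) (cong (_* f (S ∖ A)) (f-cong S∩A≗A))

  ratio-product : ∀ {a₀ a₁ b₀ b₁ k₀ k₁ F G F′ G′} → 0ℚ < a₁ → 0ℚ < b₀ → 0ℚ < b₁ → 0ℚ < F → 0ℚ < F′ → 0ℚ < G → 0ℚ < k₁ →
    a₀ * F ≤ a₁ * F′ → b₀ * G ≤ b₁ * G′ → a₁ * b₁ * k₀ ≤ a₀ * b₀ * k₁ → k₀ * (F * G) ≤ k₁ * (F′ * G′)
  ratio-product {a₀} {a₁} {b₀} {b₁} {k₀} {k₁} {F} {G} {F′} {G′} 0<a₁ 0<b₀ 0<b₁ 0<F 0<F′ 0<G 0<k₁ hA hB hk =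
    *-cancelˡ (0<* 0<a₁ 0<b₁) (begin
      (a₁ * b₁) * (k₀ * (F * G))     ≡⟨ eq₁ (a₁ * b₁) k₀ (F * G) ⟩
      (F * G) * (a₁ * b₁ * k₀)       ≤⟨ *-monoˡ (ℚ.<⇒≤ (0<* 0<F 0<G)) hk ⟩
      (F * G) * (a₀ * b₀ * k₁)       ≡⟨ eq₂ F G a₀ b₀ k₁ ⟩
      k₁ * ((a₀ * F) * (b₀ * G))     ≤⟨ *-monoˡ (ℚ.<⇒≤ 0<k₁) (ℚ.≤-trans
        (ℚ.*-monoʳ-≤-nonNeg (b₀ * G) {{ℚ.nonNegative (ℚ.<⇒≤ (0<* 0<b₀ 0<G))}} hA)
        (*-monoˡ (ℚ.<⇒≤ (0<* 0<a₁ 0<F′)) hB)) ⟩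
      k₁ * ((a₁ * F′) * (b₁ * G′))   ≡⟨ eq₃ a₁ b₁ k₁ F′ G′ ⟩
      (a₁ * b₁) * (k₁ * (F′ * G′))   ∎)
    where
    open ℚ.≤-Reasoning
    eq₁ : ∀ a k F → a * (k * F) ≡ F * (a * k)
    eq₁ = solve-∀ ℚ-ring
    eq₂ : ∀ F G a b k → (F * G) * (a * b * k) ≡ k * ((a * F) * (b * G))
    eq₂ = solve-∀ ℚ-ring
    eq₃ : ∀ a b k F G → k * ((a * F) * (b * G)) ≡ (a * b) * (k * (F * G))
    eq₃ = solve-∀ ℚ-ring

  private
    size-pos : ∀ {S : Sub n} {x} → x ∈ S → ∃ λ k → card S ≡ suc k
    size-pos {S} {x} x∈S = _ , card-remove S x x∈S

    size-pred : ∀ {S : Sub n} {x k} → x ∈ S → card S ≡ suc k → card (S ∖ ⁅ x ⁆) ≡ k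
    size-pred {S} {x} x∈S c = ℕ.suc-injective (trans (sym (card-remove S x x∈S)) c)

    P⁺-≤ : ∀ {j k} → j ℕ.≤ k → P⁺ k → P⁺ j
    P⁺-≤ j≤k p i i≤j = p i (ℕ.≤-trans i≤j j≤k)

    C⁺-≤ : ∀ {j k} → j ℕ.≤ k → C⁺ k → C⁺ j
    C⁺-≤ j≤k p i i≤j = p i (ℕ.≤-trans i≤j j≤k)

    Conn-meets : ∀ {X S u} → u ∈ S → Conn X S → ∃ λ x → x ∈ S × x ∈ X
    Conn-meets {X} {S} u∈S conn with some? (S ∩ X)
    ... | inj₁ (x , x∈) = x , ∩-∈ x∈
    ... | inj₂ none with conn ⊆-refl u∈S (λ {v} v∈S → ¬∈⇒∉ λ v∈X → ∈-∉ (∈-∩ v∈S v∈X) (none v))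
    ... | _ , _ , _ , b∈S , b∉S , _ = ∈-∉ b∈S b∉S

  -- P t k / P t (suc k) is the ratio f(S ∖ {x}) / f(S) for an end x of a path on k vertices, which is
  -- the least possible one.
  path-ratio : ∀ m k → k ℕ.≤ m → ∀ {S X} → card S ≡ k → S ⊆ D → P⁺ (2 ℕ.+ k) → Conn X S →
    P t k * f S ≤ P t (suc k) * f (S ∖ X)

  -- The case X = {x}, in which S is connected, needs one member of P fewer.
  path-ratio₁ : ∀ m k → k ℕ.≤ m → ∀ {S x} → card S ≡ suc k → S ⊆ D → P⁺ (2 ℕ.+ k) → x ∈ S → Conn ⁅ x ⁆ S →
    P t (suc k) * f S ≤ P t (2 ℕ.+ k) * f (S ∖ ⁅ x ⁆)
  path-ratio₁ m k k≤m {S} {x} c S⊆D p x∈S conn = step-ratio (P t k) (P t (suc k)) x∈S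
    (path-ratio m k k≤m (size-pred x∈S c) (⊆-trans ∖-⊆ S⊆D) p (Conn-remove conn))

  path-ratio m zero    k≤m {S} {X} c S⊆D p conn = ℚ.≤-reflexive (cong (1ℚ *_) (f-cong
    (⊆-antisym (λ {v} v∈S → ∈-∉ v∈S (card≡0 S c v)) ∖-⊆)))
  path-ratio (suc m) (suc k) (ℕ.s≤s k≤m) {S} {X} c S⊆D p conn with some? S
  ... | inj₂ none = ⊥-elim (ℕ.0≢1+n (trans (sym (card-none none)) c))
  ... | inj₁ (u , u∈S) with Conn-meets u∈S conn
  ... | x , x∈S , x∈X with component x∈S
  ... | A , x∈A , A⊆S , closed , connA with some? (S ∖ A)
  -- Here `S` is connected. As `x` lies in `X`, deleting `X` leaves at least the value that deleting
  -- `x` alone leaves.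
  ... | inj₂ none = ℚ.≤-trans (path-ratio₁ m k k≤m c S⊆D (P⁺-≤ (ℕ.n≤1+n _) p) x∈S (Conn-cong A≗S connA))
    (*-monoˡ (ℚ.<⇒≤ (p (2 ℕ.+ k) (ℕ.n≤1+n _)))
      (f-mono′ (⊆-trans ∖-⊆ S⊆D) (∖-mono ⊆-refl λ v∈x → subst (_∈ X) (sym (⁅⁆-∈ v∈x)) x∈X)))
    where
    A≗S : A ≗ S
    A≗S = ⊆-antisym A⊆S λ {v} v∈S → Sum.[ id , (λ v∉A → ∈-∉ (∈-∖ v∈S v∉A) (none v)) ]′ (∈? A v)
  ... | inj₁ (y , y∈B) with size-pos x∈A | size-pos y∈B
  ... | a , cA | b , cB = subst₂ (λ F G → P t (suc k) * F ≤ P t (2 ℕ.+ k) * G) (sym f-whole) (sym (f-parts X))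
    (ratio-product {P t (suc a)} {P t (2 ℕ.+ a)} {P t (suc b)} {P t (2 ℕ.+ b)} (p _ a≤) (p _ (ℕ.≤-trans (ℕ.n≤1+n _) b≤)) (p _ b≤)
      (f⁺ A⊆D) (f⁺ (⊆-trans ∖-⊆ A⊆D)) (f⁺ B⊆D) (p (2 ℕ.+ k) (ℕ.n≤1+n _))
      (path-ratio m (suc a) (ℕ.≤-trans a<k k≤m) cA A⊆D (P⁺-≤ (widen a<k) p) (Conn-restrict A⊆S closed conn))
      (path-ratio m (suc b) (ℕ.≤-trans b<k k≤m) cB B⊆D (P⁺-≤ (widen b<k) p)
        (Conn-restrict ∖-⊆ (Closed-∁ closed) conn))
      -- The surplus in the recombination contains `P` at two more than the size of `S`, which
      -- explains how far the hypothesis on `P` has to reach.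
      (≤-via (t * P t b * P t a * P t (4 ℕ.+ (b ℕ.+ a)))
        (0≤* (0≤* (0≤* 0≤t (ℚ.<⇒≤ (p b (ℕ.≤-trans (ℕ.m≤n+m b 2) b≤)))) (ℚ.<⇒≤ (p a (ℕ.≤-trans (ℕ.m≤n+m a 2) a≤))))
             (ℚ.<⇒≤ (p _ (ℕ.≤-reflexive (cong (2 ℕ.+_) (sym k≡))))))
        (subst (λ j → P t (suc a) * P t (suc b) * P t (suc j) ≡
                      P t (2 ℕ.+ a) * P t (2 ℕ.+ b) * P t j + t * P t b * P t a * P t (4 ℕ.+ (b ℕ.+ a)))
          (sym k≡) (P-rec.supermultiplicative t b a))))
    where
    open Split A⊆S closed
    A⊆D : A ⊆ D
    A⊆D = ⊆-trans A⊆S S⊆D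
    B⊆D : S ∖ A ⊆ D
    B⊆D = ⊆-trans ∖-⊆ S⊆D
    k≡ : suc k ≡ 2 ℕ.+ (b ℕ.+ a)
    k≡ = trans (trans (sym c) (trans card-parts (cong₂ ℕ._+_ cA cB)))
               (trans (cong suc (ℕ.+-suc a b)) (cong (2 ℕ.+_) (ℕ.+-comm a b)))
    a<k : suc a ℕ.≤ k
    a<k = subst (suc a ℕ.≤_) (sym (ℕ.suc-injective k≡)) (ℕ.s≤s (ℕ.m≤n+m a b))
    b<k : suc b ℕ.≤ k
    b<k = subst (suc b ℕ.≤_) (sym (ℕ.suc-injective k≡)) (ℕ.s≤s (ℕ.m≤m+n b a))
    widen : ∀ {i} → suc i ℕ.≤ k → 3 ℕ.+ i ℕ.≤ 3 ℕ.+ k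
    widen i<k = ℕ.≤-trans (ℕ.+-monoʳ-≤ 2 i<k) (ℕ.n≤1+n _)
    a≤ : 2 ℕ.+ a ℕ.≤ 3 ℕ.+ k
    a≤ = ℕ.≤-trans (ℕ.n≤1+n _) (widen a<k)
    b≤ : 2 ℕ.+ b ℕ.≤ 3 ℕ.+ k
    b≤ = ℕ.≤-trans (ℕ.n≤1+n _) (widen b<k)

  two-point-algebra : ∀ {p₁ p₂ q₀ q₁ K₀ A B A′ B′ Ay By} →
    0ℚ < p₁ → 0ℚ < p₂ → 0ℚ < q₀ → 0ℚ < q₁ → 0ℚ < A → 0ℚ < B → 0ℚ < A′ → B ≤ By → 0ℚ < Ay →
    0ℚ < p₂ * q₁ - t * p₁ * q₀ → 0ℚ < A * B - t * (A′ * B′) →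
    K₀ ≤ p₁ * q₁ → p₁ * A ≤ p₂ * A′ → q₀ * B ≤ q₁ * B′ → p₁ * A ≤ p₂ * Ay →
    K₀ * (A * B - t * (A′ * B′)) ≤ (p₂ * q₁ - t * p₁ * q₀) * (Ay * By)
  two-point-algebra {p₁} {p₂} {q₀} {q₁} {K₀} {A} {B} {A′} {B′} {Ay} {By}
    0<p₁ 0<p₂ 0<q₀ 0<q₁ 0<A 0<B 0<A′ B≤By 0<Ay 0<K₁ 0<F hK hA hB hy =
    *-cancelˡ 0<p₂ (begin
      p₂ * (K₀ * F)              ≤⟨ *-monoˡ (ℚ.<⇒≤ 0<p₂) (ℚ.*-monoʳ-≤-nonNeg F {{ℚ.nonNegative (ℚ.<⇒≤ 0<F)}} hK) ⟩
      p₂ * (p₁ * q₁ * F)         ≡⟨ eq₁ p₁ p₂ q₁ F ⟩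
      p₁ * (p₂ * q₁ * F)         ≤⟨ *-monoˡ (ℚ.<⇒≤ 0<p₁) mid ⟩
      p₁ * (K₁ * (A * B))        ≡⟨ eq₂ p₁ K₁ A B ⟩
      K₁ * ((p₁ * A) * B)        ≤⟨ *-monoˡ (ℚ.<⇒≤ 0<K₁) (ℚ.*-monoʳ-≤-nonNeg B {{ℚ.nonNegative (ℚ.<⇒≤ 0<B)}} hy) ⟩
      K₁ * ((p₂ * Ay) * B)       ≤⟨ *-monoˡ (ℚ.<⇒≤ 0<K₁) (*-monoˡ (ℚ.<⇒≤ (0<* 0<p₂ 0<Ay)) B≤By) ⟩
      K₁ * ((p₂ * Ay) * By)      ≡⟨ eq₃ K₁ p₂ Ay By ⟩
      p₂ * (K₁ * (Ay * By))      ∎)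
    where
    open ℚ.≤-Reasoning
    F = A * B - t * (A′ * B′)
    K₁ = p₂ * q₁ - t * p₁ * q₀
    eq₁ : ∀ p₁ p₂ q₁ F → p₂ * (p₁ * q₁ * F) ≡ p₁ * (p₂ * q₁ * F)
    eq₁ = solve-∀ ℚ-ring
    eq₂ : ∀ p₁ K A B → p₁ * (K * (A * B)) ≡ K * ((p₁ * A) * B)
    eq₂ = solve-∀ ℚ-ring
    eq₃ : ∀ K p A B → K * ((p * A) * B) ≡ p * (K * (A * B))
    eq₃ = solve-∀ ℚ-ring
    both : (p₁ * A) * (q₀ * B) ≤ (p₂ * A′) * (q₁ * B′)
    both = *-mono (ℚ.<⇒≤ (0<* 0<p₁ 0<A)) (ℚ.≤-trans (ℚ.<⇒≤ (0<* 0<q₀ 0<B)) hB) hA hB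
    mid : p₂ * q₁ * F ≤ K₁ * (A * B)
    mid = ≤-via (t * ((p₂ * A′) * (q₁ * B′) - (p₁ * A) * (q₀ * B))) (0≤* 0≤t (≤⇒0≤ both))
      (eq t p₁ p₂ q₀ q₁ A B A′ B′)
      where
      eq : ∀ t p₁ p₂ q₀ q₁ A B A′ B′ → (p₂ * q₁ - t * p₁ * q₀) * (A * B) ≡
        p₂ * q₁ * (A * B - t * (A′ * B′)) + t * ((p₂ * A′) * (q₁ * B′) - (p₁ * A) * (q₀ * B))
      eq = solve-∀ ℚ-ring

  -- The extremal case is a path with ends `x` and `y`. Delete `x` and let `A` be the component of
  -- `y` in the rest. The path ratio of `A` controls both the loss of `y` and the loss of the
  -- neighbours of `x`; for the other components only the latter matters, and submultiplicativity of
  -- `P` accounts for them.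
  two-point-ratio : ∀ {S x y} k → card S ≡ 2 ℕ.+ k → S ⊆ D → P⁺ (3 ℕ.+ k) → x ∈ S → y ∈ S → x ≢ y →
    Conn ⁅ x ⁆ S → P t (1 ℕ.+ k) * f S ≤ P t (3 ℕ.+ k) * f ((S ∖ ⁅ x ⁆) ∖ ⁅ y ⁆)
  two-point-ratio {S} {x} {y} k c S⊆D p x∈S y∈S x≢y conn with component (∈-∖x y∈S (x≢y ∘ sym))
  ... | A , y∈A , A⊆S′ , closed , connA with size-pos y∈A
  ... | a , cA = subst₂ _≤_
      (cong₂ _*_ (cong (P t) (sym k+1≡)) (sym f-S))
      (cong₂ _*_ (trans (sym (P-rec.addition t b (suc a))) (cong (P t) (sym k+3≡))) (sym (f-parts ⁅ y ⁆)))
      (two-point-algebra {P t (1 ℕ.+ a)} {P t (2 ℕ.+ a)} {P t b} {P t (1 ℕ.+ b)} {P t (b ℕ.+ suc a)}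
        (p _ (ℕ.≤-trans (ℕ.m≤n+m (suc a) 2) a≤)) (p _ (ℕ.≤-trans (ℕ.n≤1+n _) a≤))
        (p _ (ℕ.≤-trans (ℕ.m≤n+m b 2) b≤)) (p _ (ℕ.≤-trans (ℕ.n≤1+n _) b≤))
        (f⁺ A⊆D) (f⁺ B⊆D) (f⁺ (⊆-trans ∖-⊆ A⊆D)) (f-mono′ B⊆D ∖-⊆) (f⁺ (⊆-trans ∖-⊆ A⊆D))
        (subst (0ℚ <_) (trans (cong (P t) k+3≡) (P-rec.addition t b (suc a))) (p (3 ℕ.+ k) ℕ.≤-refl))
        (subst (0ℚ <_) f-S (f⁺ S⊆D))
        (P-submultiplicative a b (P⁺-≤ (ℕ.≤-trans (ℕ.≤-reflexive (cong (2 ℕ.+_) (sym k≡))) (ℕ.n≤1+n _)) p))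
        (path-ratio (suc a) (suc a) ℕ.≤-refl cA A⊆D (P⁺-≤ a≤ p) (Conn-restrict A⊆S′ closed connS′))
        (path-ratio b b ℕ.≤-refl refl B⊆D (P⁺-≤ b≤ p) (Conn-restrict ∖-⊆ (Closed-∁ closed) connS′))
        (path-ratio₁ a a ℕ.≤-refl cA A⊆D (P⁺-≤ (ℕ.≤-trans (ℕ.n≤1+n _) a≤) p) y∈A connA))
    where
    S′ = S ∖ ⁅ x ⁆
    open Split A⊆S′ closed
    b = card (S′ ∖ A)
    connS′ : Conn (E x) S′
    connS′ = Conn-remove conn
    A⊆D : A ⊆ D
    A⊆D = ⊆-trans A⊆S′ (⊆-trans ∖-⊆ S⊆D)
    B⊆D : S′ ∖ A ⊆ D
    B⊆D = ⊆-trans ∖-⊆ (⊆-trans ∖-⊆ S⊆D)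
    k≡ : k ≡ a ℕ.+ b
    k≡ = ℕ.suc-injective (trans (sym (size-pred x∈S c)) (trans card-parts (cong (ℕ._+ b) cA)))
    k+1≡ : 1 ℕ.+ k ≡ b ℕ.+ suc a
    k+1≡ = trans (cong suc k≡) (ℕ.+-comm (suc a) b)
    k+3≡ : 3 ℕ.+ k ≡ 2 ℕ.+ (b ℕ.+ suc a)
    k+3≡ = cong (2 ℕ.+_) k+1≡
    a≤ : 3 ℕ.+ a ℕ.≤ 3 ℕ.+ k
    a≤ = ℕ.+-monoʳ-≤ 3 (subst (a ℕ.≤_) (sym k≡) (ℕ.m≤m+n a b))
    b≤ : 2 ℕ.+ b ℕ.≤ 3 ℕ.+ k
    b≤ = ℕ.≤-trans (ℕ.n≤1+n _) (ℕ.+-monoʳ-≤ 3 (subst (b ℕ.≤_) (sym k≡) (ℕ.m≤n+m b a)))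
    f-S : f S ≡ f A * f (S′ ∖ A) - t * (f (A ∖ E x) * f ((S′ ∖ A) ∖ E x))
    f-S = trans (f-remove x∈S) (cong₂ (λ F G → F - t * G) f-whole (f-parts (E x)))

  private
    -- The recurrence at the new vertex `b` deletes all its neighbours, but knowing one of them,
    -- `a`, is enough: deleting further vertices only increases `f`.
    insert-ratio : ∀ {T a b} lo mid → 0ℚ ≤ mid → T ⊆ D → a ∈ T → b ∉ T → E a b ≡ true →
      lo * f T ≤ mid * f (T ∖ ⁅ a ⁆) → mid * f (T ∪ ⁅ b ⁆) ≤ (mid - t * lo) * f T
    insert-ratio {T} {a} {b} lo mid 0≤mid T⊆D a∈T b∉T e h = subst (λ F → mid * f (T ∪ ⁅ b ⁆) ≤ (mid - t * lo) * F) T≡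
      (step-ratio lo mid (∈-∪ʳ (∈-⁅⁆ b)) (subst (λ F → lo * F ≤ mid * f (((T ∪ ⁅ b ⁆) ∖ ⁅ b ⁆) ∖ E b)) (sym T≡)
        (ℚ.≤-trans h (*-monoˡ 0≤mid (ℚ.≤-trans
          (f-mono′ (⊆-trans ∖-⊆ T⊆D) (∖-mono ⊆-refl λ v∈a → subst (_∈ E b) (sym (⁅⁆-∈ v∈a)) (in! (flip e))))
          (ℚ.≤-reflexive (f-cong (⊆-antisym (∖-mono (≗⇒⊆ (sym ∘ insert-remove b∉T)) ⊆-refl)
                                            (∖-mono (≗⇒⊆ (insert-remove b∉T)) ⊆-refl)))))))))
      where
      T≡ : f ((T ∪ ⁅ b ⁆) ∖ ⁅ b ⁆) ≡ f T
      T≡ = f-cong (insert-remove b∉T)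

    -- One inequality gives two results: since `F`, `G` and `mid` are positive it forces `next` to
    -- be positive, and then the bound is passed on from `F` to `G`. This is how positivity of `P`
    -- and `C` is obtained.
    next-bound : ∀ {mid next F G} → 0ℚ < mid → 0ℚ < F → 0ℚ < G → F ≤ mid → mid * G ≤ next * F → 0ℚ < next × G ≤ next
    next-bound {mid} {next} {F} {G} 0<mid 0<F 0<G F≤mid h = 0<next , *-cancelˡ 0<mid
      (ℚ.≤-trans h (subst (next * F ≤_) (ℚ.*-comm next mid) (*-monoˡ (ℚ.<⇒≤ 0<next) F≤mid)))
      where
      0<next : 0ℚ < next
      0<next = 0<-cancelˡ 0<F (ℚ.<-≤-trans (0<* 0<mid 0<G) (subst (mid * G ≤_) (ℚ.*-comm next F) h))

    extend : ∀ {Q : ℕ → Set} {k} → (∀ j → j ℕ.≤ k → Q j) → Q (suc k) → ∀ j → j ℕ.≤ suc k → Q j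
    extend below top j j≤ = Sum.[ (λ j< → below j (ℕ.≤-pred j<)) , (λ { refl → top }) ]′ (ℕ.m≤n⇒m<n∨m≡n j≤)

  path-bound : ∀ {S r} → S ⊆ D → r ∈ S → Conn ⁅ r ⁆ S →
    P⁺ (suc (card S)) × f S ≤ P t (suc (card S))
  path-bound {S} {r} S⊆D r∈S conn =
    let _ , p , b = grow Bounded Bounded-cong conn step (∈-⁅⁆ r) (λ v∈ → subst (_∈ S) (sym (⁅⁆-∈ v∈)) r∈S) base in p , b
    where
    Bounded : Sub n → Set
    Bounded T = Conn ⁅ r ⁆ T × P⁺ (suc (card T)) × f T ≤ P t (suc (card T))
    Bounded-cong : ∀ {T T′} → T ≗ T′ → Bounded T → Bounded T′
    Bounded-cong T≗ (conn , p , b) = Conn-cong T≗ conn , subst (P⁺ ∘ suc) (card-cong T≗) p ,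
      subst₂ (λ F k → F ≤ P t (suc k)) (f-cong T≗) (card-cong T≗) b
    none : ∀ v → v ∉ ⁅ r ⁆ ∖ ⁅ r ⁆
    none v = ¬∈⇒∉ λ p → ∈-∉ (∖-⊆ p) (proj₂ (∖-∈ p))
    card-r : card ⁅ r ⁆ ≡ 1
    card-r = trans (card-remove ⁅ r ⁆ r (∈-⁅⁆ r)) (cong suc (card-none none))
    f-r : f ⁅ r ⁆ ≡ P t 2
    f-r = trans (f-remove (∈-⁅⁆ r)) (cong₂ (λ F G → F - t * G) (f-none none) (f-none (λ v → ∉-∖ˡ (none v))))
    base : Bounded ⁅ r ⁆
    base = Conn-⁅⁆ , subst (P⁺ ∘ suc) (sym card-r) p₂ , ℚ.≤-reflexive (trans f-r (cong (P t ∘ suc) (sym card-r)))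
      where
      p₂ : P⁺ 2
      p₂ 0 _ = 0<1
      p₂ 1 _ = 0<1
      p₂ 2 _ = subst (0ℚ <_) f-r (f⁺ (λ v∈ → S⊆D (subst (_∈ S) (sym (⁅⁆-∈ v∈)) r∈S)))
      p₂ (suc (suc (suc _))) (ℕ.s≤s (ℕ.s≤s ()))
    step : ∀ {T a b} → T ⊆ S → r ∈ T → a ∈ T → b ∈ S → b ∉ T → E a b ≡ true → Bounded T → Bounded (T ∪ ⁅ b ⁆)
    step {T} {a} {b} T⊆S r∈T a∈T b∈S b∉T e (conn , p , bound) with size-pos a∈T
    ... | k , c rewrite card-insert T b b∉T | c =
      let 0<next , G≤next = next-bound (p (2 ℕ.+ k) ℕ.≤-refl) (f⁺ (⊆-trans T⊆S S⊆D)) (f⁺ T∪b⊆D) bound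
            (insert-ratio (P t (suc k)) (P t (2 ℕ.+ k)) (ℚ.<⇒≤ (p (2 ℕ.+ k) ℕ.≤-refl)) (⊆-trans T⊆S S⊆D) a∈T b∉T e
              (path-ratio₁ k k ℕ.≤-refl c (⊆-trans T⊆S S⊆D) p a∈T (Conn-reroot r∈T a∈T conn)))
      in Conn-grow conn a∈T b∉T e , extend p 0<next , G≤next
      where
      T∪b⊆D : T ∪ ⁅ b ⁆ ⊆ D
      T∪b⊆D v∈ = Sum.[ (λ v∈T → S⊆D (T⊆S v∈T)) , (λ v∈b → subst (_∈ D) (sym (⁅⁆-∈ v∈b)) (S⊆D b∈S)) ]′ (∪-∈ v∈)

  Doubly : Sub n → Sub n → Set
  Doubly X S = ∃ λ y → ∃ λ z → (y ∈ S × y ∈ X) × (z ∈ S × z ∈ X) × y ≢ z × Linked S y z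

  -- S contains the cycle K, or attaching a new vertex to all of X would create a cycle through it.
  Cyclic : Sub n → Sub n → Sub n → Set
  Cyclic K X S = K ⊆ S ⊎ Doubly X S

  module Cycles {K : Sub n} {c : Fin n} (cycle : CycleSet K c) (posP : P⁺ (suc (card D))) where
    open CycleSet cycle

    private
      two-elements : ∀ {S : Sub n} {y z} → y ∈ S → z ∈ S → y ≢ z → ∃ λ k → card S ≡ 2 ℕ.+ k
      two-elements {S} {y} {z} y∈S z∈S y≢z =
        _ , trans (card-remove S y y∈S) (cong suc (card-remove _ z (∈-∖x z∈S (y≢z ∘ sym))))

      cyclic-size : ∀ {X S : Sub n} → Cyclic K X S → ∃ λ k → card S ≡ 2 ℕ.+ k
      cyclic-size (inj₁ K⊆S) with around root
      ... | y , z , y∈ , z∈ , y≢z , _ = two-elements (K⊆S (∖-⊆ y∈)) (K⊆S (∖-⊆ z∈)) y≢z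
      cyclic-size (inj₂ (y , z , (y∈S , _) , (z∈S , _) , y≢z , _)) = two-elements y∈S z∈S y≢z

      sizeP : ∀ {S : Sub n} {j} → S ⊆ D → card S ≡ j → P⁺ (suc j)
      sizeP S⊆D refl = P⁺-≤ (ℕ.s≤s (card-mono _ _ S⊆D)) posP

    -- The bound `C t k / C t (suc k)` is chosen because the recurrence of `C` reproduces it; at a
    -- vertex of the cycle itself the ratio is at least this. The second form of `Cyclic` is what
    -- the first one becomes when a vertex of the cycle is deleted.
    cycle-ratio : ∀ m k → k ℕ.≤ m → ∀ {S X} → card S ≡ suc k → S ⊆ D → C⁺ (2 ℕ.+ k) → Conn X S → Cyclic K X S →
      C t k * f S ≤ C t (suc k) * f (S ∖ X)

    cycle-ratio₁ : ∀ m k → k ℕ.≤ m → ∀ {S x} → card S ≡ 2 ℕ.+ k → S ⊆ D → C⁺ (2 ℕ.+ k) → x ∈ S → Conn ⁅ x ⁆ S →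
      K ⊆ S → C t (suc k) * f S ≤ C t (2 ℕ.+ k) * f (S ∖ ⁅ x ⁆)
    cycle-ratio₁ m k k≤m {S} {x} c S⊆D p x∈S conn K⊆S = step-ratio (C t k) (C t (suc k)) x∈S
      (cycle-ratio m k k≤m (size-pred x∈S c) (⊆-trans ∖-⊆ S⊆D) p (Conn-remove conn) cyclic)
      where
      cyclic : Cyclic K (E x) (S ∖ ⁅ x ⁆)
      cyclic with ∈? K x
      ... | inj₂ x∉K = inj₁ (λ v∈K → ∈-∖x (K⊆S v∈K) (∈-∉-≢ v∈K x∉K))
      -- The deleted vertex lies on the cycle, so its two neighbours there remain and are still
      -- linked by the rest of the cycle.
      ... | inj₁ x∈K =
        let y , z , y∈ , z∈ , y≢z , ey , ez , linked = around x∈K ; K∖x⊆ = ∖-mono K⊆S ⊆-refl in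
        inj₂ (z , y , (K∖x⊆ z∈ , in! ez) , (K∖x⊆ y∈ , in! ey) , y≢z ∘ sym , Linked-⊆ K∖x⊆ (linked z∈))

    cycle-ratio m zero k≤m c S⊆D p conn cyclic with cyclic-size cyclic
    ... | _ , c′ = ⊥-elim (ℕ.0≢1+n (ℕ.suc-injective (trans (sym c) c′)))
    cycle-ratio (suc m) (suc k) (ℕ.s≤s k≤m) {S} {X} cS S⊆D p conn cyclic with some? S
    ... | inj₂ none = ⊥-elim (ℕ.0≢1+n (trans (sym (card-none none)) cS))
    ... | inj₁ (u , u∈S) with Conn-meets u∈S conn
    ... | x , x∈S , x∈X with component x∈S
    ... | A , x∈A , A⊆S , closed , connA with some? (S ∖ A)
    -- A disconnected `S` has its cyclic structure on one side of the split. That side gets the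
    -- bound from `C`, the other the bound from `P`.
    ... | inj₁ (y , y∈B) = Sum.[ split A⊆S closed y∈B , split ∖-⊆ (Closed-∁ closed) (∈-∖ x∈S (∉-∖ʳ x∈A)) ]′ (which cyclic)
      where
      which : Cyclic K X S → Cyclic K X A ⊎ Cyclic K X (S ∖ A)
      which (inj₁ K⊆S) with ∈? A c
      ... | inj₁ c∈A = inj₁ (inj₁ λ v∈K → joined v∈K A (Closed-⊆ K⊆S closed) c∈A)
      ... | inj₂ c∉A = inj₂ (inj₁ λ v∈K → joined v∈K (S ∖ A) (Closed-⊆ K⊆S (Closed-∁ closed)) (∈-∖ (K⊆S root) c∉A))
      which (inj₂ (y , z , (y∈S , y∈X) , (z∈S , z∈X) , y≢z , linked)) with ∈? A y
      ... | inj₁ y∈A = inj₁ (inj₂ (y , z , (y∈A , y∈X) , (linked A closed y∈A , z∈X) , y≢z ,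
                         Linked-restrict closed y∈A linked))
      ... | inj₂ y∉A = inj₂ (inj₂ (y , z , (∈-∖ y∈S y∉A , y∈X) ,
                         (linked (S ∖ A) (Closed-∁ closed) (∈-∖ y∈S y∉A) , z∈X) , y≢z ,
                         Linked-restrict (Closed-∁ closed) (∈-∖ y∈S y∉A) linked))

      split : ∀ {A y} → A ⊆ S → Closed S A → y ∈ S ∖ A → Cyclic K X A →
        C t (suc k) * f S ≤ C t (2 ℕ.+ k) * f (S ∖ X)
      split {A} A⊆S closed y∈B cyclicA with cyclic-size cyclicA | size-pos y∈B
      ... | a , cA | b , cB = subst₂ (λ F G → C t (suc k) * F ≤ C t (2 ℕ.+ k) * G) (sym f-whole) (sym (f-parts X))
        (ratio-product {C t (1 ℕ.+ a)} {C t (2 ℕ.+ a)} {P t (1 ℕ.+ b)} {P t (2 ℕ.+ b)}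
          (p _ (ℕ.≤-trans (ℕ.n≤1+n _) a≤)) (pB (suc b) (ℕ.m≤n+m _ 2)) (pB (2 ℕ.+ b) (ℕ.n≤1+n _))
          (f⁺ A⊆D) (f⁺ (⊆-trans ∖-⊆ A⊆D)) (f⁺ B⊆D) (p (2 ℕ.+ k) (ℕ.n≤1+n _))
          (cycle-ratio m (suc a) (ℕ.≤-trans a<k k≤m) cA A⊆D (C⁺-≤ a≤ p) (Conn-restrict A⊆S closed conn) cyclicA)
          (path-ratio (suc b) (suc b) ℕ.≤-refl cB B⊆D pB (Conn-restrict ∖-⊆ (Closed-∁ closed) conn))
          (≤-via (t * P t b * C t a * C t (4 ℕ.+ (b ℕ.+ a)))
            (0≤* (0≤* (0≤* 0≤t (ℚ.<⇒≤ (pB b (ℕ.m≤n+m _ 3)))) (ℚ.<⇒≤ (p a (ℕ.≤-trans (ℕ.m≤n+m a 3) a≤))))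
                 (ℚ.<⇒≤ (p _ (ℕ.≤-reflexive (cong (3 ℕ.+_) (sym k≡))))))
            (subst (λ j → C t (suc a) * P t (suc b) * C t (suc j) ≡
                          C t (2 ℕ.+ a) * P t (2 ℕ.+ b) * C t j + t * P t b * C t a * C t (4 ℕ.+ (b ℕ.+ a)))
              (cong suc (sym k≡)) (C-rec.supermultiplicative t b a))))
        where
        open Split A⊆S closed
        A⊆D : A ⊆ D
        A⊆D = ⊆-trans A⊆S S⊆D
        B⊆D : S ∖ A ⊆ D
        B⊆D = ⊆-trans ∖-⊆ S⊆D
        k≡ : k ≡ suc (b ℕ.+ a)
        k≡ = ℕ.suc-injective (ℕ.suc-injective (trans (sym cS) (trans card-parts (trans (cong₂ ℕ._+_ cA cB)
          (trans (cong (2 ℕ.+_) (ℕ.+-suc a b)) (cong (3 ℕ.+_) (ℕ.+-comm a b)))))))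
        a<k : suc a ℕ.≤ k
        a<k = subst (suc a ℕ.≤_) (sym k≡) (ℕ.s≤s (ℕ.m≤n+m a b))
        a≤ : 3 ℕ.+ a ℕ.≤ 3 ℕ.+ k
        a≤ = ℕ.+-monoʳ-≤ 3 (ℕ.≤-trans (ℕ.n≤1+n a) a<k)
        pB : P⁺ (3 ℕ.+ b)
        pB = P⁺-≤ (ℕ.+-monoʳ-≤ 3 (ℕ.≤-trans (ℕ.n≤1+n b) (subst (suc b ℕ.≤_) (sym k≡) (ℕ.s≤s (ℕ.m≤m+n b a)))))
               (sizeP S⊆D cS)
    ... | inj₂ none = connected cyclic
      where
      A≗S : A ≗ S
      A≗S = ⊆-antisym A⊆S λ {v} v∈S → Sum.[ id , (λ v∉A → ∈-∉ (∈-∖ v∈S v∉A) (none v)) ]′ (∈? A v)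
      conn₁ : Conn ⁅ x ⁆ S
      conn₁ = Conn-cong A≗S connA
      doubly-algebra : ∀ {p₁ p₃ c₁ c₂ F G} → 0ℚ < p₃ → 0ℚ < c₂ → 0ℚ ≤ F → p₁ * F ≤ p₃ * G → p₃ * c₁ ≤ p₁ * c₂ →
        c₁ * F ≤ c₂ * G
      doubly-algebra {p₁} {p₃} {c₁} {c₂} {F} {G} 0<p₃ 0<c₂ 0≤F hF hc = *-cancelˡ 0<p₃
        (subst₂ _≤_ (ℚ.*-assoc p₃ c₁ F) (eq₂ c₂ p₃ G)
          (ℚ.≤-trans (ℚ.*-monoʳ-≤-nonNeg F {{ℚ.nonNegative 0≤F}} hc)
            (subst (_≤ c₂ * (p₃ * G)) (eq₁ c₂ p₁ F) (*-monoˡ (ℚ.<⇒≤ 0<c₂) hF))))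
        where
        eq₁ : ∀ c p F → c * (p * F) ≡ p * c * F
        eq₁ = solve-∀ ℚ-ring
        eq₂ : ∀ c p G → c * (p * G) ≡ p * (c * G)
        eq₂ = solve-∀ ℚ-ring
      connected : Cyclic K X S → C t (suc k) * f S ≤ C t (2 ℕ.+ k) * f (S ∖ X)
      connected (inj₁ K⊆S) = ℚ.≤-trans
        (cycle-ratio₁ m k k≤m cS S⊆D (C⁺-≤ (ℕ.n≤1+n _) p) x∈S conn₁ K⊆S)
        (*-monoˡ (ℚ.<⇒≤ (p (2 ℕ.+ k) (ℕ.n≤1+n _)))
          (f-mono′ (⊆-trans ∖-⊆ S⊆D) (∖-mono ⊆-refl λ v∈x → subst (_∈ X) (sym (⁅⁆-∈ v∈x)) x∈X)))
      -- Only `y` and `z` of all of `X` are deleted. The extremal set is now a path with these two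
      -- ends, and `P-C-ratio` compares it with the cycle.
      connected (inj₂ (y , z , (y∈S , y∈X) , (z∈S , z∈X) , y≢z , _)) = ℚ.≤-trans
        (doubly-algebra {P t (suc k)} (sizeP S⊆D cS (3 ℕ.+ k) ℕ.≤-refl) (p (2 ℕ.+ k) (ℕ.n≤1+n _)) (ℚ.<⇒≤ (f⁺ S⊆D))
          (two-point-ratio k cS S⊆D (sizeP S⊆D cS) y∈S z∈S y≢z (Conn-reroot x∈S y∈S conn₁))
          (P-C-ratio k (P⁺-≤ (ℕ.≤-trans (ℕ.n≤1+n _) (ℕ.n≤1+n _)) (sizeP S⊆D cS)) (ℚ.<⇒≤ (p (3 ℕ.+ k) ℕ.≤-refl))))
        (*-monoˡ (ℚ.<⇒≤ (p (2 ℕ.+ k) (ℕ.n≤1+n _)))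
          (f-mono′ (⊆-trans ∖-⊆ (⊆-trans ∖-⊆ S⊆D))
            λ v∈ → let v∈S , v∉X = ∖-∈ v∈ in
              ∈-∖x (∈-∖x v∈S (∈-∉-≢ y∈X v∉X ∘ sym)) (∈-∉-≢ z∈X v∉X ∘ sym)))

    cycle-bound : K ⊆ D → Conn ⁅ c ⁆ D → 0ℚ < C t (card D) × f D ≤ C t (card D)
    cycle-bound K⊆D conn =
      let _ , _ , p , b = grow Bounded Bounded-cong conn step root K⊆D base in p (card D) ℕ.≤-refl , b
      where
      Bounded : Sub n → Set
      Bounded T = Conn ⁅ c ⁆ T × K ⊆ T × C⁺ (card T) × f T ≤ C t (card T)
      Bounded-cong : ∀ {T T′} → T ≗ T′ → Bounded T → Bounded T′
      Bounded-cong T≗ (conn , K⊆T , p , b) = Conn-cong T≗ conn , ⊆-trans K⊆T (≗⇒⊆ T≗) , subst C⁺ (card-cong T≗) p ,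
        subst₂ (λ F k → F ≤ C t k) (f-cong T≗) (card-cong T≗) b
      base : Bounded K
      base with around root
      ... | y , z , y∈ , z∈ , y≢z , ey , ez , linked with two-elements y∈ z∈ y≢z
      ... | j , cK′ = Linked⇒Conn (λ v∈K → Linked-sym root (joined v∈K)) , ⊆-refl ,
        -- The estimate for `K` gives positivity of `C` at the length of the cycle only; the smaller
        -- indices follow by descent.
        subst C⁺ (sym cK) (C-positive-below (3 ℕ.+ j) p (proj₁ result)) ,
        subst (λ k → f K ≤ C t k) (sym cK) (proj₂ result)
        where
        K′ = K ∖ ⁅ c ⁆
        K′⊆D : K′ ⊆ D
        K′⊆D = ⊆-trans ∖-⊆ K⊆D
        cK : card K ≡ 3 ℕ.+ j
        cK = trans (card-remove K c root) (cong suc cK′)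
        connK′ : Conn ⁅ y ⁆ K′
        connK′ = Linked⇒Conn linked
        bound : P⁺ (3 ℕ.+ j) × f K′ ≤ P t (3 ℕ.+ j)
        bound = subst (λ k → P⁺ (suc k) × f K′ ≤ P t (suc k)) cK′ (path-bound K′⊆D y∈ connK′)
        p : P⁺ (3 ℕ.+ j)
        p = proj₁ bound
        -- Without `c` the cycle is compared with a path on `2 + j` vertices whose ends are the
        -- neighbours `y` and `z` of `c`. Restoring `c` turns `P t (3 + j)` into
        -- `P t (3 + j) - t * P t (1 + j)`, which is `C t (3 + j)`.
        result : 0ℚ < C t (3 ℕ.+ j) × f K ≤ C t (3 ℕ.+ j)
        result = next-bound (p (3 ℕ.+ j) ℕ.≤-refl) (f⁺ K′⊆D) (f⁺ K⊆D) (proj₂ bound)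
          (subst (λ r → P t (3 ℕ.+ j) * f K ≤ r * f K′) (sym (C-via-P t (suc j)))
            (step-ratio (P t (1 ℕ.+ j)) (P t (3 ℕ.+ j)) root (ℚ.≤-trans
              (two-point-ratio j cK′ K′⊆D p y∈ z∈ y≢z connK′)
              (*-monoˡ (ℚ.<⇒≤ (p (3 ℕ.+ j) ℕ.≤-refl)) (f-mono′ (⊆-trans ∖-⊆ (⊆-trans ∖-⊆ K′⊆D))
                λ v∈ → let v∈K′ , v∉E = ∖-∈ v∈ in
                  ∈-∖x (∈-∖x v∈K′ (∈-∉-≢ (in! ey) v∉E ∘ sym)) (∈-∉-≢ (in! ez) v∉E ∘ sym))))))
      step : ∀ {T a b} → T ⊆ D → c ∈ T → a ∈ T → b ∈ D → b ∉ T → E a b ≡ true → Bounded T → Bounded (T ∪ ⁅ b ⁆)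
      step {T} {a} {b} T⊆D c∈T a∈T b∈D b∉T e (conn , K⊆T , p , bound) with cyclic-size {K} (inj₁ K⊆T)
      ... | k , cT rewrite card-insert T b b∉T | cT =
        let 0<next , G≤next = next-bound (p (2 ℕ.+ k) ℕ.≤-refl) (f⁺ T⊆D) (f⁺ T∪b⊆D) bound
              (insert-ratio (C t (suc k)) (C t (2 ℕ.+ k)) (ℚ.<⇒≤ (p (2 ℕ.+ k) ℕ.≤-refl)) T⊆D a∈T b∉T e
                (cycle-ratio₁ k k ℕ.≤-refl cT T⊆D p a∈T (Conn-reroot c∈T a∈T conn) K⊆T))
        in Conn-grow conn a∈T b∉T e , (λ v∈K → ∈-∪ˡ (K⊆T v∈K)) , extend p 0<next , G≤next
        where
        T∪b⊆D : T ∪ ⁅ b ⁆ ⊆ D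
        T∪b⊆D v∈ = Sum.[ T⊆D , (λ v∈b → subst (_∈ D) (sym (⁅⁆-∈ v∈b)) b∈D) ]′ (∪-∈ v∈)

-- The lower bound

-- The value at −t of the independence polynomial of the triangle with k further leaves at one vertex.
U-poly : ℚ → ℕ → ℚ
U-poly t k = (1ℚ - t) ^ k * (1ℚ - (t + t)) - t

module LowerBound {n} (E : Adj n) (E-sym : Sym E) (E-irr : ∀ v → E v v ≡ false)
  (t : ℚ) (0≤t : 0ℚ ≤ t) (t<1 : 0ℚ < 1ℚ - t) where

  open Weighted E E-sym t
  open Connectivity E E-sym using (edge?; AtMostOne; Forest; Pseudoforest)

  private
    a = 1ℚ - t

    a≤1 : a ≤ 1ℚ
    a≤1 = ≤-via t 0≤t (eq t)
      where
      eq : ∀ t → 1ℚ ≡ (1ℚ - t) + t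
      eq = solve-∀ ℚ-ring

    0≤a^ : ∀ k → 0ℚ ≤ a ^ k
    0≤a^ k = ℚ.<⇒≤ (0<^ k t<1)

    a^-suc : ∀ k → a ^ suc k ≤ a ^ k
    a^-suc k = subst (a ^ suc k ≤_) (ℚ.*-identityˡ (a ^ k))
      (ℚ.*-monoʳ-≤-nonNeg (a ^ k) {{ℚ.nonNegative (0≤a^ k)}} a≤1)

    a^-≤ : ∀ {j k} → j ℕ.≤ k → a ^ k ≤ a ^ j
    a^-≤ {j} {k} j≤k = subst (λ i → a ^ i ≤ a ^ j) (ℕ.m∸n+n≡m j≤k) (go (k ℕ.∸ j))
      where
      go : ∀ i → a ^ (i ℕ.+ j) ≤ a ^ j
      go zero    = ℚ.≤-refl
      go (suc i) = ℚ.≤-trans (a^-suc (i ℕ.+ j)) (go i)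

    f-insert-≤ : ∀ {S x} → Pos S → x ∈ S → f S ≤ a * f (S ∖ ⁅ x ⁆)
    f-insert-≤ {S} {x} pos x∈S = ≤-via (t * (G - F)) (0≤* 0≤t (≤⇒0≤ (f-mono 0≤t pos ∖-⊆ ∖-⊆)))
      (trans (eq t F G) (cong (_+ t * (G - F)) (sym (f-remove x∈S))))
      where
      F = f (S ∖ ⁅ x ⁆)
      G = f ((S ∖ ⁅ x ⁆) ∖ E x)
      eq : ∀ t F G → (1ℚ - t) * F ≡ (F - t * G) + t * (G - F)
      eq = solve-∀ ℚ-ring

  f-power-bound : ∀ k {S} → Pos S → card S ≡ k → f S ≤ a ^ k
  f-power-bound zero    {S} pos c = ℚ.≤-reflexive (f-none (card≡0 S c))
  f-power-bound (suc k) {S} pos c with some? S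
  ... | inj₂ none = ⊥-elim (ℕ.0≢1+n (trans (sym (card-none none)) c))
  ... | inj₁ (x , x∈S) = ℚ.≤-trans (f-insert-≤ pos x∈S)
    (*-monoˡ (ℚ.<⇒≤ t<1) (f-power-bound k (Pos-⊆ ∖-⊆ pos) (ℕ.suc-injective (trans (sym (card-remove S x x∈S)) c))))

  -- The star on 1 + k vertices has the value (1 − t)^k − t.
  forest-bound : ∀ {D} → Forest D → ∀ k → t < a ^ k →
    ∀ {S} → S ⊆ D → card S ≡ suc k → a ^ k - t ≤ f S
  -- Positivity is produced and not assumed: `t < a ^ k` makes the star bound positive at size
  -- `suc k`, and also at all smaller sizes because `a ^ k` decreases. In return the induction for
  -- the bound uses it for the upper estimate of the subtracted term.
  forest-pos : ∀ {D} → Forest D → ∀ k → t < a ^ k → ∀ {S} → S ⊆ D → card S ℕ.≤ suc k → 0ℚ < f S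

  forest-pos forest k t<a^k {S} S⊆D c≤ with card S in c
  ... | zero  = subst (0ℚ <_) (sym (f-none (card≡0 S c))) 0<1
  ... | suc j with ℕ.m≤n⇒m<n∨m≡n c≤
  forest-pos forest (suc k) t<a^k {S} S⊆D c≤ | suc j | inj₁ j<k = forest-pos forest k (ℚ.<-≤-trans t<a^k (a^-suc k)) S⊆D
    (subst (ℕ._≤ suc k) (sym c) (ℕ.≤-pred j<k))
  forest-pos forest zero t<a^k {S} S⊆D c≤ | suc j | inj₁ (ℕ.s≤s ())
  forest-pos forest k t<a^k {S} S⊆D c≤ | suc .k | inj₂ refl =
    ℚ.<-≤-trans (<⇒0< t<a^k) (forest-bound forest k t<a^k S⊆D c)

  forest-bound forest zero t<1′ {S} S⊆D c with some? S
  ... | inj₂ none = ⊥-elim (ℕ.0≢1+n (trans (sym (card-none none)) c))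
  ... | inj₁ (x , x∈S) = ℚ.≤-reflexive (sym (trans (f-remove x∈S)
    (trans (cong₂ (λ F G → F - t * G) (f-none none) (f-none (λ v → ∉-∖ˡ (none v)))) (eq t))))
    where
    none : ∀ v → v ∉ S ∖ ⁅ x ⁆
    none = card≡0 _ (ℕ.suc-injective (trans (sym (card-remove S x x∈S)) c))
    eq : ∀ t → 1ℚ - t * 1ℚ ≡ 1ℚ - t
    eq = solve-∀ ℚ-ring
  forest-bound forest (suc k) t<a^k {S} S⊆D c with some? S
  ... | inj₂ none = ⊥-elim (ℕ.0≢1+n (trans (sym (card-none none)) c))
  ... | inj₁ (v , v∈S) with forest S⊆D v∈S
  ... | x , x∈S , one = subst (a ^ suc k - t ≤_) (sym (f-remove x∈S)) bound
    where
    S′ = S ∖ ⁅ x ⁆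
    S′⊆D : S′ ⊆ _
    S′⊆D p = S⊆D (∖-⊆ p)
    t<a^k′ : t < a ^ k
    t<a^k′ = ℚ.<-≤-trans t<a^k (a^-suc k)
    c′ : card S′ ≡ suc k
    c′ = ℕ.suc-injective (trans (sym (card-remove S x x∈S)) c)
    pos′ : Pos S′
    pos′ T T⊆S′ = forest-pos forest k t<a^k′ (λ p → S′⊆D (T⊆S′ p)) (subst (card T ℕ.≤_) c′ (card-mono T S′ T⊆S′))
    lower : a ^ k - t ≤ f S′
    lower = forest-bound forest k t<a^k′ S′⊆D c′
    eq₁ : ∀ t X → (1ℚ - t) * X ≡ X - t * X
    eq₁ = solve-∀ ℚ-ring
    bound : a ^ suc k - t ≤ f S′ - t * f (S′ ∖ E x)
    bound with some? (S′ ∩ E x)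
    ... | inj₂ none = subst (λ G → a ^ suc k - t ≤ f S′ - t * G)
      (f-cong (⊆-antisym (λ {v} p → ∈-∖ p (¬∈⇒∉ λ q → ∈-∉ (∈-∩ p q) (none v))) ∖-⊆))
      (ℚ.≤-trans (≤-via (t * t) (0≤* 0≤t 0≤t) (eq₂ t (a ^ k)))
        (subst (a * (a ^ k - t) ≤_) (eq₁ t (f S′)) (*-monoˡ (ℚ.<⇒≤ t<1) lower)))
      where
      eq₂ : ∀ t X → (1ℚ - t) * (X - t) ≡ ((1ℚ - t) * X - t) + t * t
      eq₂ = solve-∀ ℚ-ring
    -- With `x` a leaf at `u`, the subtracted set is S′ without `u`, of `k` vertices, and its value
    -- is at most that of `k` isolated vertices. With `X` for `a ^ k`, the inductive bound becomes
    -- `(X - t) - t * X`, which is the next one.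
    ... | inj₁ (u , u∈) = ≤-via ((f S′ - (a ^ k - t)) + t * (a ^ k - f (S′ ∖ E x)))
      (0≤+ (≤⇒0≤ lower) (0≤* 0≤t (≤⇒0≤ upper)))
      (eq₃ t (a ^ k) (f S′) (f (S′ ∖ E x)))
      where
      eq₃ : ∀ t X F G → F - t * G ≡ ((1ℚ - t) * X - t) + ((F - (X - t)) + t * (X - G))
      eq₃ = solve-∀ ℚ-ring
      upper : f (S′ ∖ E x) ≤ a ^ k
      upper = f-power-bound k (Pos-⊆ ∖-⊆ pos′) (trans
        (card-cong (⊆-antisym
          (λ p → let q , r = ∖-∈ p in ∈-∖x q λ { refl → ∈-∉ (proj₂ (∩-∈ u∈)) r })
          (λ p → let q , r = ∖x-∈ p in ∈-∖ q (¬∈⇒∉ λ e → r (one (∖-⊆ q) (∖-⊆ (proj₁ (∩-∈ u∈))) (holds e) (holds (proj₂ (∩-∈ u∈))))))))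
        (ℕ.suc-injective (trans (sym (card-remove S′ u (proj₁ (∩-∈ u∈)))) c′)))

  -- The extremal set consists of the edge `p q` and `k` isolated vertices.
  f-edge-bound : ∀ {S p q} k → Pos S → card S ≡ 2 ℕ.+ k → p ∈ S → q ∈ S → p ≢ q → E p q ≡ true →
    f S ≤ a ^ k * (1ℚ - (t + t))
  f-edge-bound {S} {p} {q} k pos c p∈S q∈S p≢q e = ℚ.≤-trans f≤H
    (ℚ.*-monoʳ-≤-nonNeg (1ℚ - (t + t)) {{ℚ.nonNegative 0≤b}}
      (f-power-bound k (Pos-⊆ (⊆-trans ∖-⊆ ∖-⊆) pos)
        (ℕ.suc-injective (trans (sym (card-remove S′ q q∈S′)) (ℕ.suc-injective (trans (sym (card-remove S p p∈S)) c))))))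
    where
    S′ = S ∖ ⁅ p ⁆
    q∈S′ : q ∈ S′
    q∈S′ = ∈-∖x q∈S (p≢q ∘ sym)
    F = f S′
    G = f (S′ ∖ E p)
    H = f (S′ ∖ ⁅ q ⁆)
    H≤G : H ≤ G
    H≤G = f-mono 0≤t pos (⊆-trans ∖-⊆ ∖-⊆) (∖-mono ⊆-refl λ v∈q → subst (_∈ E p) (sym (⁅⁆-∈ v∈q)) (in! e))
    f≤H : f S ≤ H * (1ℚ - (t + t))
    f≤H = ≤-via ((a * H - F) + t * (G - H)) (0≤+ (≤⇒0≤ (f-insert-≤ (Pos-⊆ ∖-⊆ pos) q∈S′)) (0≤* 0≤t (≤⇒0≤ H≤G)))
      (trans (eq t F G H) (cong (_+ ((a * H - F) + t * (G - H))) (sym (f-remove p∈S))))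
      where
      eq : ∀ t F G H → H * (1ℚ - (t + t)) ≡ (F - t * G) + (((1ℚ - t) * H - F) + t * (G - H))
      eq = solve-∀ ℚ-ring
    0≤b : 0ℚ ≤ 1ℚ - (t + t)
    0≤b = ℚ.<⇒≤ (0<-cancelˡ (pos _ (⊆-trans ∖-⊆ ∖-⊆)) (ℚ.<-≤-trans (pos S ⊆-refl) f≤H))

  f-edgeless : ∀ k {S} → card S ≡ k → (∀ {u v} → u ∈ S → v ∈ S → E u v ≡ false) → f S ≡ a ^ k
  f-edgeless zero    {S} c none = f-none (card≡0 S c)
  f-edgeless (suc k) {S} c none with some? S
  ... | inj₂ empty = ⊥-elim (ℕ.0≢1+n (trans (sym (card-none empty)) c))
  ... | inj₁ (x , x∈S) = trans (f-remove x∈S)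
    (trans (cong (λ G → f (S ∖ ⁅ x ⁆) - t * G)
      (f-cong (⊆-antisym ∖-⊆ λ p → ∈-∖ p (out! (none x∈S (∖-⊆ p))))))
    (trans (cong (λ F → F - t * F) (f-edgeless k (ℕ.suc-injective (trans (sym (card-remove S x x∈S)) c))
             λ u∈ v∈ → none (∖-⊆ u∈) (∖-⊆ v∈))) (eq t (a ^ k))))
    where
    eq : ∀ t X → X - t * X ≡ (1ℚ - t) * X
    eq = solve-∀ ℚ-ring

  -- The extremal values for induced subgraphs of each size: the empty set, a vertex, an edge, and
  -- from three vertices on a triangle with leaves at one vertex.
  least : ℕ → ℚ
  least 0                   = 1ℚ
  least 1                   = a
  least 2                   = 1ℚ - (t + t)
  least (suc (suc (suc k))) = U-poly t k

  U-pos : ∀ k → 0ℚ < U-poly t k → 0ℚ ≤ 1ℚ - (t + t)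
  U-pos k 0<U = ℚ.<⇒≤ (0<-cancelˡ (0<^ k t<1) (subst (0ℚ <_) (eq (a ^ k * (1ℚ - (t + t))) t) (0<+ 0<U 0≤t)))
    where
    eq : ∀ x t → (x - t) + t ≡ x
    eq = solve-∀ ℚ-ring

  least-suc : ∀ j → 0ℚ < least (suc j) → least (suc j) ≤ least j
  least-suc 0 _ = a≤1
  least-suc 1 _ = ≤-via t 0≤t (eq t)
    where
    eq : ∀ t → 1ℚ - t ≡ (1ℚ - (t + t)) + t
    eq = solve-∀ ℚ-ring
  least-suc 2 _ = ≤-via t 0≤t (eq t)
    where
    eq : ∀ t → 1ℚ - (t + t) ≡ (1ℚ * (1ℚ - (t + t)) - t) + t
    eq = solve-∀ ℚ-ring
  least-suc (suc (suc (suc k))) 0<U = ≤-via (t * (a ^ k * (1ℚ - (t + t))))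
    (0≤* 0≤t (0≤* (0≤a^ k) (U-pos (suc k) 0<U))) (eq t (a ^ k))
    where
    eq : ∀ t X → X * (1ℚ - (t + t)) - t ≡ (((1ℚ - t) * X) * (1ℚ - (t + t)) - t) + t * (X * (1ℚ - (t + t)))
    eq = solve-∀ ℚ-ring

  least-≤ : ∀ i j → 0ℚ < least (i ℕ.+ j) → 0ℚ < least j
  least-≤ zero    j 0<l = 0<l
  least-≤ (suc i) j 0<l = least-≤ i j (ℚ.<-≤-trans 0<l (least-suc (i ℕ.+ j) 0<l))

  least-isolated : ∀ j → 0ℚ < least (suc j) → least (suc j) ≤ a * least j
  least-isolated 0 _ = ℚ.≤-reflexive (sym (ℚ.*-identityʳ a))
  least-isolated 1 _ = ≤-via (t * t) (0≤* 0≤t 0≤t) (eq t)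
    where
    eq : ∀ t → (1ℚ - t) * (1ℚ - t) ≡ (1ℚ - (t + t)) + t * t
    eq = solve-∀ ℚ-ring
  least-isolated 2 _ = ≤-via (t * t + t * t) (0≤+ (0≤* 0≤t 0≤t) (0≤* 0≤t 0≤t)) (eq t)
    where
    eq : ∀ t → (1ℚ - t) * (1ℚ - (t + t)) ≡ (1ℚ * (1ℚ - (t + t)) - t) + (t * t + t * t)
    eq = solve-∀ ℚ-ring
  least-isolated (suc (suc (suc k))) _ = ≤-via (t * t) (0≤* 0≤t 0≤t) (eq t (a ^ k))
    where
    eq : ∀ t X → (1ℚ - t) * (X * (1ℚ - (t + t)) - t) ≡ (((1ℚ - t) * X) * (1ℚ - (t + t)) - t) + t * t
    eq = solve-∀ ℚ-ring

  unicyclic-bound : ∀ {D c} → Pseudoforest D c → Forest (D ∖ ⁅ c ⁆) → ∀ m j → j ℕ.≤ m → 0ℚ < least j →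
    ∀ {S} → S ⊆ D → card S ≡ j → least j ≤ f S
  unicyclic-bound _ _ _ zero _ 0<l {S} S⊆D c = ℚ.≤-reflexive (sym (f-none (card≡0 S c)))
  unicyclic-bound {D} {c} pseudo forest (suc m) (suc j) (ℕ.s≤s j≤m) 0<l {S} S⊆D cS with some? S
  ... | inj₂ none = ⊥-elim (ℕ.0≢1+n (trans (sym (card-none none)) cS))
  ... | inj₁ (v , v∈S) with pseudo S⊆D v∈S
  -- No vertex of small degree is offered, and `c` has exactly the neighbours `y` and `z` in `S`.
  -- Without `c` there remains a forest, to which the star bound applies; without `y` and `z` too,
  -- `k` vertices remain, of value at most `a ^ k`. With `X` for `a ^ k` this gives
  -- `((1 - t) * X - t) - t * X`, which is `U-poly t k`.
  ... | inj₂ (c∈S , y , z , y∈S , z∈S , y≢z , y≢c , z≢c , ey , ez , two) = closing j 0<l c′ c″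
    where
    S′ = S ∖ ⁅ c ⁆
    c′ : card S′ ≡ j
    c′ = ℕ.suc-injective (trans (sym (card-remove S c c∈S)) cS)
    y∈S′ : y ∈ S′
    y∈S′ = ∈-∖x y∈S y≢c
    z∈S″ : z ∈ S′ ∖ ⁅ y ⁆
    z∈S″ = ∈-∖x (∈-∖x z∈S z≢c) (y≢z ∘ sym)
    rest : S′ ∖ E c ≗ S′ ∖ ⁅ y ⁆ ∖ ⁅ z ⁆
    rest = ⊆-antisym
      (λ p → let q , r = ∖-∈ p in ∈-∖x (∈-∖x q (∈-∉-≢ (in! ey) r ∘ sym)) (∈-∉-≢ (in! ez) r ∘ sym))
      (λ p → let q , w≢z = ∖x-∈ p ; r , w≢y = ∖x-∈ q in
        ∈-∖ r (¬∈⇒∉ λ e → Sum.[ w≢y , w≢z ]′ (two (∖-⊆ r) (holds e))))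
    c″ : j ≡ 2 ℕ.+ card (S′ ∖ E c)
    c″ = trans (sym c′) (trans (card-remove S′ y y∈S′)
      (cong suc (trans (card-remove (S′ ∖ ⁅ y ⁆) z z∈S″) (cong suc (card-cong (sym ∘ rest))))))
    closing : ∀ j → 0ℚ < least (suc j) → card S′ ≡ j → j ≡ 2 ℕ.+ card (S′ ∖ E c) → least (suc j) ≤ f S
    closing (suc (suc k)) 0<U c′ c″ =
      subst (U-poly t k ≤_) (sym (f-remove c∈S)) (≤-via ((f S′ - (a ^ suc k - t)) + t * (a ^ k - f (S′ ∖ E c)))
        (0≤+ (≤⇒0≤ (forest-bound forest (suc k) t<a^ S′⊆ c′)) (0≤* 0≤t (≤⇒0≤ upper)))
        (eq t (a ^ k) (f S′) (f (S′ ∖ E c))))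
      where
      eq : ∀ t X F G → F - t * G ≡ (X * (1ℚ - (t + t)) - t) + ((F - ((1ℚ - t) * X - t)) + t * (X - G))
      eq = solve-∀ ℚ-ring
      S′⊆ : S′ ⊆ D ∖ ⁅ c ⁆
      S′⊆ = ∖-mono S⊆D ⊆-refl
      t<a^ : t < a ^ suc k
      t<a^ = <-via (U-poly t k + t * a ^ k) (0<+ 0<U (0≤* 0≤t (0≤a^ k))) (eq′ t (a ^ k))
        where
        eq′ : ∀ t X → (1ℚ - t) * X ≡ t + ((X * (1ℚ - (t + t)) - t) + t * X)
        eq′ = solve-∀ ℚ-ring
      pos′ : Pos S′
      pos′ T T⊆ = forest-pos forest (suc k) t<a^ (⊆-trans T⊆ S′⊆) (subst (card T ℕ.≤_) c′ (card-mono T S′ T⊆))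
      upper : f (S′ ∖ E c) ≤ a ^ k
      upper = f-power-bound k (Pos-⊆ ∖-⊆ pos′) (sym (ℕ.suc-injective (ℕ.suc-injective c″)))
  ... | inj₁ (x , x∈S , one) = subst (least (suc j) ≤_) (sym (f-remove x∈S)) bound
    where
    S′ = S ∖ ⁅ x ⁆
    S′⊆D : S′ ⊆ D
    S′⊆D = ⊆-trans ∖-⊆ S⊆D
    c′ : card S′ ≡ j
    c′ = ℕ.suc-injective (trans (sym (card-remove S x x∈S)) cS)
    0<lj : 0ℚ < least j
    0<lj = least-≤ 1 j 0<l
    lower : least j ≤ f S′
    lower = unicyclic-bound pseudo forest m j j≤m 0<lj S′⊆D c′
    pos′ : Pos S′
    -- Positivity of `least` descends to smaller sizes, so the induction hypothesis makes `f`
    -- positive on every subset of S′.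
    pos′ T T⊆S′ = ℚ.<-≤-trans 0<l′ (unicyclic-bound pseudo forest m (card T) (ℕ.≤-trans T≤j j≤m) 0<l′ (⊆-trans T⊆S′ S′⊆D) refl)
      where
      T≤j : card T ℕ.≤ j
      T≤j = subst (card T ℕ.≤_) c′ (card-mono T S′ T⊆S′)
      0<l′ : 0ℚ < least (card T)
      0<l′ = least-≤ (j ℕ.∸ card T) (card T) (subst (λ i → 0ℚ < least i) (sym (ℕ.m∸n+n≡m T≤j)) 0<lj)
    bound : least (suc j) ≤ f S′ - t * f (S′ ∖ E x)
    bound with some? (S′ ∩ E x)
    ... | inj₂ none = subst (λ G → least (suc j) ≤ f S′ - t * G)
      (f-cong (⊆-antisym (λ {v} p → ∈-∖ p (¬∈⇒∉ λ q → ∈-∉ (∈-∩ p q) (none v))) ∖-⊆))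
      (ℚ.≤-trans (least-isolated j 0<l) (subst (a * least j ≤_) (eq₁ t (f S′)) (*-monoˡ (ℚ.<⇒≤ t<1) lower)))
      where
      eq₁ : ∀ t X → (1ℚ - t) * X ≡ X - t * X
      eq₁ = solve-∀ ℚ-ring
    ... | inj₁ (u , u∈) = subst (λ G → least (suc j) ≤ f S′ - t * G) (f-cong (sym ∘ W≗)) (leaf j 0<l c′ lower)
      where
      u∈S′ : u ∈ S′
      u∈S′ = proj₁ (∩-∈ u∈)
      eu : E x u ≡ true
      eu = holds (proj₂ (∩-∈ u∈))
      W = S′ ∖ ⁅ u ⁆
      W≗ : S′ ∖ E x ≗ W
      W≗ = ⊆-antisym
        (λ p → let q , r = ∖-∈ p in ∈-∖x q (∈-∉-≢ (in! eu) r ∘ sym))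
        (λ p → let q , r = ∖x-∈ p in ∈-∖ q (¬∈⇒∉ λ e → r (one (∖-⊆ q) (∖-⊆ u∈S′) (holds e) eu)))
      posW : Pos W
      posW = Pos-⊆ ∖-⊆ pos′
      sub-mono : ∀ L {F G} B → L ≤ F → G ≤ B → L - t * B ≤ F - t * G
      sub-mono L {F} {G} B L≤F G≤B = ≤-via ((F - L) + t * (B - G)) (0≤+ (≤⇒0≤ L≤F) (0≤* 0≤t (≤⇒0≤ G≤B))) (eq t L F G B)
        where
        eq : ∀ t L F G B → F - t * G ≡ (L - t * B) + ((F - L) + t * (B - G))
        eq = solve-∀ ℚ-ring
      leaf : ∀ j → 0ℚ < least (suc j) → card S′ ≡ j → least j ≤ f S′ → least (suc j) ≤ f S′ - t * f W
      leaf zero 0<l c′ lower = ∈-∉ u∈S′ (card≡0 S′ c′ u)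
      leaf (suc j) 0<l c′ lower = deep j 0<l lower (ℕ.suc-injective (trans (sym (card-remove S′ u u∈S′)) c′))
        where
        deep : ∀ j → 0ℚ < least (2 ℕ.+ j) → least (suc j) ≤ f S′ → card W ≡ j → least (2 ℕ.+ j) ≤ f S′ - t * f W
        deep 0 _ lower c″ = subst (_≤ f S′ - t * f W) (eq t) (sub-mono a 1ℚ lower (f-power-bound 0 posW c″))
          where
          eq : ∀ t → (1ℚ - t) - t * 1ℚ ≡ 1ℚ - (t + t)
          eq = solve-∀ ℚ-ring
        deep 1 _ lower c″ = subst (_≤ f S′ - t * f W) (eq t)
          (sub-mono (1ℚ - (t + t)) 1ℚ lower (ℚ.≤-trans (f-power-bound 1 posW c″) (subst (_≤ 1ℚ) (sym (ℚ.*-identityʳ a)) a≤1)))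
          where
          eq : ∀ t → (1ℚ - (t + t)) - t * 1ℚ ≡ 1ℚ * (1ℚ - (t + t)) - t
          eq = solve-∀ ℚ-ring
        deep (suc (suc k)) 0<U lower c″ with edge? W W
        -- The crude bound by a power of `a` would be too weak for the subtracted term. An edge in
        -- `W` improves it to `a ^ k * (1 - 2t)`, and `U-poly t k` minus `t` times this is exactly
        -- `U-poly t (suc k)`.
        ... | inj₁ (p , q , p∈W , q∈W , e) = subst (_≤ f S′ - t * f W) (eq t (a ^ k))
          (sub-mono (U-poly t k) _ lower (f-edge-bound k posW c″ p∈W q∈W p≢q e))
          where
          p≢q : p ≢ q
          p≢q refl with trans (sym e) (E-irr p)
          ... | ()
          eq : ∀ t X → (X * (1ℚ - (t + t)) - t) - t * (X * (1ℚ - (t + t))) ≡ ((1ℚ - t) * X) * (1ℚ - (t + t)) - t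
          eq = solve-∀ ℚ-ring
        -- If `W` has no edge, all edges of `S` meet `u`, and the expansion is made at `u` instead
        -- of `x`. The other `3 + k` vertices are independent, so the value is at least
        -- `a ^ (3 + k) - t`, which exceeds the required bound by `t * t * a ^ (1 + k)`.
        ... | inj₂ none = subst (least (4 ℕ.+ k) ≤_) (trans (sym (f-remove u∈S)) whole) (ℚ.≤-trans
            (≤-via (t * t * a ^ suc k) (0≤* (0≤* 0≤t 0≤t) (0≤a^ (suc k))) (eq t (a ^ k)))
            (sub-mono _ 1ℚ (ℚ.≤-reflexive (sym (f-edgeless (3 ℕ.+ k) cV edgeless)))
              (ℚ.≤-trans (f-power-bound _ (Pos-⊆ V∖⊆ pos′) refl) (a^-≤ {0} {card ((S ∖ ⁅ u ⁆) ∖ E u)} ℕ.z≤n))))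
          where
          V = S ∖ ⁅ u ⁆
          u∈S : u ∈ S
          u∈S = ∖-⊆ u∈S′
          x∈V : x ∈ V
          x∈V = ∈-∖x x∈S (proj₂ (∖x-∈ u∈S′) ∘ sym)
          whole : f S ≡ f S′ - t * f W
          whole = trans (f-remove x∈S) (cong (λ G → f S′ - t * G) (f-cong W≗))
          cV : card V ≡ 3 ℕ.+ k
          cV = trans (card-remove V x x∈V) (cong suc (trans (card-cong (⊆-antisym
            (λ p → let q , r = ∖x-∈ p ; q₁ , q₂ = ∖x-∈ q in ∈-∖x (∈-∖x q₁ r) q₂)
            (λ p → let q , r = ∖x-∈ p ; q₁ , q₂ = ∖x-∈ q in ∈-∖x (∈-∖x q₁ r) q₂))) c″))
          only-u : ∀ {v} → v ∈ V → E x v ≡ false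
          only-u v∈V = Bool.¬-not λ e → proj₂ (∖x-∈ v∈V) (one (∖-⊆ v∈V) u∈S e eu)
          inW : ∀ {v} → v ∈ V → v ≢ x → v ∈ W
          inW v∈V v≢x = let v∈S , v≢u = ∖x-∈ v∈V in ∈-∖x (∈-∖x v∈S v≢x) v≢u
          edgeless : ∀ {v w} → v ∈ V → w ∈ V → E v w ≡ false
          edgeless {v} {w} v∈V w∈V with v Fin.≟ x | w Fin.≟ x
          ... | yes refl | _        = only-u w∈V
          ... | no _     | yes refl = trans (E-sym v w) (only-u v∈V)
          ... | no v≢x   | no w≢x   = none (inW v∈V v≢x) (inW w∈V w≢x)
          V∖⊆ : V ∖ E u ⊆ S′
          V∖⊆ p = let q , r = ∖-∈ p in ∈-∖x (∖-⊆ q) (∈-∉-≢ (in! (trans (E-sym u x) eu)) r ∘ sym)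
          eq : ∀ t X → (1ℚ - t) * ((1ℚ - t) * ((1ℚ - t) * X)) - t * 1ℚ ≡
            (((1ℚ - t) * X) * (1ℚ - (t + t)) - t) + t * t * ((1ℚ - t) * X)
          eq = solve-∀ ℚ-ring

-- Graph stars

-- A leaf l at u with activity w(l) can be deleted if the activity of u is divided by 1 + w(l).
Z-leaf : ∀ {n} (E : Adj n) → Sym E → ∀ {l u} w w′ → l ≢ u → E u l ≡ true → (∀ v → E l v ≡ true → v ≡ u) →
  w′ l ≡ 0ℚ → (1ℚ + w l) * w′ u ≡ w u → (∀ v → v ≢ l → v ≢ u → w′ v ≡ w v) →
  Z E w ≡ (1ℚ + w l) * Z E w′
Z-leaf E E-sym {l} {u} w w′ l≢u eul only w′l w′u w′≡w = begin
  Z E w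
    ≡⟨ Z-expand E E-sym w u ⟩
  Z E (cut ⁅ u ⁆ w) + w u * Z E (cut (E u) (cut ⁅ u ⁆ w))
    ≡⟨ cong (_+ w u * Z E (cut (E u) (cut ⁅ u ⁆ w))) (Z-expand E E-sym (cut ⁅ u ⁆ w) l) ⟩
  (Z E base + cut ⁅ u ⁆ w l * Z E (cut (E l) base)) + w u * Z E (cut (E u) (cut ⁅ u ⁆ w))
    ≡⟨ cong₂ (λ b c → b + c * Z E (cut (E u) (cut ⁅ u ⁆ w)))
         (cong₂ (λ b c → Z E base + b * c) (cut-∉ {X = ⁅ u ⁆} {w} (∉-⁅⁆ l≢u)) (Z-cong E isolated)) (sym w′u) ⟩
  (Z E base + w l * Z E base) + (1ℚ + w l) * w′ u * Z E (cut (E u) (cut ⁅ u ⁆ w))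
    ≡⟨ eq (Z E base) (w l) (w′ u) _ ⟩
  (1ℚ + w l) * (Z E base + w′ u * Z E (cut (E u) (cut ⁅ u ⁆ w)))
    ≡⟨ cong₂ (λ b c → (1ℚ + w l) * (b + w′ u * c)) (Z-cong E (sym ∘ same)) (Z-cong E (sym ∘ same′)) ⟩
  (1ℚ + w l) * (Z E (cut ⁅ u ⁆ w′) + w′ u * Z E (cut (E u) (cut ⁅ u ⁆ w′)))
    ≡⟨ cong ((1ℚ + w l) *_) (Z-expand E E-sym w′ u) ⟨
  (1ℚ + w l) * Z E w′ ∎
  where
  open ≡-Reasoning
  base = cut ⁅ l ⁆ (cut ⁅ u ⁆ w)
  eq : ∀ b l y x → (b + l * b) + (1ℚ + l) * y * x ≡ (1ℚ + l) * (b + y * x)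
  eq = solve-∀ ℚ-ring
  isolated : cut (E l) base ≗ base
  isolated v with ∈? (E l) v
  ... | inj₂ v∉ = cut-∉ {X = E l} {base} v∉
  ... | inj₁ v∈ with only v (holds v∈)
  ... | refl = trans (cut-∈ {X = E l} {base} v∈) (sym (cut-zero ⁅ l ⁆ (cut ⁅ u ⁆ w) u (cut-∈ {X = ⁅ u ⁆} {w} (∈-⁅⁆ u))))
  same : cut ⁅ u ⁆ w′ ≗ base
  same v with v Fin.≟ u | v Fin.≟ l
  ... | yes _  | yes _    = refl
  ... | yes _  | no _     = refl
  ... | no _   | yes refl = w′l
  ... | no v≢u | no v≢l   = w′≡w v v≢l v≢u
  same′ : cut (E u) (cut ⁅ u ⁆ w′) ≗ cut (E u) (cut ⁅ u ⁆ w)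
  same′ v = go (∈? (E u) v) (v Fin.≟ u)
    where
    go : v ∈ E u ⊎ v ∉ E u → Dec (v ≡ u) → cut (E u) (cut ⁅ u ⁆ w′) v ≡ cut (E u) (cut ⁅ u ⁆ w) v
    go (inj₁ v∈) _          = trans (cut-∈ {X = E u} {cut ⁅ u ⁆ w′} v∈) (sym (cut-∈ {X = E u} {cut ⁅ u ⁆ w} v∈))
    go (inj₂ v∉) (yes refl) = trans (cut-zero (E u) (cut ⁅ u ⁆ w′) u (cut-∈ {X = ⁅ u ⁆} {w′} (∈-⁅⁆ u)))
                                  (sym (cut-zero (E u) (cut ⁅ u ⁆ w) u (cut-∈ {X = ⁅ u ⁆} {w} (∈-⁅⁆ u))))
    go (inj₂ v∉) (no v≢u)   = cong (λ x → if E u v then 0ℚ else x)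
      (trans (cut-∉ {X = ⁅ u ⁆} {w′} (∉-⁅⁆ v≢u))
        (trans (w′≡w v (λ { refl → ∈-∉ (in! eul) v∉ }) v≢u) (sym (cut-∉ {X = ⁅ u ⁆} {w} (∉-⁅⁆ v≢u)))))

-- The graph star of the graph induced on ∁ L: the vertices of L are the attached leaves,
-- and mate exchanges v and v*.
record Starred {n} (E : Adj n) : Set where
  field
    E-sym     : Sym E
    E-irr     : ∀ v → E v v ≡ false
    L         : Sub n
    mate      : Fin n → Fin n
    mate-L    : ∀ v → L (mate v) ≡ not (L v)
    mate-mate : ∀ v → mate (mate v) ≡ v
    mate-edge : ∀ v → E v (mate v) ≡ true
    mate-only : ∀ {v u} → v ∈ L → E v u ≡ true → u ≡ mate v

  mate-∈ : ∀ {v} → v ∈ L → mate v ∈ ∁ L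
  mate-∈ {v} v∈L = ∈-∁ (out! (trans (mate-L v) (cong not (holds v∈L))))

  mate-∉ : ∀ {v} → v ∈ ∁ L → mate v ∈ L
  mate-∉ {v} v∈ = in! (trans (mate-L v) (cong not (fails (∁-∈ v∈))))

  mate-injective : ∀ {u v} → mate u ≡ mate v → u ≡ v
  mate-injective {u} {v} e = trans (sym (mate-mate u)) (trans (cong mate e) (mate-mate v))

  card-∁L : card (∁ L) ≡ card L
  card-∁L = ℕ.≤-antisym (card-injection mate mate-∉ (λ _ _ → mate-injective))
                        (card-injection mate mate-∈ (λ _ _ → mate-injective))

  card-halves : n ≡ card L ℕ.+ card (∁ L)
  card-halves = trans (sym card-full) (trans (card-split full L) (cong₂ ℕ._+_
    (card-cong (⊆-antisym (λ p → proj₂ (∩-∈ p)) (λ p → ∈-∩ ∈-full p)))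
    (card-cong (⊆-antisym (λ p → ∈-∁ (proj₂ (∖-∈ p))) (λ p → ∈-∖ ∈-full (∁-∈ p))))))

  card-half : ∀ {k} → n ≡ k ℕ.+ k → card L ≡ k × card (∁ L) ≡ k
  card-half {k} n≡k+k = half , trans card-∁L half
    where
    half : card L ≡ k
    half = ℕ.*-cancelˡ-≡ (card L) k 2 (trans (double (card L)) (trans (cong (card L ℕ.+_) (sym card-∁L))
      (trans (sym card-halves) (trans n≡k+k (sym (double k))))))
      where
      double : ∀ j → 2 ℕ.* j ≡ j ℕ.+ j
      double j = cong (j ℕ.+_) (ℕ.+-identityʳ j)

  -- The substitution formula for graph stars, with `y` for q / (1 + q), in a version for induced
  -- subgraphs that keep all of `L`. A leaf contributes the factor `1 + q` whether or not its
  -- neighbour is in `S`.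
  star-polynomial : ∀ q y → (1ℚ + q) * y ≡ q → ∀ {S} → S ⊆ ∁ L →
    Z E (ind q (S ∪ L)) ≡ (1ℚ + q) ^ card L * Z E (ind y S)
  star-polynomial q y qy {S} S⊆D = trans (Z-cong E start)
    (trans (go (card L) (λ _ → false) (λ { (in! ()) }) (card-cong (⊆-antisym ∖-⊆ λ p → ∈-∖ p (out! refl))))
           (cong ((1ℚ + q) ^ card L *_) (Z-cong E end)))
    where
    -- The activities when the leaves in `P` have been deleted: the neighbour of a deleted leaf has
    -- `y`, the other vertices of `S` still have `q`.
    W : Sub n → Fin n → ℚ
    W P v = if L v then (if P v then 0ℚ else q) else (if S v then (if P (mate v) then y else q) else 0ℚ)
    start : ind q (S ∪ L) ≗ W (λ _ → false)
    start v with ∈? L v | ∈? S v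
    ... | inj₁ v∈L | _ rewrite holds v∈L = ind-∈ {S = S ∪ L} (∈-∪ʳ v∈L)
    ... | inj₂ v∉L | inj₁ v∈S rewrite fails v∉L | holds v∈S = ind-∈ {S = S ∪ L} (∈-∪ˡ v∈S)
    ... | inj₂ v∉L | inj₂ v∉S rewrite fails v∉L | fails v∉S =
      ind-∉ {S = S ∪ L} (¬∈⇒∉ λ p → Sum.[ (λ v∈S → ∈-∉ v∈S v∉S) , (λ v∈L → ∈-∉ v∈L v∉L) ]′ (∪-∈ p))
    end : W L ≗ ind y S
    end v with ∈? L v | ∈? S v
    ... | inj₁ v∈L | inj₁ v∈S = ∈-∉ v∈L (∁-∈ (S⊆D v∈S))
    ... | inj₁ v∈L | inj₂ v∉S rewrite holds v∈L | fails v∉S = refl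
    ... | inj₂ v∉L | inj₁ v∈S rewrite fails v∉L | holds v∈S | holds (mate-∉ (∈-∁ v∉L)) = refl
    ... | inj₂ v∉L | inj₂ v∉S rewrite fails v∉L | fails v∉S = refl
    step : ∀ P l → l ∈ L → l ∉ P → Z E (W P) ≡ (1ℚ + q) * Z E (W (P ∪ ⁅ l ⁆))
    step P l l∈L l∉P = trans
      (Z-leaf E E-sym {l} {mate l} (W P) (W (P ∪ ⁅ l ⁆)) l≢m (trans (E-sym _ _) (mate-edge l)) (λ v → mate-only l∈L) at-l at-u other)
      (cong (λ x → (1ℚ + x) * Z E (W (P ∪ ⁅ l ⁆))) W-l)
      where
      l≢m : l ≢ mate l
      l≢m = ∈-∉-≢ l∈L (∁-∈ (mate-∈ l∈L))
      W-l : W P l ≡ q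
      W-l rewrite holds l∈L | fails l∉P = refl
      at-l : W (P ∪ ⁅ l ⁆) l ≡ 0ℚ
      at-l rewrite holds l∈L | holds (∈-∪ʳ {T = ⁅ l ⁆} {S = P} (∈-⁅⁆ l)) = refl
      at-u : (1ℚ + W P l) * W (P ∪ ⁅ l ⁆) (mate l) ≡ W P (mate l)
      at-u rewrite W-l | fails (∁-∈ (mate-∈ l∈L)) | mate-mate l | fails l∉P | holds (∈-∪ʳ {T = ⁅ l ⁆} {S = P} (∈-⁅⁆ l))
        with S (mate l)
      ... | true  = qy
      ... | false = ℚ.*-zeroʳ (1ℚ + q)
      other : ∀ v → v ≢ l → v ≢ mate l → W (P ∪ ⁅ l ⁆) v ≡ W P v
      other v v≢l v≢m = cong₂ (λ a b → if L v then (if a then 0ℚ else q) else (if S v then (if b then y else q) else 0ℚ))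
        (∪-skip v≢l) (∪-skip λ e → v≢m (trans (sym (mate-mate v)) (cong mate e)))
    go : ∀ k P → P ⊆ L → card (L ∖ P) ≡ k → Z E (W P) ≡ (1ℚ + q) ^ k * Z E (W L)
    go k P P⊆L c with some? (L ∖ P)
    ... | inj₂ none = trans (Z-cong E λ v → cong₂ (λ a b → if L v then (if a then 0ℚ else q) else (if S v then (if b then y else q) else 0ℚ))
            (P≗L v) (P≗L (mate v)))
          (trans (sym (ℚ.*-identityˡ (Z E (W L)))) (cong (λ k → (1ℚ + q) ^ k * Z E (W L)) (trans (sym (card-none none)) c)))
      where
      P≗L : P ≗ L
      P≗L = ⊆-antisym P⊆L λ {v} v∈L → Sum.[ id , (λ v∉P → ∈-∉ (∈-∖ v∈L v∉P) (none v)) ]′ (∈? P v)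
    ... | inj₁ (l , l∈) with k
    ... | zero  = ∈-∉ l∈ (card≡0 _ c l)
    ... | suc k = trans (step P l (∖-⊆ l∈) (proj₂ (∖-∈ l∈))) (trans
      (cong ((1ℚ + q) *_) (go k (P ∪ ⁅ l ⁆) (λ p → Sum.[ P⊆L , (λ v∈l → subst (_∈ L) (sym (⁅⁆-∈ v∈l)) (∖-⊆ l∈)) ]′ (∪-∈ p))
        (ℕ.suc-injective (trans (trans (cong suc (card-cong (⊆-antisym
           (λ p → let q , r = ∖-∈ p in ∈-∖x (∈-∖ q (¬∈⇒∉ λ s → ∈-∉ (∈-∪ˡ s) r)) (∈-∉-≢ (∈-∪ʳ (∈-⁅⁆ l)) r ∘ sym))
           (λ p → let q , r = ∖x-∈ p ; q₁ , q₂ = ∖-∈ q in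
             ∈-∖ q₁ (¬∈⇒∉ λ s → Sum.[ (λ z → ∈-∉ z q₂) , (λ z → r (⁅⁆-∈ z)) ]′ (∪-∈ s))))))
           (sym (card-remove (L ∖ P) l l∈))) c))))
      (sym (ℚ.*-assoc (1ℚ + q) ((1ℚ + q) ^ k) (Z E (W L)))))

-- The independence polynomial of a graph at rational points

adj : ∀ {n} → Graph n → Adj n
adj G u v = does (Graph._~?_ G u v)

adj-true : ∀ {n} (G : Graph n) {u v} → Graph._~_ G u v → adj G u v ≡ true
adj-true G {u} {v} = dec-true (Graph._~?_ G u v)

true-adj : ∀ {n} (G : Graph n) {u v} → adj G u v ≡ true → Graph._~_ G u v
true-adj G {u} {v} e with Graph._~?_ G u v
... | yes u~v = u~v

adj-sym : ∀ {n} (G : Graph n) → Sym (adj G)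
adj-sym G u v with Graph._~?_ G u v
... | yes u~v = sym (adj-true G (Graph.~-sym G u~v))
... | no u≁v  = sym (dec-false (Graph._~?_ G v u) (u≁v ∘ Graph.~-sym G))

adj-irr : ∀ {n} (G : Graph n) v → adj G v v ≡ false
adj-irr G v = dec-false (Graph._~?_ G v v) (Graph.~-irrefl G)

opaque
  ℕ→ℚ : ℕ → ℚ
  ℕ→ℚ k = ℤ.+ k ℚ./ 1

  ℕ→ℚ-≡ : ∀ k → ℤ.+ k ℚ./ 1 ≡ ℕ→ℚ k
  ℕ→ℚ-≡ k = refl

  ℕ→ℚ-zero : ℕ→ℚ 0 ≡ 0ℚ
  ℕ→ℚ-zero = refl

  ℕ→ℚ-suc : ∀ k → ℕ→ℚ (suc k) ≡ 1ℚ + ℕ→ℚ k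
  ℕ→ℚ-suc k = ℚ.toℚᵘ-injective (ℚᵘ.≃-trans (ℚ.toℚᵘ-fromℚᵘ (ℚᵘ.mkℚᵘ (ℤ.+ suc k) 0))
    (ℚᵘ.≃-trans (ℚᵘ.*≡* (cong₂ (λ i j → (i ℤ.+ j) ℤ.* ℤ.+ 1) (sym (ℤ.*-identityʳ (ℤ.+ 1))) (sym (ℤ.*-identityʳ (ℤ.+ k)))))
      (ℚᵘ.≃-sym (ℚᵘ.≃-trans (ℚ.toℚᵘ-homo-+ 1ℚ ((ℤ.+ k) ℚ./ 1))
        (ℚᵘ.+-congʳ (ℚᵘ.mkℚᵘ (ℤ.+ 1) 0) (ℚ.toℚᵘ-fromℚᵘ (ℚᵘ.mkℚᵘ (ℤ.+ k) 0)))))))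

sumℚ : List ℚ → ℚ
sumℚ = List.foldr _+_ 0ℚ

poly : ∀ {n} → Graph n → ℚ → ℚ
poly {n} G q = sumℚ (List.map (λ k → ℕ→ℚ (#independent G k) * q ^ k) (List.upTo (suc n)))

seq-I : ∀ {n} (G : Graph n) x m → ℝ.seq (I G x) m ≡ poly G (ℝ.seq x m)
seq-I {n} G x m = go (List.upTo (suc n))
  where
  power : ∀ k → ℝ.seq (x D.^ k) m ≡ ℝ.seq x m ^ k
  power zero    = refl
  power (suc k) = cong (ℝ.seq x m *_) (power k)
  go : ∀ ks → ℝ.seq (List.foldr D._+_ 0ℝ (List.map (λ k → fromℕ (#independent G k) D.* x D.^ k) ks)) m ≡
              sumℚ (List.map (λ k → ℕ→ℚ (#independent G k) * ℝ.seq x m ^ k) ks)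
  go []       = refl
  go (k ∷ ks) = cong₂ _+_ (cong₂ _*_ (ℕ→ℚ-≡ (#independent G k)) (power k)) (go ks)

Σ< : ℕ → (ℕ → ℚ) → ℚ
Σ< zero    g = 0ℚ
Σ< (suc n) g = g 0 + Σ< n (g ∘ suc)

sumℚ-applyUpTo : ∀ (g : ℕ → ℚ) h n → sumℚ (List.map g (List.applyUpTo h n)) ≡ Σ< n (g ∘ h)
sumℚ-applyUpTo g h zero    = refl
sumℚ-applyUpTo g h (suc n) = cong (g (h 0) +_) (sumℚ-applyUpTo g (h ∘ suc) n)

Σ<-cong : ∀ n {g h} → g ≗ h → Σ< n g ≡ Σ< n h
Σ<-cong zero    e = refl
Σ<-cong (suc n) e = cong₂ _+_ (e 0) (Σ<-cong n (e ∘ suc))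

Σ<-+ : ∀ n g h → Σ< n (λ k → g k + h k) ≡ Σ< n g + Σ< n h
Σ<-+ zero    g h = refl
Σ<-+ (suc n) g h = trans (cong (g 0 + h 0 +_) (Σ<-+ n (g ∘ suc) (h ∘ suc))) (eq (g 0) (h 0) _ _)
  where
  eq : ∀ a b c d → a + b + (c + d) ≡ a + c + (b + d)
  eq = solve-∀ ℚ-ring

Σ<-zero : ∀ n {g} → (∀ k → g k ≡ 0ℚ) → Σ< n g ≡ 0ℚ
Σ<-zero zero    e = refl
Σ<-zero (suc n) e = cong₂ _+_ (e 0) (Σ<-zero n (e ∘ suc))

Σ<-pick : ∀ n k (g : ℕ → ℚ) → k ℕ.< n → Σ< n (λ j → if does (k ℕ.≟ j) then g j else 0ℚ) ≡ g k
Σ<-pick (suc n) zero    g _           = trans (cong (g 0 +_) (Σ<-zero n λ _ → refl)) (ℚ.+-identityʳ (g 0))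
Σ<-pick (suc n) (suc k) g (ℕ.s≤s k<n) = trans (cong (0ℚ +_) (Σ<-pick n k (g ∘ suc) k<n)) (ℚ.+-identityˡ (g (suc k)))

length-filter-∷ : ∀ {A : Set} {Q : A → Set} (Q? : ∀ x → Dec (Q x)) x xs →
  List.length (List.filter Q? (x ∷ xs)) ≡ bit (does (Q? x)) ℕ.+ List.length (List.filter Q? xs)
length-filter-∷ Q? x xs with does (Q? x)
... | true  = refl
... | false = refl

module _ {n} (G : Graph n) (q : ℚ) where

  term : Subset.Subset n → ℚ
  term S = if does (independent? G S) then q ^ Subset.∣ S ∣ else 0ℚ

  private
    counted : List (Subset.Subset n) → ℕ → ℕ
    counted xs k = List.length (List.filter (λ S → independent? G S ×-dec (Subset.∣ S ∣ ℕ.≟ k)) xs)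

    counted-∷ : ∀ S xs k → counted (S ∷ xs) k ≡
      bit (does (independent? G S) ∧ does (Subset.∣ S ∣ ℕ.≟ k)) ℕ.+ counted xs k
    counted-∷ S xs k = length-filter-∷ (λ S → independent? G S ×-dec (Subset.∣ S ∣ ℕ.≟ k)) S xs

    new : Subset.Subset n → ℕ → ℚ
    new S k = if does (independent? G S) then (if does (Subset.∣ S ∣ ℕ.≟ k) then q ^ k else 0ℚ) else 0ℚ

    new-pick : ∀ S → Σ< (suc n) (new S) ≡ term S
    new-pick S = go (does (independent? G S))
      where
      go : ∀ b → Σ< (suc n) (λ k → if b then (if does (Subset.∣ S ∣ ℕ.≟ k) then q ^ k else 0ℚ) else 0ℚ) ≡
                 (if b then q ^ Subset.∣ S ∣ else 0ℚ)
      go true  = Σ<-pick (suc n) Subset.∣ S ∣ (q ^_) (ℕ.s≤s (Subset.∣p∣≤n S))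
      go false = Σ<-zero (suc n) λ _ → refl

    new-bit : ∀ b c k x → ℕ→ℚ (bit (b ∧ c) ℕ.+ k) * x ≡ (if b then (if c then x else 0ℚ) else 0ℚ) + ℕ→ℚ k * x
    new-bit true  true  k x = trans (cong (_* x) (ℕ→ℚ-suc k)) (eq (ℕ→ℚ k) x)
      where
      eq : ∀ a b → (1ℚ + a) * b ≡ b + a * b
      eq = solve-∀ ℚ-ring
    new-bit true  false k x = sym (ℚ.+-identityˡ (ℕ→ℚ k * x))
    new-bit false c     k x = sym (ℚ.+-identityˡ (ℕ→ℚ k * x))

    by-size : ∀ xs → Σ< (suc n) (λ k → ℕ→ℚ (counted xs k) * q ^ k) ≡ sumℚ (List.map term xs)
    by-size []       = Σ<-zero (suc n) λ k → trans (cong (_* q ^ k) ℕ→ℚ-zero) (ℚ.*-zeroˡ (q ^ k))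
    by-size (S ∷ xs) = trans
      (Σ<-cong (suc n) λ k → trans (cong (λ c → ℕ→ℚ c * q ^ k) (counted-∷ S xs k))
        (new-bit (does (independent? G S)) (does (Subset.∣ S ∣ ℕ.≟ k)) (counted xs k) (q ^ k)))
      (trans (Σ<-+ (suc n) (new S) (λ k → ℕ→ℚ (counted xs k) * q ^ k)) (cong₂ _+_ (new-pick S) (by-size xs)))

  poly-terms : poly G q ≡ sumℚ (List.map term (subsets n))
  poly-terms = trans (sumℚ-applyUpTo (λ k → ℕ→ℚ (#independent G k) * q ^ k) id (suc n)) (by-size (subsets n))

Σ⊆ : ∀ n → (Vec Bool n → ℚ) → ℚ
Σ⊆ zero    h = h []
Σ⊆ (suc n) h = Σ⊆ n (h ∘ (false ∷_)) + Σ⊆ n (h ∘ (true ∷_))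

Σ⊆-cong : ∀ n {g h} → g ≗ h → Σ⊆ n g ≡ Σ⊆ n h
Σ⊆-cong zero    e = e []
Σ⊆-cong (suc n) e = cong₂ _+_ (Σ⊆-cong n (e ∘ (false ∷_))) (Σ⊆-cong n (e ∘ (true ∷_)))

Σ⊆-* : ∀ n c h → Σ⊆ n (λ S → c * h S) ≡ c * Σ⊆ n h
Σ⊆-* zero    c h = refl
Σ⊆-* (suc n) c h = trans (cong₂ _+_ (Σ⊆-* n c _) (Σ⊆-* n c _)) (sym (ℚ.*-distribˡ-+ c _ _))

sumℚ-subsets : ∀ n h → sumℚ (List.map h (subsets n)) ≡ Σ⊆ n h
sumℚ-subsets zero    h = ℚ.+-identityʳ (h [])
sumℚ-subsets (suc n) h = trans (append (List.map (false ∷_) (subsets n)) (List.map (true ∷_) (subsets n)))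
  (cong₂ _+_ (trans (cong sumℚ (sym (List.map-∘ (subsets n)))) (sumℚ-subsets n (h ∘ (false ∷_))))
             (trans (cong sumℚ (sym (List.map-∘ (subsets n)))) (sumℚ-subsets n (h ∘ (true ∷_)))))
  where
  append : ∀ xs ys → sumℚ (List.map h (xs List.++ ys)) ≡ sumℚ (List.map h xs) + sumℚ (List.map h ys)
  append []       ys = sym (ℚ.+-identityˡ _)
  append (x ∷ xs) ys = trans (cong (h x +_) (append xs ys)) (sym (ℚ.+-assoc (h x) _ _))

monomial : ∀ {n} → Adj n → (Fin n → ℚ) → Vec Bool n → ℚ
monomial E w []          = 1ℚ
monomial E w (false ∷ S) = monomial (shift E) (w ∘ suc) S
monomial E w (true ∷ S)  = w zero * monomial (shift E) (cut (E zero ∘ suc) (w ∘ suc)) S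

Z-monomials : ∀ {n} (E : Adj n) w → Z E w ≡ Σ⊆ n (monomial E w)
Z-monomials {zero}  E w = refl
Z-monomials {suc n} E w = cong₂ _+_ (Z-monomials (shift E) _)
  (trans (cong (w zero *_) (Z-monomials (shift E) _)) (sym (Σ⊆-* n (w zero) _)))

monomial-cong : ∀ {n} (E : Adj n) {w w′} → w ≗ w′ → monomial E w ≗ monomial E w′
monomial-cong E e []          = refl
monomial-cong E e (false ∷ S) = monomial-cong (shift E) (e ∘ suc) S
monomial-cong E e (true ∷ S)  = cong₂ _*_ (e zero)
  (monomial-cong (shift E) (cut-cong {X = E zero ∘ suc} (e ∘ suc)) S)

module _ (q : ℚ) where

  IndependentIn : ∀ {n} → Adj n → Sub n → Vec Bool n → Set
  IndependentIn E B S = (∀ {u v} → u Subset.∈ S → v Subset.∈ S → E u v ≡ false) × (∀ {v} → v Subset.∈ S → v ∈ B)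

  monomial-yes : ∀ {n} (E : Adj n) B S → IndependentIn E B S → monomial E (ind q B) S ≡ q ^ Subset.∣ S ∣
  monomial-yes E B []          _           = refl
  monomial-yes E B (false ∷ S) (indep , S⊆B) = monomial-yes (shift E) (B ∘ suc) S
    ((λ u∈ v∈ → indep (Vec.there u∈) (Vec.there v∈)) , λ v∈ → in! (holds (S⊆B (Vec.there v∈))))
  monomial-yes E B (true ∷ S)  (indep , S⊆B) = cong₂ _*_ (ind-∈ {S = B} (S⊆B Vec.here))
    (trans (monomial-cong (shift E) (cut-ind q (E zero ∘ suc) (B ∘ suc)) S)
      (monomial-yes (shift E) ((B ∘ suc) ∖ (E zero ∘ suc)) S
        ((λ u∈ v∈ → indep (Vec.there u∈) (Vec.there v∈)) ,
         λ v∈ → ∈-∖ (in! (holds (S⊆B (Vec.there v∈)))) (out! (indep Vec.here (Vec.there v∈))))))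

  monomial-no : ∀ {n} (E : Adj n) → Sym E → (∀ v → E v v ≡ false) → ∀ B S → ¬ IndependentIn E B S →
    monomial E (ind q B) S ≡ 0ℚ
  monomial-no E E-sym E-irr B []          dep = ⊥-elim (dep ((λ ()) , (λ ())))
  monomial-no E E-sym E-irr B (false ∷ S) dep = monomial-no (shift E) (λ u v → E-sym (suc u) (suc v)) (E-irr ∘ suc) (B ∘ suc) S
    λ { (indep , S⊆B) → dep ((λ { (Vec.there u∈) (Vec.there v∈) → indep u∈ v∈ }) , λ { (Vec.there v∈) → in! (holds (S⊆B v∈)) }) }
  monomial-no E E-sym E-irr B (true ∷ S)  dep with ∈? B zero
  ... | inj₂ 0∉B = trans (cong (_* monomial (shift E) (cut (E zero ∘ suc) (ind q B ∘ suc)) S) (ind-∉ {S = B} 0∉B))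
    (ℚ.*-zeroˡ (monomial (shift E) (cut (E zero ∘ suc) (ind q B ∘ suc)) S))
  ... | inj₁ 0∈B = trans (cong (ind q B zero *_) (trans
      (monomial-cong (shift E) (cut-ind q (E zero ∘ suc) (B ∘ suc)) S)
      (monomial-no (shift E) (λ u v → E-sym (suc u) (suc v)) (E-irr ∘ suc) ((B ∘ suc) ∖ (E zero ∘ suc)) S
        λ { (indep , S⊆) → dep (whole indep S⊆) })))
      (ℚ.*-zeroʳ (ind q B zero))
    where
    whole : (∀ {u v} → u Subset.∈ S → v Subset.∈ S → E (suc u) (suc v) ≡ false) →
      (∀ {v} → v Subset.∈ S → v ∈ (B ∘ suc) ∖ (E zero ∘ suc)) → IndependentIn E B (true ∷ S)
    whole indep S⊆ = all , λ { Vec.here → 0∈B ; (Vec.there v∈) → in! (holds (proj₁ (∖-∈ (S⊆ v∈)))) }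
      where
      all : ∀ {u v} → u Subset.∈ (true ∷ S) → v Subset.∈ (true ∷ S) → E u v ≡ false
      all Vec.here       Vec.here       = E-irr zero
      all Vec.here       (Vec.there v∈) = fails (proj₂ (∖-∈ (S⊆ v∈)))
      all (Vec.there u∈) Vec.here       = trans (E-sym _ zero) (fails (proj₂ (∖-∈ (S⊆ u∈))))
      all (Vec.there u∈) (Vec.there v∈) = indep u∈ v∈

-- Collecting the counts over all sizes gives a sum of powers of `q` over the independent sets.
-- Unfolding the recursion of `Z` gives a sum over all subsets with the same terms, the dependent
-- sets contributing 0.
poly-Z : ∀ {n} (G : Graph n) q → poly G q ≡ Z (adj G) (ind q full)
poly-Z {n} G q = trans (poly-terms G q) (trans (sumℚ-subsets n (term G q))
  (trans (Σ⊆-cong n same) (sym (Z-monomials (adj G) (ind q full)))))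
  where
  same : ∀ S → term G q S ≡ monomial (adj G) (ind q full) S
  same S = go (independent? G S)
    where
    contra : true ≡ false → ⊥
    contra ()
    go : (d : Dec (Independent G S)) → (if does d then q ^ Subset.∣ S ∣ else 0ℚ) ≡ monomial (adj G) (ind q full) S
    go (yes indep) = sym (monomial-yes q (adj G) full S
      ((λ u∈ v∈ → dec-false (Graph._~?_ G _ _) (indep _ _ u∈ v∈)) , λ _ → ∈-full))
    go (no ¬indep) = sym (monomial-no q (adj G) (adj-sym G) (adj-irr G) full S
      λ { (indep , _) → ¬indep λ u v u∈ v∈ u~v → contra (trans (sym (adj-true G u~v)) (indep u∈ v∈)) })

-- Continuity and the largest root

∣∣-≤ : ∀ {p e} → p ≤ e → - p ≤ e → ℚ.∣ p ∣ ≤ e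
∣∣-≤ {p} {e} p≤e -p≤e = Sum.[ (λ eq → subst (_≤ e) (sym eq) p≤e) , (λ eq → subst (_≤ e) (sym eq) -p≤e) ]′ (ℚ.∣p∣≡p∨∣p∣≡-p p)

p≤∣p∣ : ∀ p → p ≤ ℚ.∣ p ∣
p≤∣p∣ p = Sum.[ (λ e → ℚ.≤-reflexive (sym e)) , below ]′ (ℚ.∣p∣≡p∨∣p∣≡-p p)
  where
  below : ℚ.∣ p ∣ ≡ - p → p ≤ ℚ.∣ p ∣
  below e with ℚ.≤-total 0ℚ p
  ... | inj₁ 0≤p = ℚ.≤-reflexive (sym (ℚ.0≤p⇒∣p∣≡p 0≤p))
  ... | inj₂ p≤0 = ℚ.≤-trans p≤0 (ℚ.0≤∣p∣ p)

∣-∣-≤ : ∀ {p q e} → ℚ.∣ p - q ∣ ≤ e → p ≤ q + e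
∣-∣-≤ {p} {q} {e} h = 0≤⇒≤ (subst (0ℚ ≤_) (eq p q e) (≤⇒0≤ (ℚ.≤-trans (p≤∣p∣ (p - q)) h)))
  where
  eq : ∀ p q e → e - (p - q) ≡ (q + e) - p
  eq = solve-∀ ℚ-ring

two : ℚ
two = 1ℚ + 1ℚ

0≤2 : 0ℚ ≤ two
0≤2 = 0≤+ 0≤1 0≤1

-- In closed form 3^n and n 3^(n-1): the maximum and a Lipschitz constant of `Z` for activities of
-- modulus at most 2. The points that occur lie within distance 1 of the interval from -1 to 0.
bound lipschitz : ℕ → ℚ
bound zero    = 1ℚ
bound (suc n) = bound n + two * bound n
lipschitz zero    = 0ℚ
lipschitz (suc n) = lipschitz n + (two * lipschitz n + bound n)

0≤bound : ∀ n → 0ℚ ≤ bound n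
0≤bound zero    = 0≤1
0≤bound (suc n) = 0≤+ (0≤bound n) (0≤* 0≤2 (0≤bound n))

0≤lipschitz : ∀ n → 0ℚ ≤ lipschitz n
0≤lipschitz zero    = ℚ.≤-refl
0≤lipschitz (suc n) = 0≤+ (0≤lipschitz n) (0≤+ (0≤* 0≤2 (0≤lipschitz n)) (0≤bound n))

cut-small : ∀ {n} (X : Sub n) {w e} → 0ℚ ≤ e → (∀ v → ℚ.∣ w v ∣ ≤ e) → ∀ v → ℚ.∣ cut X w v ∣ ≤ e
cut-small X 0≤e h v with X v
... | true  = 0≤e
... | false = h v

cut-close : ∀ {n} (X : Sub n) {w w′ : Fin n → ℚ} {e} → 0ℚ ≤ e → (∀ v → ℚ.∣ w v - w′ v ∣ ≤ e) →
  ∀ v → ℚ.∣ cut X w v - cut X w′ v ∣ ≤ e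
cut-close X 0≤e h v with X v
... | true  = 0≤e
... | false = h v

Z-bound : ∀ {n} (E : Adj n) {w} → (∀ v → ℚ.∣ w v ∣ ≤ two) → ℚ.∣ Z E w ∣ ≤ bound n
Z-bound {zero}  E h = ℚ.≤-refl
Z-bound {suc n} E {w} h = ℚ.≤-trans (ℚ.∣p+q∣≤∣p∣+∣q∣ (Z (shift E) (w ∘ suc)) _)
  (ℚ.+-mono-≤ (Z-bound (shift E) (h ∘ suc))
    (subst (_≤ two * bound n) (sym (ℚ.∣p*q∣≡∣p∣*∣q∣ (w zero) _))
      (*-mono (ℚ.0≤∣p∣ (w zero)) (0≤bound n) (h zero) (Z-bound (shift E) (cut-small (E zero ∘ suc) 0≤2 (h ∘ suc))))))

Z-lipschitz : ∀ {n} (E : Adj n) {w w′ e} → 0ℚ ≤ e → (∀ v → ℚ.∣ w v ∣ ≤ two) → (∀ v → ℚ.∣ w′ v ∣ ≤ two) →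
  (∀ v → ℚ.∣ w v - w′ v ∣ ≤ e) → ℚ.∣ Z E w - Z E w′ ∣ ≤ lipschitz n * e
Z-lipschitz {zero}  E {e = e} 0≤e h h′ close = ℚ.≤-reflexive (sym (ℚ.*-zeroˡ e))
Z-lipschitz {suc n} E {w} {w′} {e} 0≤e h h′ close = begin
  ℚ.∣ (A + w zero * B) - (A′ + w′ zero * B′) ∣
    ≡⟨ cong ℚ.∣_∣ (eq₁ A A′ B B′ (w zero) (w′ zero)) ⟩
  ℚ.∣ (A - A′) + (w zero * (B - B′) + (w zero - w′ zero) * B′) ∣
    ≤⟨ ℚ.≤-trans (ℚ.∣p+q∣≤∣p∣+∣q∣ (A - A′) _) (ℚ.+-monoʳ-≤ ℚ.∣ A - A′ ∣ (ℚ.∣p+q∣≤∣p∣+∣q∣ (w zero * (B - B′)) _)) ⟩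
  ℚ.∣ A - A′ ∣ + (ℚ.∣ w zero * (B - B′) ∣ + ℚ.∣ (w zero - w′ zero) * B′ ∣)
    ≡⟨ cong₂ (λ x y → ℚ.∣ A - A′ ∣ + (x + y)) (ℚ.∣p*q∣≡∣p∣*∣q∣ (w zero) (B - B′)) (ℚ.∣p*q∣≡∣p∣*∣q∣ (w zero - w′ zero) B′) ⟩
  ℚ.∣ A - A′ ∣ + (ℚ.∣ w zero ∣ * ℚ.∣ B - B′ ∣ + ℚ.∣ w zero - w′ zero ∣ * ℚ.∣ B′ ∣)
    ≤⟨ ℚ.+-mono-≤ (Z-lipschitz (shift E) 0≤e (h ∘ suc) (h′ ∘ suc) (close ∘ suc)) (ℚ.+-mono-≤
         (*-mono (ℚ.0≤∣p∣ (w zero)) (0≤* (0≤lipschitz n) 0≤e) (h zero)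
           (Z-lipschitz (shift E) 0≤e (cut-small X 0≤2 (h ∘ suc)) (cut-small X 0≤2 (h′ ∘ suc)) (cut-close X 0≤e (close ∘ suc))))
         (*-mono (ℚ.0≤∣p∣ (w zero - w′ zero)) (0≤bound n) (close zero) (Z-bound (shift E) (cut-small X 0≤2 (h′ ∘ suc))))) ⟩
  lipschitz n * e + (two * (lipschitz n * e) + e * bound n)
    ≡⟨ eq₂ (lipschitz n) e two (bound n) ⟩
  (lipschitz n + (two * lipschitz n + bound n)) * e ∎
  where
  open ℚ.≤-Reasoning
  X = E zero ∘ suc
  A = Z (shift E) (w ∘ suc)
  A′ = Z (shift E) (w′ ∘ suc)
  B = Z (shift E) (cut X (w ∘ suc))
  B′ = Z (shift E) (cut X (w′ ∘ suc))
  eq₁ : ∀ A A′ B B′ x x′ → (A + x * B) - (A′ + x′ * B′) ≡ (A - A′) + (x * (B - B′) + (x - x′) * B′)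
  eq₁ = solve-∀ ℚ-ring
  eq₂ : ∀ l e t b → l * e + (t * (l * e) + e * b) ≡ (l + (t * l + b)) * e
  eq₂ = solve-∀ ℚ-ring

Small : ℚ → Set
Small q = ℚ.∣ q ∣ ≤ two

small : ∀ {q} → - two ≤ q → q ≤ 0ℚ → Small q
small {q} -2≤q q≤0 = ∣∣-≤ (ℚ.≤-trans q≤0 0≤2) (subst (- q ≤_) (neg-neg two) (ℚ.neg-antimono-≤ -2≤q))
  where
  neg-neg : ∀ x → - (- x) ≡ x
  neg-neg = solve-∀ ℚ-ring

ind-small : ∀ {n} (S : Sub n) {q} → Small q → ∀ v → Small (ind q S v)
ind-small S h v with S v
... | true  = h
... | false = 0≤2

ind-close : ∀ {n} (S : Sub n) {q r e} → 0ℚ ≤ e → ℚ.∣ q - r ∣ ≤ e → ∀ v → ℚ.∣ ind q S v - ind r S v ∣ ≤ e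
ind-close S 0≤e h v with S v
... | true  = h
... | false = 0≤e

f-lipschitz : ∀ {n} (E : Adj n) S {q r e} → 0ℚ ≤ e → Small q → Small r → ℚ.∣ q - r ∣ ≤ e →
  Z E (ind q S) ≤ Z E (ind r S) + lipschitz n * e
f-lipschitz E S 0≤e hq hr h =
  ∣-∣-≤ (Z-lipschitz E 0≤e (ind-small S hq) (ind-small S hr) (ind-close S 0≤e h))

0<½ : 0ℚ < ½
0<½ = ℚ.positive⁻¹ ½

½+½ : ∀ x → ½ * x + ½ * x ≡ x
½+½ x = trans (sym (ℚ.*-distribʳ-+ x ½ ½)) (ℚ.*-identityˡ x)

n≤2^n : ∀ n → ℕ→ℚ n ≤ two ^ n
n≤2^n zero    = subst (_≤ 1ℚ) (sym ℕ→ℚ-zero) 0≤1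
n≤2^n (suc n) = subst (_≤ two ^ suc n) (sym (ℕ→ℚ-suc n))
  (subst (1ℚ + ℕ→ℚ n ≤_) (eq (two ^ n)) (ℚ.+-mono-≤ (1≤2^ n) (n≤2^n n)))
  where
  eq : ∀ x → x + x ≡ (1ℚ + 1ℚ) * x
  eq = solve-∀ ℚ-ring
  1≤2^ : ∀ n → 1ℚ ≤ two ^ n
  1≤2^ zero    = ℚ.≤-refl
  1≤2^ (suc n) = ℚ.≤-trans (1≤2^ n) (≤-via (two ^ n) (ℚ.≤-trans 0≤1 (1≤2^ n)) (sym (eq (two ^ n))))

opaque
  unfolding ℕ→ℚ
  archimedean : ∀ x → ∃ λ n → x ≤ ℕ→ℚ n
  archimedean x = ℤ.∣ ℚ.↥ x ∣ , ℚ.toℚᵘ-cancel-≤ (ℚᵘ.≤-trans (below x)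
    (ℚᵘ.≤-reflexive (ℚᵘ.≃-sym (ℚ.toℚᵘ-fromℚᵘ (ℚᵘ.mkℚᵘ (ℤ.+ ℤ.∣ ℚ.↥ x ∣) 0)))))
    where
    below : ∀ x → ℚ.toℚᵘ x ℚᵘ.≤ ℚᵘ.mkℚᵘ (ℤ.+ ℤ.∣ ℚ.↥ x ∣) 0
    below (ℚ.mkℚ (ℤ.+ n) d _)    = ℚᵘ.*≤* (subst₂ ℤ._≤_ (ℤ.pos-* n 1) (ℤ.pos-* n (suc d)) (ℤ.+≤+ (ℕ.*-monoʳ-≤ n (ℕ.s≤s ℕ.z≤n))))
    below (ℚ.mkℚ ℤ.-[1+ n ] d _) = ℚᵘ.*≤* ℤ.-≤+

½^ : ∀ n → ½ ^ n * two ^ n ≡ 1ℚ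
½^ zero    = refl
½^ (suc n) = trans (eq ½ two (½ ^ n) (two ^ n)) (cong₂ _*_ refl (½^ n))
  where
  eq : ∀ a b c d → a * c * (b * d) ≡ (a * b) * (c * d)
  eq = solve-∀ ℚ-ring

halving : ∀ W ε → 0ℚ < ε → ∃ λ N → W * ½ ^ N ≤ ε
halving W ε 0<ε =
  let instance
        pos-ε : ℚ.Positive ε
        pos-ε = ℚ.positive 0<ε
        nonZero-ε : ℚ.NonZero ε
        nonZero-ε = ℚ.pos⇒nonZero ε
      -- Since `two ^ N` is at least `N`, any natural number not below `W / ε` will do.
      N , h = archimedean (W * ℚ.1/ ε)
  in N , subst₂ _≤_
    (trans (eq₁ W (ℚ.1/ ε) ε (½ ^ N)) (trans (cong (λ x → x * (W * ½ ^ N)) (ℚ.*-inverseʳ ε)) (ℚ.*-identityˡ _)))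
    (trans (eq₂ (two ^ N) ε (½ ^ N)) (trans (cong (_* ε) (½^ N)) (ℚ.*-identityˡ ε)))
    (ℚ.*-monoʳ-≤-nonNeg (ε * ½ ^ N) {{ℚ.nonNegative (0≤* (ℚ.<⇒≤ 0<ε) (ℚ.<⇒≤ (0<^ N 0<½)))}} (ℚ.≤-trans h (n≤2^n N)))
  where
  eq₁ : ∀ W i ε h → W * i * (ε * h) ≡ ε * i * (W * h)
  eq₁ = solve-∀ ℚ-ring
  eq₂ : ∀ t ε h → t * (ε * h) ≡ h * t * ε
  eq₂ = solve-∀ ℚ-ring

module Root {n} (E : Adj n) (E-sym : Sym E) (v₀ : Fin n) where

  -- Positivity on all induced subgraphs is what the bounds use. At a rational point it is decided
  -- by running through the finitely many subsets, which makes bisection possible.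
  Good : ℚ → Set
  Good q = ∀ S → 0ℚ < Z E (ind q S)

  good? : ∀ q → Good q ⊎ ∃ λ S → Z E (ind q S) ≤ 0ℚ
  good? q with Subset.anySubset? (λ p → Z E (ind q (Vec.lookup p)) ℚ.≤? 0ℚ)
  ... | yes (p , h) = inj₂ (Vec.lookup p , h)
  ... | no none     = inj₁ λ S → ℚ.≰⇒> λ h → none (Vec.tabulate S , subst (_≤ 0ℚ)
    (Z-cong E λ v → cong (λ b → if b then q else 0ℚ) (sym (Vec.lookup∘tabulate S v))) h)

  good-0 : Good 0ℚ
  good-0 S = subst (0ℚ <_) (sym (Z-none E zeros)) 0<1
    where
    zeros : ∀ v → ind 0ℚ S v ≡ 0ℚ
    zeros v with S v
    ... | true  = refl
    ... | false = refl

  neg-neg : ∀ q → - (- q) ≡ q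
  neg-neg = solve-∀ ℚ-ring

  at-vertex : ∀ q → Z E (ind q ⁅ v₀ ⁆) ≡ 1ℚ + q
  at-vertex q = subst (λ r → Z E (ind r ⁅ v₀ ⁆) ≡ 1ℚ + q) (neg-neg q)
    (trans (Weighted.f-remove E E-sym (- q) (∈-⁅⁆ v₀)) (trans
      (cong₂ (λ F G → F - (- q) * G) (Weighted.f-none E E-sym (- q) none) (Weighted.f-none E E-sym (- q) (λ v → ∉-∖ˡ (none v))))
      (eq q)))
    where
    none : ∀ v → v ∉ ⁅ v₀ ⁆ ∖ ⁅ v₀ ⁆
    none v = ¬∈⇒∉ λ p → ∈-∉ (∖-⊆ p) (proj₂ (∖-∈ p))
    eq : ∀ q → 1ℚ - (- q) * 1ℚ ≡ 1ℚ + q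
    eq = solve-∀ ℚ-ring

  good-range : ∀ {q} → Good q → 0ℚ < 1ℚ + q
  good-range {q} good = subst (0ℚ <_) (at-vertex q) (good ⁅ v₀ ⁆)

  good-mono : ∀ {q} → q ≤ 0ℚ → Good q → ∀ S → Z E (ind q full) ≤ Z E (ind q S)
  good-mono {q} q≤0 good S = subst (λ r → Z E (ind r full) ≤ Z E (ind r S)) (neg-neg q)
    (Weighted.f-mono E E-sym (- q) (ℚ.neg-antimono-≤ q≤0) {full}
      (λ T _ → subst (λ r → 0ℚ < Z E (ind r T)) (sym (neg-neg q)) (good T)) ⊆-refl (λ _ → ∈-full))

  -- Bisection between a good b and a bad a: at the limit Z E (ind _ full) vanishes, since at b it is
  -- the least value over all induced subgraphs, one of which has a value ≤ 0 at a.
  module Bisection (a₀ : ℚ) (-2≤a₀ : - two ≤ a₀) (a₀≤0 : a₀ ≤ 0ℚ) (S₀ : Sub n) (bad₀ : Z E (ind a₀ S₀) ≤ 0ℚ) where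

    record Bracket : Set where
      field
        a b   : ℚ
        S     : Sub n
        a₀≤a  : a₀ ≤ a
        a≤b   : a ≤ b
        b≤0   : b ≤ 0ℚ
        bad   : Z E (ind a S) ≤ 0ℚ
        good  : Good b
    open Bracket

    mid : Bracket → ℚ
    mid β = ½ * (a β + b β)

    a≤mid : ∀ β → a β ≤ mid β
    a≤mid β = subst (_≤ mid β) (½+½ (a β)) (subst (½ * a β + ½ * a β ≤_) (sym (ℚ.*-distribˡ-+ ½ (a β) (b β)))
      (ℚ.+-monoʳ-≤ (½ * a β) (*-monoˡ (ℚ.<⇒≤ 0<½) (a≤b β))))

    mid≤b : ∀ β → mid β ≤ b β
    mid≤b β = subst (mid β ≤_) (½+½ (b β)) (subst (_≤ ½ * b β + ½ * b β) (sym (ℚ.*-distribˡ-+ ½ (a β) (b β)))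
      (ℚ.+-monoˡ-≤ (½ * b β) (*-monoˡ (ℚ.<⇒≤ 0<½) (a≤b β))))

    Step : Bracket → Bracket → Set
    Step β γ = a β ≤ a γ × b γ ≤ b β × b γ - a γ ≡ ½ * (b β - a β)

    halve : ∀ β → ∃ (Step β)
    halve β with good? (mid β)
    ... | inj₁ g = record
      { a = a β ; b = mid β ; S = S β ; a₀≤a = a₀≤a β ; a≤b = a≤mid β ; b≤0 = ℚ.≤-trans (mid≤b β) (b≤0 β) ; bad = bad β ; good = g }
      , ℚ.≤-refl , mid≤b β , trans (cong (λ x → ½ * (a β + b β) - x) (sym (½+½ (a β)))) (eq ½ (a β) (b β))
      where
      eq : ∀ h a b → h * (a + b) - (h * a + h * a) ≡ h * (b - a)
      eq = solve-∀ ℚ-ring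
    ... | inj₂ (T , h) = record
      { a = mid β ; b = b β ; S = T ; a₀≤a = ℚ.≤-trans (a₀≤a β) (a≤mid β) ; a≤b = mid≤b β ; b≤0 = b≤0 β ; bad = h ; good = good β }
      , a≤mid β , ℚ.≤-refl , trans (cong (λ x → x - ½ * (a β + b β)) (sym (½+½ (b β)))) (eq ½ (a β) (b β))
      where
      eq : ∀ h a b → (h * b + h * b) - h * (a + b) ≡ h * (b - a)
      eq = solve-∀ ℚ-ring

    bracket : ℕ → Bracket
    bracket zero    = record
      { a = a₀ ; b = 0ℚ ; S = S₀ ; a₀≤a = ℚ.≤-refl ; a≤b = a₀≤0 ; b≤0 = ℚ.≤-refl ; bad = bad₀ ; good = good-0 }
    bracket (suc k) = proj₁ (halve (bracket k))

    width : ∀ k → b (bracket k) - a (bracket k) ≡ (- a₀) * ½ ^ k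
    width zero    = trans (ℚ.+-identityˡ (- a₀)) (sym (ℚ.*-identityʳ (- a₀)))
    width (suc k) = trans (proj₂ (proj₂ (proj₂ (halve (bracket k))))) (trans (cong (½ *_) (width k)) (eq ½ (- a₀) (½ ^ k)))
      where
      eq : ∀ h w x → h * (w * x) ≡ w * (h * x)
      eq = solve-∀ ℚ-ring

    nested : ∀ j k → a (bracket k) ≤ a (bracket (j ℕ.+ k)) × b (bracket (j ℕ.+ k)) ≤ b (bracket k)
    nested zero    k = ℚ.≤-refl , ℚ.≤-refl
    nested (suc j) k =
      let p , q = nested j k ; p′ , q′ , _ = proj₂ (halve (bracket (j ℕ.+ k)))
      in ℚ.≤-trans p p′ , ℚ.≤-trans q′ q

    nested-≤ : ∀ {k m} → k ℕ.≤ m → a (bracket k) ≤ a (bracket m) × b (bracket m) ≤ b (bracket k)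
    nested-≤ {k} {m} k≤m = subst (λ i → a (bracket k) ≤ a (bracket i) × b (bracket i) ≤ b (bracket k))
      (ℕ.m∸n+n≡m k≤m) (nested (m ℕ.∸ k) k)

    gap : ∀ {N m n} → N ℕ.≤ m → N ℕ.≤ n → b (bracket m) - b (bracket n) ≤ (- a₀) * ½ ^ N
    gap {N} {m} {n} N≤m N≤n = subst (b (bracket m) - b (bracket n) ≤_) (width N)
      (ℚ.+-mono-≤ (proj₂ (nested-≤ N≤m)) (ℚ.neg-antimono-≤ (ℚ.≤-trans (proj₁ (nested-≤ N≤n)) (a≤b (bracket n)))))

    root : ℝ
    root = mkℝ (b ∘ bracket) λ ε 0<ε → let N , h = halving (- a₀) ε 0<ε in N , λ {m} {n} N≤m N≤n →
      ∣∣-≤ (ℚ.≤-trans (gap N≤m N≤n) h)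
           (subst (_≤ ε) (eq (b (bracket n)) (b (bracket m))) (ℚ.≤-trans (gap N≤n N≤m) h))
      where
      eq : ∀ x y → x - y ≡ - (y - x)
      eq = solve-∀ ℚ-ring

    root≥ : ∀ k → a₀ ≤ ℝ.seq root k
    root≥ k = ℚ.≤-trans (a₀≤a (bracket k)) (a≤b (bracket k))

    value-pos : ∀ k → 0ℚ < Z E (ind (ℝ.seq root k) full)
    value-pos k = good (bracket k) full

    value-small : ∀ ε → 0ℚ < ε → ∃ λ N → ∀ {k} → N ℕ.≤ k → Z E (ind (ℝ.seq root k) full) ≤ ε
    value-small ε 0<ε = let N , h = halving (lipschitz n * (- a₀)) ε 0<ε in N , λ {k} N≤k →
      let β = bracket k
          0≤w : 0ℚ ≤ b β - a β
          0≤w = ≤⇒0≤ (a≤b β)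
          w≤ : b β - a β ≤ (- a₀) * ½ ^ N
          w≤ = subst (b β - a β ≤_) (width N)
                 (ℚ.+-mono-≤ (proj₂ (nested-≤ N≤k)) (ℚ.neg-antimono-≤ (proj₁ (nested-≤ N≤k))))
      in begin
        Z E (ind (b β) full)                              ≤⟨ good-mono (b≤0 β) (good β) (S β) ⟩
        Z E (ind (b β) (S β))                             ≤⟨ f-lipschitz E (S β) 0≤w
                                                              (small (ℚ.≤-trans -2≤a₀ (root≥ k)) (b≤0 β))
                                                              (small (ℚ.≤-trans -2≤a₀ (a₀≤a β)) (ℚ.≤-trans (a≤b β) (b≤0 β)))
                                                              (ℚ.≤-reflexive (ℚ.0≤p⇒∣p∣≡p 0≤w)) ⟩
        Z E (ind (a β) (S β)) + lipschitz n * (b β - a β) ≤⟨ ℚ.+-mono-≤ (bad β) (*-monoˡ (0≤lipschitz n) w≤) ⟩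
        0ℚ + lipschitz n * ((- a₀) * ½ ^ N)               ≡⟨ trans (ℚ.+-identityˡ _) (sym (ℚ.*-assoc (lipschitz n) (- a₀) (½ ^ N))) ⟩
        lipschitz n * (- a₀) * ½ ^ N                      ≤⟨ h ⟩
        ε                                                 ∎
      where open ℚ.≤-Reasoning

  bisect : ∀ a₀ → - two ≤ a₀ → a₀ ≤ 0ℚ → ∀ S₀ → Z E (ind a₀ S₀) ≤ 0ℚ →
    ∃ λ y → (∀ k → a₀ ≤ ℝ.seq y k) × (∀ k → 0ℚ < Z E (ind (ℝ.seq y k) full)) ×
            (∀ ε → 0ℚ < ε → ∃ λ N → ∀ {k} → N ℕ.≤ k → Z E (ind (ℝ.seq y k) full) ≤ ε)
  bisect a₀ -2≤a₀ a₀≤0 S₀ bad₀ = root , root≥ , value-pos , value-small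
    where open Bisection a₀ -2≤a₀ a₀≤0 S₀ bad₀

-- `δ` is the minimum of 1 and ε / (1 + l), the summand 1 avoiding a division by zero. Its four
-- quarters `η` are spent on `ξ ≤ x`, on the oscillation of the sequence of `x`, and, two of them,
-- on a strict gap beyond `ξ`.
margin : ∀ l ε → 0ℚ ≤ l → 0ℚ < ε → ∃ λ δ → ∃ λ η → 0ℚ < η × η + η + (η + η) ≡ δ × δ ≤ 1ℚ × l * δ ≤ ε
margin l ε 0≤l 0<ε = δ , ½ * (½ * δ) , 0<* 0<½ (0<* 0<½ 0<δ) ,
  trans (cong₂ _+_ (½+½ (½ * δ)) (½+½ (½ * δ))) (½+½ δ) , ℚ.p⊓q≤p 1ℚ (ε * i) , lδ≤ε
  where
  instance
    pos-l : ℚ.Positive (1ℚ + l)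
    pos-l = ℚ.positive (0<+ 0<1 0≤l)
    nonZero-l : ℚ.NonZero (1ℚ + l)
    nonZero-l = ℚ.pos⇒nonZero (1ℚ + l)
  i = ℚ.1/ (1ℚ + l)
  δ = 1ℚ ℚ.⊓ (ε * i)
  0<δ : 0ℚ < δ
  0<δ = Sum.[ (λ e → subst (0ℚ <_) (sym e) 0<1) ,
              (λ e → subst (0ℚ <_) (sym e) (0<* 0<ε (ℚ.positive⁻¹ i {{ℚ.1/pos⇒pos (1ℚ + l)}}))) ]′ (ℚ.⊓-sel 1ℚ (ε * i))
  eq₁ : ∀ l d → (1ℚ + l) * d ≡ l * d + d
  eq₁ = solve-∀ ℚ-ring
  eq₂ : ∀ l e i → l * (e * i) ≡ e * (l * i)
  eq₂ = solve-∀ ℚ-ring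
  lδ≤ε : l * δ ≤ ε
  lδ≤ε = ℚ.≤-trans (≤-via δ (ℚ.<⇒≤ 0<δ) (eq₁ l δ))
    (ℚ.≤-trans (*-monoˡ (ℚ.<⇒≤ (ℚ.positive⁻¹ (1ℚ + l))) (ℚ.p⊓q≤q 1ℚ (ε * i)))
      (ℚ.≤-reflexive (trans (eq₂ (1ℚ + l) ε i) (trans (cong (ε *_) (ℚ.*-inverseʳ (1ℚ + l))) (ℚ.*-identityʳ ε)))))

-1≤0 : - 1ℚ ≤ 0ℚ
-1≤0 = ℚ.nonPositive⁻¹ (- 1ℚ)

-2≤-1 : - two ≤ - 1ℚ
-2≤-1 = ≤-via 1ℚ 0≤1 refl

vanishing : ∀ {m k} (A : Graph m) (E : Adj k) → (∀ q → poly A q ≡ Z E (ind q full)) → ∀ y →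
  (∀ i → 0ℚ < Z E (ind (ℝ.seq y i) full)) →
  (∀ ε → 0ℚ < ε → ∃ λ N → ∀ {i} → N ℕ.≤ i → Z E (ind (ℝ.seq y i) full) ≤ ε) → I A y D.≈ 0ℝ
vanishing A E same y pos small = upper , lower
  where
  value : ∀ i → Z E (ind (ℝ.seq y i) full) ≡ ℝ.seq (I A y) i
  value i = sym (trans (seq-I A y i) (same (ℝ.seq y i)))
  upper : I A y D.≤ 0ℝ
  upper ε 0<ε = let N , h = small ε 0<ε in N , λ {i} N≤i →
    ℚ.≤-trans (ℚ.≤-reflexive (sym (value i))) (ℚ.≤-trans (h N≤i) (ℚ.≤-reflexive (sym (ℚ.+-identityˡ ε))))
  lower : 0ℝ D.≤ I A y
  lower ε 0<ε = 0 , λ {i} _ → ℚ.≤-trans (ℚ.<⇒≤ (pos i)) (ℚ.≤-trans (ℚ.≤-reflexive (value i)) (≤-via ε (ℚ.<⇒≤ 0<ε) refl))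

-- That `q` lies strictly beyond `ξ` is expressed by a gap `δ` valid from the index `M` on. A zero
-- found at or above `q` would contradict `largest` already with half of this gap.
good-beyond : ∀ {k} (E : Adj k) (E-sym : Sym E) (v₀ : Fin k) ξ →
  (∀ y → (∀ i → 0ℚ < Z E (ind (ℝ.seq y i) full)) →
    (∀ ε → 0ℚ < ε → ∃ λ N → ∀ {i} → N ℕ.≤ i → Z E (ind (ℝ.seq y i) full) ≤ ε) → y D.≤ ξ) →
  ∀ q → q ≤ 0ℚ → ∀ δ → 0ℚ < δ → ∀ M → (∀ {i} → M ℕ.≤ i → ℝ.seq ξ i + δ ≤ q) → Root.Good E E-sym v₀ q
good-beyond E E-sym v₀ ξ largest q q≤0 δ 0<δ M beyond =
  Sum.[ id , (λ { (S , bad) → ⊥-elim (start S bad (ℚ.≤-total (- 1ℚ) q)) }) ]′ (good? q)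
  where
  open Root E E-sym v₀
  not-larger : ∀ y → (∀ i → q ≤ ℝ.seq y i) → y D.≤ ξ → ⊥
  not-larger y q≤y y≤ξ with y≤ξ (½ * δ) (0<* 0<½ 0<δ)
  ... | M′ , below = contradict (ℝ.seq ξ (M ℕ.⊔ M′)) (ℝ.seq y (M ℕ.⊔ M′))
      (beyond (ℕ.m≤m⊔n M M′)) (q≤y (M ℕ.⊔ M′)) (below (ℕ.m≤n⊔m M M′))
    where
    ½δ<δ : ½ * δ < δ
    ½δ<δ = <-via {½ * δ} {δ} (½ * δ) (0<* 0<½ 0<δ) (sym (½+½ δ))
    contradict : ∀ a b → a + δ ≤ q → q ≤ b → b ≤ a + ½ * δ → ⊥
    contradict a b h₁ h₂ h₃ = ℚ.<-irrefl {a + ½ * δ} refl (ℚ.<-≤-trans {a + ½ * δ} {a + δ}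
      (ℚ.+-monoʳ-< a ½δ<δ)
      (ℚ.≤-trans h₁ (ℚ.≤-trans h₂ h₃)))
  impossible : ∀ a₀ → q ≤ a₀ →
    ∃ (λ y → (∀ k → a₀ ≤ ℝ.seq y k) × (∀ k → 0ℚ < Z E (ind (ℝ.seq y k) full)) ×
             (∀ ε → 0ℚ < ε → ∃ λ N → ∀ {k} → N ℕ.≤ k → Z E (ind (ℝ.seq y k) full) ≤ ε)) → ⊥
  impossible a₀ q≤a₀ (y , a₀≤y , pos , small) = not-larger y (λ i → ℚ.≤-trans q≤a₀ (a₀≤y i)) (largest y pos small)
  start : ∀ S → Z E (ind q S) ≤ 0ℚ → - 1ℚ ≤ q ⊎ q ≤ - 1ℚ → ⊥
  start S bad (inj₁ -1≤q) = impossible q ℚ.≤-refl (bisect q (ℚ.≤-trans -2≤-1 -1≤q) q≤0 S bad)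
  -- Below -1 the bisection starts at -1 instead, where the subgraph on a single vertex vanishes;
  -- this keeps the activities bounded.
  start S bad (inj₂ q≤-1) = impossible (- 1ℚ) q≤-1
    (bisect (- 1ℚ) -2≤-1 -1≤0 ⁅ v₀ ⁆ (ℚ.≤-reflexive (trans (at-vertex (- 1ℚ)) (ℚ.+-inverseʳ 1ℚ))))

largest-root-good : ∀ {m k} (A : Graph m) (E : Adj k) (E-sym : Sym E) (v₀ : Fin k) →
  (∀ q → poly A q ≡ Z E (ind q full)) → ∀ ξ → IsLargestRoot A ξ →
  ∀ q → q ≤ 0ℚ → ∀ δ → 0ℚ < δ → ∀ M → (∀ {i} → M ℕ.≤ i → ℝ.seq ξ i + δ ≤ q) → Root.Good E E-sym v₀ q
largest-root-good A E E-sym v₀ same ξ ξ-root = good-beyond E E-sym v₀ ξ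
  λ y pos small → proj₂ ξ-root y (vanishing A E same y pos small)

-- E may be another graph with the same independence polynomial as A.
≼-criterion : ∀ {m n k} (A : Graph m) (B : Graph n) (E : Adj k) (E-sym : Sym E) (v₀ : Fin k) →
  (∀ q → poly A q ≡ Z E (ind q full)) →
  (∀ q → q ≤ 0ℚ → Root.Good E E-sym v₀ q → poly A q ≤ poly B q) → B ≼ A
≼-criterion {m} {n} {k} A B E E-sym v₀ same core ξ ξ-root x ξ≤x x≤0 ε 0<ε =
  let δ , η , 0<η , 4η≡δ , δ≤1 , lδ≤ε = margin (lipschitz k + lipschitz n) ε (0≤+ (0≤lipschitz k) (0≤lipschitz n)) 0<ε
  in Margin.N δ η 0<η 4η≡δ δ≤1 lδ≤ε , Margin.compare δ η 0<η 4η≡δ δ≤1 lδ≤ε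
  where
  open Root E E-sym v₀

  module Margin (δ η : ℚ) (0<η : 0ℚ < η) (4η≡δ : η + η + (η + η) ≡ δ) (δ≤1 : δ ≤ 1ℚ)
    (lδ≤ε : (lipschitz k + lipschitz n) * δ ≤ ε) where

    0≤η : 0ℚ ≤ η
    0≤η = ℚ.<⇒≤ 0<η

    0<δ : 0ℚ < δ
    0<δ = subst (0ℚ <_) 4η≡δ (0<+ (0<+ 0<η 0≤η) (0≤+ 0≤η 0≤η))

    N₁ = proj₁ (ξ≤x η 0<η)
    N₂ = proj₁ (x≤0 η 0<η)
    N₃ = proj₁ (ℝ.cauchy x η 0<η)
    N = N₁ ℕ.⊔ N₂ ℕ.⊔ N₃

    module At {i} (N≤i : N ℕ.≤ i) where
      xᵢ = ℝ.seq x i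

      close : ∀ {j} → N ℕ.≤ j → ℝ.seq x j ≤ xᵢ + η
      close N≤j = ∣-∣-≤ (proj₂ (ℝ.cauchy x η 0<η) (ℕ.m⊔n≤o⇒n≤o (N₁ ℕ.⊔ N₂) N₃ N≤j) (ℕ.m⊔n≤o⇒n≤o (N₁ ℕ.⊔ N₂) N₃ N≤i))

      xᵢ≤η : xᵢ ≤ η
      xᵢ≤η = subst (xᵢ ≤_) (ℚ.+-identityˡ η) (proj₂ (x≤0 η 0<η) (ℕ.m⊔n≤o⇒n≤o N₁ N₂ (ℕ.m⊔n≤o⇒m≤o (N₁ ℕ.⊔ N₂) N₃ N≤i)))

      η≤δ : η ≤ δ
      η≤δ = ≤-via (η + η + η) (0≤+ (0≤+ 0≤η 0≤η) 0≤η) (trans (sym 4η≡δ) (eq η))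
        where
        eq : ∀ x → x + x + (x + x) ≡ x + (x + x + x)
        eq = solve-∀ ℚ-ring

      -- The point `x` may be `ξ` itself, where positivity fails, so the comparison is made at a
      -- rational point a distance `δ` to the right of an approximation of `x`.
      good-shifted : xᵢ + δ ≤ 0ℚ → Good (xᵢ + δ)
      good-shifted h = largest-root-good A E E-sym v₀ same ξ ξ-root (xᵢ + δ) h (η + η) (0<+ 0<η (ℚ.<⇒≤ 0<η)) N λ {j} N≤j → begin
        ℝ.seq ξ j + (η + η)       ≤⟨ ℚ.+-monoˡ-≤ (η + η) (proj₂ (ξ≤x η 0<η)
                                       (ℕ.m⊔n≤o⇒m≤o N₁ N₂ (ℕ.m⊔n≤o⇒m≤o (N₁ ℕ.⊔ N₂) N₃ N≤j))) ⟩
        ℝ.seq x j + η + (η + η)   ≤⟨ ℚ.+-monoˡ-≤ (η + η) (ℚ.+-monoˡ-≤ η (close N≤j)) ⟩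
        xᵢ + η + η + (η + η)      ≡⟨ trans (eq xᵢ η) (cong (xᵢ +_) 4η≡δ) ⟩
        xᵢ + δ                    ∎
        where
        open ℚ.≤-Reasoning
        eq : ∀ x y → x + y + y + (y + y) ≡ x + (y + y + (y + y))
        eq = solve-∀ ℚ-ring

      conclude : ∀ q → q ≤ 0ℚ → Good q → ℚ.∣ xᵢ - q ∣ ≤ δ → ℚ.∣ q - xᵢ ∣ ≤ δ → Small xᵢ →
        poly A xᵢ ≤ poly B xᵢ + ε
      conclude q q≤0 good near near′ x-small = begin
        poly A xᵢ                                              ≡⟨ same xᵢ ⟩
        Z E (ind xᵢ full)                                      ≤⟨ f-lipschitz E full (ℚ.<⇒≤ 0<δ) x-small q-small near ⟩
        Z E (ind q full) + lipschitz k * δ                     ≡⟨ cong (_+ lipschitz k * δ) (same q) ⟨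
        poly A q + lipschitz k * δ                             ≤⟨ ℚ.+-monoˡ-≤ (lipschitz k * δ) (core q q≤0 good) ⟩
        poly B q + lipschitz k * δ                             ≡⟨ cong (_+ lipschitz k * δ) (poly-Z B q) ⟩
        Z (adj B) (ind q full) + lipschitz k * δ               ≤⟨ ℚ.+-monoˡ-≤ (lipschitz k * δ)
                                                                    (f-lipschitz (adj B) full (ℚ.<⇒≤ 0<δ) q-small x-small near′) ⟩
        Z (adj B) (ind xᵢ full) + lipschitz n * δ + lipschitz k * δ ≡⟨ cong (λ z → z + lipschitz n * δ + lipschitz k * δ) (sym (poly-Z B xᵢ)) ⟩
        poly B xᵢ + lipschitz n * δ + lipschitz k * δ          ≡⟨ eq (poly B xᵢ) (lipschitz n) (lipschitz k) δ ⟩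
        poly B xᵢ + (lipschitz k + lipschitz n) * δ                                      ≤⟨ ℚ.+-monoʳ-≤ (poly B xᵢ) lδ≤ε ⟩
        poly B xᵢ + ε                                          ∎
        where
        open ℚ.≤-Reasoning
        eq : ∀ p l k d → p + l * d + k * d ≡ p + (k + l) * d
        eq = solve-∀ ℚ-ring
        q-small : Small q
        q-small = small (ℚ.≤-trans -2≤-1 (0≤⇒≤ (subst (0ℚ ≤_) (eq′ q) (ℚ.<⇒≤ (good-range good))))) q≤0
          where
          eq′ : ∀ q → 1ℚ + q ≡ q - (- 1ℚ)
          eq′ = solve-∀ ℚ-ring

      result : poly A xᵢ ≤ poly B xᵢ + ε
      result with ℚ.≤-total (xᵢ + δ) 0ℚ
      ... | inj₁ h = conclude (xᵢ + δ) h (good-shifted h)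
        (ℚ.≤-reflexive (trans (cong ℚ.∣_∣ (eq₁ xᵢ δ)) (trans (ℚ.∣-p∣≡∣p∣ δ) ∣δ∣)))
        (ℚ.≤-reflexive (trans (cong ℚ.∣_∣ (eq₂ xᵢ δ)) ∣δ∣))
        (small (0≤⇒≤ (subst (0ℚ ≤_) (eq₃ xᵢ δ) (0≤+ (ℚ.<⇒≤ (good-range (good-shifted h))) (≤⇒0≤ δ≤1))))
               (ℚ.≤-trans (≤-via {xᵢ} {xᵢ + δ} δ (ℚ.<⇒≤ 0<δ) refl) h))
        where
        ∣δ∣ : ℚ.∣ δ ∣ ≡ δ
        ∣δ∣ = ℚ.0≤p⇒∣p∣≡p (ℚ.<⇒≤ 0<δ)
        eq₁ : ∀ x d → x - (x + d) ≡ - d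
        eq₁ = solve-∀ ℚ-ring
        eq₂ : ∀ x d → x + d - x ≡ d
        eq₂ = solve-∀ ℚ-ring
        eq₃ : ∀ x d → 1ℚ + (x + d) + (1ℚ - d) ≡ x - (- (1ℚ + 1ℚ))
        eq₃ = solve-∀ ℚ-ring
      -- The shifted point would be positive, so the approximation is within `δ` of 0, and 0 is a
      -- good point.
      ... | inj₂ h = conclude 0ℚ ℚ.≤-refl good-0
        (∣∣-≤ (subst (_≤ δ) (eq₁ xᵢ) (ℚ.≤-trans xᵢ≤η η≤δ)) (subst (_≤ δ) (eq₂ xᵢ) -x≤δ))
        (∣∣-≤ (subst (_≤ δ) (eq₃ xᵢ) -x≤δ) (subst (_≤ δ) (eq₄ xᵢ) (ℚ.≤-trans xᵢ≤η η≤δ)))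
        (∣∣-≤ (ℚ.≤-trans (ℚ.≤-trans xᵢ≤η η≤δ) δ≤2) (ℚ.≤-trans -x≤δ δ≤2))
        where
        δ≤2 : δ ≤ two
        δ≤2 = ℚ.≤-trans δ≤1 (≤-via 1ℚ 0≤1 refl)
        -x≤δ : - xᵢ ≤ δ
        -x≤δ = 0≤⇒≤ (subst (0ℚ ≤_) (eq xᵢ δ) h)
          where
          eq : ∀ x d → x + d ≡ d - (- x)
          eq = solve-∀ ℚ-ring
        eq₁ : ∀ x → x ≡ x - 0ℚ
        eq₁ = solve-∀ ℚ-ring
        eq₂ : ∀ x → - x ≡ - (x - 0ℚ)
        eq₂ = solve-∀ ℚ-ring
        eq₃ : ∀ x → - x ≡ 0ℚ - x
        eq₃ = solve-∀ ℚ-ring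
        eq₄ : ∀ x → x ≡ - (0ℚ - x)
        eq₄ = solve-∀ ℚ-ring

    compare : ∀ {i} → N ℕ.≤ i → ℝ.seq (I A x) i ≤ ℝ.seq (I B x) i + ε
    compare {i} N≤i = subst₂ (λ p r → p ≤ r + ε) (sym (seq-I A x i)) (sym (seq-I B x i)) (At.result N≤i)

-- The bounds for the graph star of a unicyclic graph

record UnicyclicStar {N} (E : Adj N) : Set where
  field
    starred : Starred E
  open Starred starred public
  open Connectivity E E-sym public
  field
    c        : Fin N
    K        : Sub N
    cycleSet : CycleSet K c
    K⊆∁L     : K ⊆ ∁ L
    conn     : Conn ⁅ c ⁆ (∁ L)
    pseudo   : Pseudoforest (∁ L) c
    forest   : Forest (∁ L ∖ ⁅ c ⁆)

module StarAt {N} {E : Adj N} (starred : Starred E) (q t : ℚ) (tq : (1ℚ + q) * (- t) ≡ q) (0<1+q : 0ℚ < 1ℚ + q) where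
  open Starred starred
  open Weighted E E-sym t

  star-value : Z E (ind q full) ≡ (1ℚ + q) ^ card L * f (∁ L)
  star-value = trans (Z-cong E λ v → cong (λ b → if b then q else 0ℚ) (all v)) (star-polynomial q (- t) tq {∁ L} ⊆-refl)
    where
    all : full ≗ ∁ L ∪ L
    all = ⊆-antisym (λ {v} _ → Sum.[ (λ v∈L → ∈-∪ʳ v∈L) , (λ v∉L → ∈-∪ˡ (∈-∁ v∉L)) ]′ (∈? L v)) (λ _ → ∈-full)

  star-pos : (∀ S → 0ℚ < Z E (ind q S)) → Pos (∁ L)
  star-pos good S S⊆ = 0<-cancelˡ (0<^ (card L) 0<1+q) (subst (0ℚ <_) (star-polynomial q (- t) tq S⊆) (good (S ∪ L)))

module StarBounds {N} {E : Adj N} (star : UnicyclicStar E) (q t : ℚ) (tq : (1ℚ + q) * (- t) ≡ q) (0<1+q : 0ℚ < 1ℚ + q)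
  (0≤t : 0ℚ ≤ t) {n} (N≡n+n : N ≡ n ℕ.+ n) where
  open UnicyclicStar star
  open StarAt starred q t tq 0<1+q

  private
    card-L : card L ≡ n
    card-L = proj₁ (card-half N≡n+n)

    card-D : card (∁ L) ≡ n
    card-D = proj₂ (card-half N≡n+n)

    value : Z E (ind q full) ≡ (1ℚ + q) ^ n * Weighted.f E E-sym t (∁ L)
    value = trans star-value (cong (λ k → (1ℚ + q) ^ k * Weighted.f E E-sym t (∁ L)) card-L)

    0≤^ : 0ℚ ≤ (1ℚ + q) ^ n
    0≤^ = ℚ.<⇒≤ (0<^ n 0<1+q)

  star-upper : (∀ S → 0ℚ < Z E (ind q S)) → Z E (ind q full) ≤ (1ℚ + q) ^ n * C t n
  star-upper good = subst (_≤ (1ℚ + q) ^ n * C t n) (sym value) (*-monoˡ 0≤^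
    (subst (λ k → Weighted.f E E-sym t (∁ L) ≤ C t k) card-D (proj₂ (Cycles.cycle-bound cycleSet posP K⊆∁L conn))))
    where
    open UpperBound E E-sym t 0≤t (∁ L) (star-pos good)
    -- The path estimate on the whole base graph is applied here for its first half, the positivity
    -- of `P` up to the order of the base plus one.
    posP : Sequences.P⁺ t 0≤t (suc (card (∁ L)))
    posP = proj₁ (path-bound ⊆-refl (K⊆∁L (CycleSet.root cycleSet)) conn)

  star-lower : ∀ k → n ≡ 3 ℕ.+ k → 0ℚ < 1ℚ - t → 0ℚ < U-poly t k → (1ℚ + q) ^ n * U-poly t k ≤ Z E (ind q full)
  star-lower k n≡ t<1 0<U = subst ((1ℚ + q) ^ n * U-poly t k ≤_) (sym value) (*-monoˡ 0≤^
    (unicyclic-bound pseudo forest (3 ℕ.+ k) (3 ℕ.+ k) ℕ.≤-refl 0<U ⊆-refl (trans card-D n≡)))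
    where open LowerBound E E-sym E-irr t 0≤t t<1

-- The graph stars of Cₙ and Uₙ

does-true : ∀ {A : Set} (d : Dec A) → does d ≡ true → A
does-true (yes a) _ = a

module StarGraph {n} (H : Graph n) where

  E : Adj (n ℕ.+ n)
  E = adj (H ⋆)

  side : Fin n ⊎ Fin n → Bool
  side (inj₁ _) = false
  side (inj₂ _) = true

  star-adj : Fin n ⊎ Fin n → Fin n ⊎ Fin n → Bool
  star-adj (inj₁ u) (inj₁ v) = adj H u v
  star-adj (inj₁ u) (inj₂ v) = does (u Fin.≟ v)
  star-adj (inj₂ u) (inj₁ v) = does (u Fin.≟ v)
  star-adj (inj₂ u) (inj₂ v) = false

  E-star : ∀ i j → E i j ≡ star-adj (Fin.splitAt n i) (Fin.splitAt n j)
  E-star i j with Fin.splitAt n i | Fin.splitAt n j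
  ... | inj₁ u | inj₁ v = refl
  ... | inj₁ u | inj₂ v = refl
  ... | inj₂ u | inj₁ v = refl
  ... | inj₂ u | inj₂ v = refl

  mate : Fin (n ℕ.+ n) → Fin (n ℕ.+ n)
  mate v = Fin.join n n (Sum.swap (Fin.splitAt n v))

  split-mate : ∀ v → Fin.splitAt n (mate v) ≡ Sum.swap (Fin.splitAt n v)
  split-mate v = Fin.splitAt-join n n (Sum.swap (Fin.splitAt n v))

  starred : Starred E
  starred = record
    { E-sym     = adj-sym (H ⋆)
    ; E-irr     = adj-irr (H ⋆)
    ; L         = side ∘ Fin.splitAt n
    ; mate      = mate
    ; mate-L    = λ v → trans (cong side (split-mate v)) (swapped (Fin.splitAt n v))
    ; mate-mate = λ v → trans (cong (λ s → Fin.join n n (Sum.swap s)) (split-mate v))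
                        (trans (cong (Fin.join n n) (twice (Fin.splitAt n v))) (Fin.join-splitAt n n v))
    ; mate-edge = λ v → trans (E-star v (mate v)) (trans (cong (star-adj (Fin.splitAt n v)) (split-mate v))
                        (joined (Fin.splitAt n v)))
    ; mate-only = λ {v} {u} v∈L e → trans (sym (Fin.join-splitAt n n u))
                    (cong (Fin.join n n) (only (Fin.splitAt n v) (Fin.splitAt n u) (holds v∈L) (trans (sym (E-star v u)) e)))
    }
    where
    swapped : ∀ s → side (Sum.swap s) ≡ not (side s)
    swapped (inj₁ _) = refl
    swapped (inj₂ _) = refl
    twice : ∀ (s : Fin n ⊎ Fin n) → Sum.swap (Sum.swap s) ≡ s
    twice (inj₁ _) = refl
    twice (inj₂ _) = refl
    joined : ∀ s → star-adj s (Sum.swap s) ≡ true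
    joined (inj₁ u) = dec-true (u Fin.≟ u) refl
    joined (inj₂ u) = dec-true (u Fin.≟ u) refl
    only : ∀ s r → side s ≡ true → star-adj s r ≡ true → r ≡ Sum.swap s
    only (inj₂ u) (inj₁ v) _ e with u Fin.≟ v
    ... | yes refl = refl

  open Starred starred using (E-sym; L) public

  E-base : ∀ v w (v<n : toℕ v ℕ.< n) (w<n : toℕ w ℕ.< n) → E v w ≡ adj H (Fin.fromℕ< v<n) (Fin.fromℕ< w<n)
  E-base v w v<n w<n = trans (E-star v w) (cong₂ star-adj (Fin.splitAt-< n v v<n) (Fin.splitAt-< n w w<n))

  opaque
    interval : ℕ → ℕ → Sub (n ℕ.+ n)
    interval i j v = does (i ℕ.≤? toℕ v) ∧ does (suc (toℕ v) ℕ.≤? j)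

    ∈-interval : ∀ {i j v} → i ℕ.≤ toℕ v → toℕ v ℕ.< j → v ∈ interval i j
    ∈-interval {i} {j} {v} p q = in! (cong₂ _∧_ (dec-true (i ℕ.≤? toℕ v) p) (dec-true (suc (toℕ v) ℕ.≤? j) q))

    interval-∈ : ∀ {i j v} → v ∈ interval i j → i ℕ.≤ toℕ v × toℕ v ℕ.< j
    interval-∈ {i} {j} {v} (in! p) =
      does-true (i ℕ.≤? toℕ v) (Bool.∧-conicalˡ _ _ p) , does-true (suc (toℕ v) ℕ.≤? j) (Bool.∧-conicalʳ _ _ p)

  base-interval : ∁ L ≗ interval 0 n
  base-interval = ⊆-antisym
    (λ {v} v∈ → ∈-interval ℕ.z≤n (below v (Fin.splitAt n v) refl (fails (∁-∈ v∈))))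
    (λ {v} v∈ → ∈-∁ (out! (cong side (Fin.splitAt-< n v (proj₂ (interval-∈ v∈))))))
    where
    below : ∀ v s → Fin.splitAt n v ≡ s → side s ≡ false → toℕ v ℕ.< n
    below v (inj₁ u) e _ = subst (ℕ._< n) (trans (sym (Fin.toℕ-↑ˡ u n)) (cong toℕ (Fin.splitAt⁻¹-↑ˡ e))) (Fin.toℕ<n u)

  vertex : ∀ {i} → i ℕ.< n → Fin (n ℕ.+ n)
  vertex i<n = Fin.fromℕ< (ℕ.≤-trans i<n (ℕ.m≤m+n n n))

  toℕ-vertex : ∀ {i} (i<n : i ℕ.< n) → toℕ (vertex i<n) ≡ i
  toℕ-vertex i<n = Fin.toℕ-fromℕ< (ℕ.≤-trans i<n (ℕ.m≤m+n n n))

  interval-remove : ∀ {i j} (i<n : i ℕ.< n) → interval i j ∖ ⁅ vertex i<n ⁆ ≗ interval (suc i) j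
  interval-remove {i} {j} i<n = ⊆-antisym
    (λ p → let q , v≢x = ∖x-∈ p ; i≤v , v<j = interval-∈ q in
      ∈-interval (ℕ.≤∧≢⇒< i≤v λ i≡v → v≢x (Fin.toℕ-injective (trans (sym i≡v) (sym (toℕ-vertex i<n))))) v<j)
    (λ p → let i<v , v<j = interval-∈ p in
      ∈-∖x (∈-interval (ℕ.<⇒≤ i<v) v<j) λ v≡x → ℕ.<⇒≢ i<v (sym (trans (cong toℕ v≡x) (toℕ-vertex i<n))))

  vertex-∈ : ∀ {i j} (i<n : i ℕ.< n) → i ℕ.< j → vertex i<n ∈ interval i j
  vertex-∈ i<n i<j = ∈-interval (ℕ.≤-reflexive (sym (toℕ-vertex i<n))) (subst (ℕ._< _) (sym (toℕ-vertex i<n)) i<j)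

  interval-empty : ∀ {i} v → v ∉ interval i i
  interval-empty v = ¬∈⇒∉ λ p → let a , b = interval-∈ p in ℕ.<⇒≱ b a

  module Values (t : ℚ) where
    open Weighted E E-sym t public

    f-first : ∀ {i j} (i<n : i ℕ.< n) → i ℕ.< j →
      f (interval i j) ≡ f (interval (suc i) j) - t * f (interval (suc i) j ∖ E (vertex i<n))
    f-first {i} {j} i<n i<j = trans (f-remove (vertex-∈ i<n i<j)) (cong₂ (λ F G → F - t * G)
      (f-cong (interval-remove i<n))
      (f-cong (⊆-antisym (∖-mono (≗⇒⊆ (interval-remove i<n)) ⊆-refl) (∖-mono (≗⇒⊆ (sym ∘ interval-remove i<n)) ⊆-refl))))

module CycleStar (k : ℕ) where
  private
    n = 3 ℕ.+ k

  open StarGraph (D.cycle n)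

  private
    Next : ℕ → ℕ → Set
    Next a b = suc a ≡ b ⊎ (suc a ≡ n × b ≡ 0)

    toNext : ∀ v w → toℕ v ℕ.< n → toℕ w ℕ.< n → E v w ≡ true → Next (toℕ v) (toℕ w) ⊎ Next (toℕ w) (toℕ v)
    toNext v w v<n w<n e = subst₂ (λ a b → Next a b ⊎ Next b a) (Fin.toℕ-fromℕ< v<n) (Fin.toℕ-fromℕ< w<n)
      (proj₂ (true-adj (D.cycle n) (trans (sym (E-base v w v<n w<n)) e)))

    fromNext : ∀ v w → toℕ v ℕ.< n → toℕ w ℕ.< n → toℕ v ≢ toℕ w → Next (toℕ v) (toℕ w) ⊎ Next (toℕ w) (toℕ v) → E v w ≡ true
    fromNext v w v<n w<n v≢w h = trans (E-base v w v<n w<n) (adj-true (D.cycle n)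
      ((λ e → v≢w (trans (sym (Fin.toℕ-fromℕ< v<n)) (trans (cong toℕ e) (Fin.toℕ-fromℕ< w<n)))) ,
       subst₂ (λ a b → Next a b ⊎ Next b a) (sym (Fin.toℕ-fromℕ< v<n)) (sym (Fin.toℕ-fromℕ< w<n)) h))

  -- Since `0 < i`, the interval avoids the vertex 0 and with it the closing edge of the cycle, so
  -- it induces a path on `l` vertices.
  path-value : ∀ t l i → 0 ℕ.< i → i ℕ.+ l ℕ.≤ n → Values.f t (interval i (i ℕ.+ l)) ≡ P t (suc l)
  path-value t zero i 0<i i≤n rewrite ℕ.+-identityʳ i = Values.f-none t interval-empty
  path-value t (suc zero) i 0<i i+1≤n = trans (f-first i<n i<j)
    (cong₂ (λ F G → F - t * G) (f-none empty) (f-none (λ v → ∉-∖ˡ (empty v))))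
    where
    open Values t
    i<j : i ℕ.< i ℕ.+ 1
    i<j = ℕ.≤-reflexive (sym (ℕ.+-comm i 1))
    i<n : i ℕ.< n
    i<n = ℕ.≤-trans i<j i+1≤n
    empty : ∀ v → v ∉ interval (suc i) (i ℕ.+ 1)
    empty v = subst (λ j → v ∉ interval (suc i) j) (sym (ℕ.+-comm i 1)) (interval-empty v)
  path-value t (suc (suc l)) i 0<i i+l≤n = trans (f-first i<n i<j) (cong₂ (λ F G → F - t * G)
    (subst (λ j → f (interval (suc i) j) ≡ P t (2 ℕ.+ l)) (sym (ℕ.+-suc i (suc l)))
      (path-value t (suc l) (suc i) (ℕ.s≤s ℕ.z≤n) (subst (ℕ._≤ n) (ℕ.+-suc i (suc l)) i+l≤n)))
    (trans (f-cong rest) (path-value t l (2 ℕ.+ i) (ℕ.s≤s ℕ.z≤n) (subst (ℕ._≤ n) j≡ i+l≤n))))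
    where
    open Values t
    j≡ : i ℕ.+ (2 ℕ.+ l) ≡ 2 ℕ.+ i ℕ.+ l
    j≡ = trans (ℕ.+-suc i (suc l)) (cong suc (ℕ.+-suc i l))
    i<j : i ℕ.< i ℕ.+ (2 ℕ.+ l)
    i<j = subst (suc i ℕ.≤_) (sym j≡) (ℕ.s≤s (ℕ.≤-trans (ℕ.n≤1+n i) (ℕ.m≤m+n (suc i) l)))
    i<n : i ℕ.< n
    i<n = ℕ.≤-trans i<j i+l≤n
    x = vertex i<n
    x≡ : toℕ x ≡ i
    x≡ = toℕ-vertex i<n
    x<n : toℕ x ℕ.< n
    x<n = subst (ℕ._< n) (sym x≡) i<n
    rest : interval (suc i) (i ℕ.+ (2 ℕ.+ l)) ∖ E x ≗ interval (2 ℕ.+ i) (2 ℕ.+ i ℕ.+ l)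
    rest = ⊆-antisym
      (λ {w} p → let q , w∉ = ∖-∈ p ; i<w , w<j = interval-∈ q in
        ∈-interval (ℕ.≤∧≢⇒< i<w λ e → ∈-∉ (in! (fromNext x w x<n (ℕ.≤-trans w<j i+l≤n)
          (λ e′ → ℕ.<⇒≢ i<w (trans (sym x≡) e′)) (inj₁ (inj₁ (trans (cong suc x≡) e))))) w∉) (subst (toℕ w ℕ.<_) j≡ w<j))
      (λ {w} p → let 2+i≤w , w<j = interval-∈ p ; w<j′ = subst (toℕ w ℕ.<_) (sym j≡) w<j in
        ∈-∖ (∈-interval (ℕ.<⇒≤ 2+i≤w) w<j′)
            (out! (Bool.¬-not λ e → apart w 2+i≤w (toNext x w x<n (ℕ.≤-trans w<j′ i+l≤n) e))))
      where
      apart : ∀ w → 2 ℕ.+ i ℕ.≤ toℕ w → Next (toℕ x) (toℕ w) ⊎ Next (toℕ w) (toℕ x) → ⊥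
      apart w h (inj₁ (inj₁ e))       = ℕ.<⇒≢ h (trans (cong suc (sym x≡)) e)
      apart w h (inj₁ (inj₂ (_ , e))) = ℕ.<⇒≱ h (subst (ℕ._≤ suc i) (sym e) ℕ.z≤n)
      apart w h (inj₂ (inj₁ e))       = ℕ.<⇒≱ (ℕ.≤-trans (ℕ.n≤1+n _) h) (ℕ.≤-trans (ℕ.n≤1+n (toℕ w)) (ℕ.≤-reflexive (trans e x≡)))
      apart w h (inj₂ (inj₂ (_ , e))) = ℕ.<⇒≢ 0<i (trans (sym e) x≡)

  base-value : ∀ t → Values.f t (∁ (Starred.L starred)) ≡ C t n
  base-value t = trans (f-cong base-interval) (trans (f-first 0<n 0<n) (trans
    (cong₂ (λ F G → F - t * G) (path-value t (2 ℕ.+ k) 1 (ℕ.s≤s ℕ.z≤n) ℕ.≤-refl)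
      (trans (f-cong rest) (path-value t k 2 (ℕ.s≤s ℕ.z≤n) (ℕ.n≤1+n (2 ℕ.+ k)))))
    (sym (C-via-P t (suc k)))))
    where
    open Values t
    0<n : 0 ℕ.< n
    0<n = ℕ.s≤s ℕ.z≤n
    x = vertex 0<n
    x≡ : toℕ x ≡ 0
    x≡ = toℕ-vertex 0<n
    x<n : toℕ x ℕ.< n
    x<n = subst (ℕ._< n) (sym x≡) 0<n
    rest : interval 1 n ∖ E x ≗ interval 2 (2 ℕ.+ k)
    rest = ⊆-antisym
      (λ {w} p → let q , w∉ = ∖-∈ p ; 0<w , w<n = interval-∈ q
                     adjacent : Next (toℕ x) (toℕ w) ⊎ Next (toℕ w) (toℕ x) → ⊥
                     adjacent h = ∈-∉ (in! (fromNext x w x<n w<n (λ e → ℕ.<⇒≢ 0<w (trans (sym x≡) e)) h)) w∉ in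
        ∈-interval (ℕ.≤∧≢⇒< 0<w λ e → adjacent (inj₁ (inj₁ (trans (cong suc x≡) e))))
                   (ℕ.≤-pred (ℕ.≤∧≢⇒< w<n λ e → adjacent (inj₂ (inj₂ (e , x≡))))))
      (λ {w} p → let 2≤w , w<j = interval-∈ p ; w<n = ℕ.≤-trans w<j (ℕ.n≤1+n _) in
        ∈-∖ (∈-interval (ℕ.<⇒≤ 2≤w) w<n) (out! (Bool.¬-not λ e → apart w 2≤w w<j (toNext x w x<n w<n e))))
      where
      apart : ∀ w → 2 ℕ.≤ toℕ w → toℕ w ℕ.< 2 ℕ.+ k → Next (toℕ x) (toℕ w) ⊎ Next (toℕ w) (toℕ x) → ⊥
      apart w h h′ (inj₁ (inj₁ e))       = ℕ.<⇒≢ h (trans (cong suc (sym x≡)) e)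
      apart w h h′ (inj₁ (inj₂ (e , _))) = ℕ.0≢1+n (ℕ.suc-injective (trans (cong suc (sym x≡)) e))
      apart w h h′ (inj₂ (inj₁ e))       = ℕ.0≢1+n (sym (trans e x≡))
      apart w h h′ (inj₂ (inj₂ (e , _))) = ℕ.<⇒≢ h′ (ℕ.suc-injective e)

module UStar (k : ℕ) where
  private
    n = 3 ℕ.+ k

  open StarGraph (D.U n)
  open Starred starred using (E-irr)

  private
    Edge : ℕ → ℕ → Set
    Edge a b = a ≡ 0 ⊎ (a ≡ 1 × b ≡ 2)

    fromEdge : ∀ v w → toℕ v ℕ.< n → toℕ w ℕ.< n → toℕ v ≢ toℕ w → Edge (toℕ v) (toℕ w) → E v w ≡ true
    fromEdge v w v<n w<n v≢w h = trans (E-base v w v<n w<n) (adj-true (D.U n)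
      ((λ e → v≢w (trans (sym (Fin.toℕ-fromℕ< v<n)) (trans (cong toℕ e) (Fin.toℕ-fromℕ< w<n)))) ,
       inj₁ (subst₂ Edge (sym (Fin.toℕ-fromℕ< v<n)) (sym (Fin.toℕ-fromℕ< w<n)) h)))

    vertex<n : ∀ {i} (i<n : i ℕ.< n) → toℕ (vertex i<n) ℕ.< n
    vertex<n i<n = subst (ℕ._< n) (sym (toℕ-vertex i<n)) i<n

  module _ (t : ℚ) (0≤t : 0ℚ ≤ t) (pos : Weighted.Pos E E-sym t (∁ L)) where
    open Values t

    private
      0<n : 0 ℕ.< n
      0<n = ℕ.s≤s ℕ.z≤n
      1<n : 1 ℕ.< n
      1<n = ℕ.s≤s (ℕ.s≤s ℕ.z≤n)
      2<n : 2 ℕ.< n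
      2<n = ℕ.s≤s (ℕ.s≤s (ℕ.s≤s ℕ.z≤n))
      x₀ = vertex 0<n
      x₁ = vertex 1<n
      x₂ = vertex 2<n

      base : interval 0 n ⊆ ∁ L
      base = ≗⇒⊆ (sym ∘ base-interval)

      x₀∈ : x₀ ∈ ∁ L
      x₀∈ = base (vertex-∈ 0<n 0<n)

    1-t-pos : 0ℚ < 1ℚ - t
    1-t-pos = subst (0ℚ <_) (trans (f-remove (∈-⁅⁆ x₀)) (trans
        (cong₂ (λ F G → F - t * G) (f-none none) (f-none (λ v → ∉-∖ˡ (none v)))) (eq t)))
      (pos ⁅ x₀ ⁆ λ v∈ → subst (_∈ ∁ L) (sym (⁅⁆-∈ v∈)) x₀∈)
      where
      none : ∀ v → v ∉ ⁅ x₀ ⁆ ∖ ⁅ x₀ ⁆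
      none v = ¬∈⇒∉ λ p → ∈-∉ (∖-⊆ p) (proj₂ (∖-∈ p))
      eq : ∀ t → 1ℚ - t * 1ℚ ≡ 1ℚ - t
      eq = solve-∀ ℚ-ring

    private
      rest : interval 1 n ⊆ ∁ L
      rest p = base (∈-interval ℕ.z≤n (proj₂ (interval-∈ p)))

      alone : ∀ w → w ∉ interval 1 n ∖ E x₀
      alone w = ¬∈⇒∉ λ p → let q , w∉ = ∖-∈ p ; 0<w , w<n = interval-∈ q in
        ∈-∉ (in! (fromEdge x₀ w (vertex<n 0<n) w<n (λ e → ℕ.<⇒≢ 0<w (trans (sym (toℕ-vertex 0<n)) e)) (inj₁ (toℕ-vertex 0<n)))) w∉

      card-rest : card (interval 1 n) ≡ 2 ℕ.+ k
      card-rest = ℕ.suc-injective (trans (sym (trans (card-remove (interval 0 n) x₀ (vertex-∈ 0<n 0<n))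
        (cong suc (card-cong (interval-remove 0<n))))) (trans (card-cong (sym ∘ base-interval)) (proj₂ (Starred.card-half starred refl))))

      x₁∈ : x₁ ∈ interval 1 n
      x₁∈ = vertex-∈ 1<n 1<n

      x₂∈ : x₂ ∈ interval 1 n
      x₂∈ = ∈-interval (subst (1 ℕ.≤_) (sym (toℕ-vertex 2<n)) (ℕ.s≤s ℕ.z≤n)) (vertex<n 2<n)

      1≢2 : toℕ x₁ ≢ toℕ x₂
      1≢2 e = ℕ.0≢1+n (ℕ.suc-injective (trans (sym (toℕ-vertex 1<n)) (trans e (toℕ-vertex 2<n))))

    -- The centre of `U` is adjacent to every other base vertex, so the subtracted term at the
    -- centre is `t`. The other base vertices contain the edge 12, and `f-edge-bound` applies to
    -- them.
    base-bound : f (∁ L) ≤ U-poly t k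
    base-bound = subst (_≤ U-poly t k) (sym (trans (f-cong base-interval) (f-first 0<n 0<n)))
      (≤-via ((1ℚ - t) ^ k * (1ℚ - (t + t)) - f (interval 1 n))
        (≤⇒0≤ (LowerBound.f-edge-bound E E-sym E-irr t 0≤t 1-t-pos k (λ S S⊆ → pos S (⊆-trans S⊆ rest)) card-rest x₁∈ x₂∈
          (λ e → 1≢2 (cong toℕ e)) (fromEdge x₁ x₂ (vertex<n 1<n) (vertex<n 2<n) 1≢2 (inj₂ (toℕ-vertex 1<n , toℕ-vertex 2<n)))))
        (trans (eq ((1ℚ - t) ^ k * (1ℚ - (t + t))) t (f (interval 1 n)))
          (cong (λ G → (f (interval 1 n) - t * G) + ((1ℚ - t) ^ k * (1ℚ - (t + t)) - f (interval 1 n))) (sym (f-none alone)))))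
      where
      eq : ∀ X t F → X - t ≡ (F - t * 1ℚ) + (X - F)
      eq = solve-∀ ℚ-ring

-- Cycles of unicyclic graphs

search : ∀ {n} {A B : Fin n → Set} → (∀ i → A i ⊎ B i) → ∃ A ⊎ (∀ i → B i)
search {zero}  h = inj₂ λ ()
search {suc n} h with h zero | search (h ∘ suc)
... | inj₁ a | _            = inj₁ (zero , a)
... | inj₂ _ | inj₁ (i , a) = inj₁ (suc i , a)
... | inj₂ b | inj₂ bs      = inj₂ λ { zero → b ; (suc i) → bs i }

module SimplePaths {N} (G : Graph N) where
  private
    E = adj G
  open Connectivity E (adj-sym G)

  -- Simple S y x vs: the vertices x ∷ vs form a path in S that ends at y.
  data Simple (S : Sub N) (y : Fin N) : ∀ {l} → Fin N → Vec (Fin N) l → Set where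
    end  : y ∈ S → Simple S y y []
    step : ∀ {l x z} {vs : Vec (Fin N) l} → x ∈ S → E x z ≡ true → (∀ i → Vec.lookup (z ∷ vs) i ≢ x) →
           Simple S y z vs → Simple S y x (z ∷ vs)

  Simple-⊆ : ∀ {S T y x l} {vs : Vec (Fin N) l} → S ⊆ T → Simple S y x vs → Simple T y x vs
  Simple-⊆ S⊆T (end y∈S)            = end (S⊆T y∈S)
  Simple-⊆ S⊆T (step x∈S e fresh p) = step (S⊆T x∈S) e fresh (Simple-⊆ S⊆T p)

  Simple-∈ : ∀ {S y x l} {vs : Vec (Fin N) l} → Simple S y x vs → ∀ i → Vec.lookup (x ∷ vs) i ∈ S
  Simple-∈ (end y∈S)        zero    = y∈S
  Simple-∈ (step x∈S _ _ p) zero    = x∈S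
  Simple-∈ (step _ _ _ p)   (suc i) = Simple-∈ p i

  lookup-injective : ∀ {x l} {vs : Vec (Fin N) l} → (∀ i → Vec.lookup vs i ≢ x) →
    (∀ {i j} → Vec.lookup vs i ≡ Vec.lookup vs j → i ≡ j) →
    ∀ {i j} → Vec.lookup (x ∷ vs) i ≡ Vec.lookup (x ∷ vs) j → i ≡ j
  lookup-injective fresh inj {zero}  {zero}  e = refl
  lookup-injective fresh inj {zero}  {suc j} e = ⊥-elim (fresh j (sym e))
  lookup-injective fresh inj {suc i} {zero}  e = ⊥-elim (fresh i e)
  lookup-injective fresh inj {suc i} {suc j} e = cong suc (inj e)

  Simple-injective : ∀ {S y x l} {vs : Vec (Fin N) l} → Simple S y x vs →
    ∀ {i j} → Vec.lookup (x ∷ vs) i ≡ Vec.lookup (x ∷ vs) j → i ≡ j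
  Simple-injective (end _) {zero} {zero} e = refl
  Simple-injective (step _ _ fresh p) e = lookup-injective fresh (Simple-injective p) e

  Simple-edge : ∀ {S y x l} {vs : Vec (Fin N) l} → Simple S y x vs → ∀ i j → suc (toℕ i) ≡ toℕ j →
    E (Vec.lookup (x ∷ vs) i) (Vec.lookup (x ∷ vs) j) ≡ true
  Simple-edge (step _ e _ _) zero    (suc zero) _ = e
  Simple-edge (step _ _ _ p) (suc i) (suc j)    h = Simple-edge p i j (ℕ.suc-injective h)

  Simple-last : ∀ {S y x l} {vs : Vec (Fin N) l} → Simple S y x vs → ∀ i → toℕ i ≡ l → Vec.lookup (x ∷ vs) i ≡ y
  Simple-last (end _)        zero    _ = refl
  Simple-last (step _ _ _ p) (suc i) h = Simple-last p i (ℕ.suc-injective h)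

  -- Here reachability by cuts becomes an actual path, because a `Cycle` needs its vertices in
  -- order. While the component of `y` is exhausted, each new vertex is put in front of the path
  -- from its neighbour; being new, it keeps the path simple.
  connect : ∀ {S y x} → y ∈ S → Linked S y x → ∃ λ l → ∃ λ (vs : Vec (Fin N) l) → Simple S y x vs
  connect {S} {y} {x} y∈S linked with component y∈S
  ... | A , y∈A , A⊆S , closed , connA =
    let l , vs , p = grow Reached Reached-cong connA extend (∈-⁅⁆ y)
                       (λ v∈ → subst (_∈ A) (sym (⁅⁆-∈ v∈)) y∈A) base (linked A closed y∈A)
    in l , vs , Simple-⊆ A⊆S p
    where
    Reached : Sub N → Set
    Reached T = ∀ {v} → v ∈ T → ∃ λ l → ∃ λ (vs : Vec (Fin N) l) → Simple T y v vs
    Reached-cong : ∀ {T T′} → T ≗ T′ → Reached T → Reached T′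
    Reached-cong T≗ h v∈ = let l , vs , p = h (≗⇒⊆ (sym ∘ T≗) v∈) in l , vs , Simple-⊆ (≗⇒⊆ T≗) p
    base : Reached ⁅ y ⁆
    base v∈ with ⁅⁆-∈ v∈
    ... | refl = 0 , [] , end (∈-⁅⁆ y)
    extend : ∀ {T a b} → T ⊆ A → y ∈ T → a ∈ T → b ∈ A → b ∉ T → E a b ≡ true → Reached T → Reached (T ∪ ⁅ b ⁆)
    extend {T} {a} {b} _ _ a∈T _ b∉T e h v∈ with ∪-∈ v∈
    ... | inj₁ v∈T = let l , vs , p = h v∈T in l , vs , Simple-⊆ ∈-∪ˡ p
    ... | inj₂ v∈b with ⁅⁆-∈ v∈b
    ... | refl = let l , vs , p = h a∈T in suc l , a ∷ vs , step (∈-∪ʳ v∈b) (flip e)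
                   (λ i → ∈-∉-≢ (Simple-∈ p i) b∉T) (Simple-⊆ ∈-∪ˡ p)

  -- A vertex outside `S` joined to both ends of a path in `S` closes a cycle. As `x` and `y`
  -- differ, the path has at least two vertices and the cycle at least three.
  close : ∀ {S w x y} → y ∈ S → w ∉ S → x ≢ y → Linked S y x → E w x ≡ true → E w y ≡ true →
    ∃ λ (d : Cycle G) → Cycle.HasEdge d w x × Cycle.HasEdge d w y
  close {S} {w} {x} {y} y∈S w∉S x≢y linked ex ey with connect y∈S linked
  ... | .0     , []     , end _ = ⊥-elim (x≢y refl)
  ... | suc l , z ∷ vs , p = d , (zero , suc zero , ((λ ()) , inj₁ (inj₁ refl)) , refl , refl) ,
        (zero , Fin.fromℕ (2 ℕ.+ l) , ((λ ()) , inj₂ (inj₂ (cong suc (Fin.toℕ-fromℕ (2 ℕ.+ l)) , refl))) , refl ,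
          Simple-last p (Fin.fromℕ (suc l)) (Fin.toℕ-fromℕ (suc l)))
    where
    vertices : Vec (Fin N) (3 ℕ.+ l)
    vertices = w ∷ x ∷ z ∷ vs
    fresh : ∀ i → Vec.lookup (x ∷ z ∷ vs) i ≢ w
    fresh i = ∈-∉-≢ (Simple-∈ p i) w∉S
    edge : ∀ i j → suc (toℕ i) ≡ toℕ j ⊎ (suc (toℕ i) ≡ 3 ℕ.+ l × toℕ j ≡ 0) →
      E (Vec.lookup vertices i) (Vec.lookup vertices j) ≡ true
    edge zero    (suc zero) (inj₁ _)        = ex
    edge (suc i) (suc j)    (inj₁ h)        = Simple-edge p i j (ℕ.suc-injective h)
    edge (suc i) zero       (inj₂ (h , _))  = subst (λ v → E v w ≡ true)
      (sym (Simple-last p i (ℕ.suc-injective (ℕ.suc-injective h)))) (flip ey)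
    d : Cycle G
    d = record
      { len       = 3 ℕ.+ l
      ; 3≤len     = ℕ.s≤s (ℕ.s≤s (ℕ.s≤s ℕ.z≤n))
      ; vertex    = Vec.lookup vertices
      ; injective = lookup-injective fresh (Simple-injective p)
      ; adjacent  = λ { {i} {j} (_ , inj₁ h) → true-adj G (edge i j h)
                      ; {i} {j} (_ , inj₂ h) → true-adj G (flip (edge j i h)) }
      }

image : ∀ {l n} → (Fin l → Fin n) → Sub n
image {zero}  g v = false
image {suc l} g   = image (g ∘ suc) ∪ ⁅ g zero ⁆

image-∈ : ∀ {l n} (g : Fin l → Fin n) i → g i ∈ image g
image-∈ g zero    = ∈-∪ʳ (∈-⁅⁆ (g zero))
image-∈ g (suc i) = ∈-∪ˡ (image-∈ (g ∘ suc) i)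

∈-image : ∀ {l n} (g : Fin l → Fin n) {v} → v ∈ image g → ∃ λ i → g i ≡ v
∈-image {zero}  g (in! ())
∈-image {suc l} g v∈ with ∪-∈ v∈
... | inj₁ p = let i , e = ∈-image (g ∘ suc) p in suc i , e
... | inj₂ p = zero , sym (⁅⁆-∈ p)

card-image : ∀ {l n} (g : Fin l → Fin n) → (∀ {i j} → g i ≡ g j → i ≡ j) → card (image g) ≡ l
card-image {zero}  g inj = card-none λ v → out! refl
card-image {suc l} g inj = trans
  (card-insert (image (g ∘ suc)) (g zero) (¬∈⇒∉ λ p → let i , e = ∈-image (g ∘ suc) p in Fin.0≢1+n (sym (inj e))))
  (cong suc (card-image (g ∘ suc) (Fin.suc-injective ∘ inj)))

module TheCycle {N} (G : Graph N) (cyc : Cycle G) where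
  open Cycle cyc using (len; 3≤len; vertex; injective; adjacent; HasEdge) public
  private
    E = adj G
  open Connectivity E (adj-sym G)

  Next : Fin len → Fin len → Set
  Next i j = suc (toℕ i) ≡ toℕ j ⊎ (suc (toℕ i) ≡ len × toℕ j ≡ 0)

  private
    0<len : 0 ℕ.< len
    0<len = ℕ.≤-trans (ℕ.s≤s ℕ.z≤n) 3≤len

    next : ∀ i → ∃ (Next i)
    next i with suc (toℕ i) ℕ.<? len
    ... | yes p = Fin.fromℕ< p , inj₁ (sym (Fin.toℕ-fromℕ< p))
    ... | no ¬p = Fin.fromℕ< 0<len , inj₂ (ℕ.≤-antisym (Fin.toℕ<n i) (ℕ.≮⇒≥ ¬p) , Fin.toℕ-fromℕ< 0<len)

    prev : ∀ i → ∃ λ j → Next j i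
    prev i with toℕ i in eq
    ... | zero  = Fin.fromℕ< (ℕ.≤-reflexive last) , inj₂ (trans (cong suc (Fin.toℕ-fromℕ< (ℕ.≤-reflexive last))) last , refl)
      where
      last : suc (ℕ.pred len) ≡ len
      last = ℕ.suc-pred len {{ℕ.>-nonZero 0<len}}
    ... | suc k = Fin.fromℕ< k<len , inj₁ (cong suc (Fin.toℕ-fromℕ< k<len))
      where
      k<len : k ℕ.< len
      k<len = ℕ.<-trans (ℕ.n<1+n k) (subst (ℕ._< len) eq (Fin.toℕ<n i))

  Next-unique : ∀ {i j k} → Next i j → Next i k → j ≡ k
  Next-unique (inj₁ p)       (inj₁ q)       = Fin.toℕ-injective (trans (sym p) q)
  Next-unique {j = j} (inj₁ p) (inj₂ (q , _)) = ⊥-elim (ℕ.<⇒≢ (Fin.toℕ<n j) (trans (sym p) q))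
  Next-unique {k = k} (inj₂ (p , _)) (inj₁ q) = ⊥-elim (ℕ.<⇒≢ (Fin.toℕ<n k) (trans (sym q) p))
  Next-unique (inj₂ (_ , p)) (inj₂ (_ , q)) = Fin.toℕ-injective (trans p (sym q))

  Prev-unique : ∀ {i j k} → Next j i → Next k i → j ≡ k
  Prev-unique (inj₁ p)       (inj₁ q)       = Fin.toℕ-injective (ℕ.suc-injective (trans p (sym q)))
  Prev-unique (inj₁ p)       (inj₂ (_ , q)) = ⊥-elim (ℕ.0≢1+n (trans (sym q) (sym p)))
  Prev-unique (inj₂ (_ , p)) (inj₁ q)       = ⊥-elim (ℕ.0≢1+n (trans (sym p) (sym q)))
  Prev-unique (inj₂ (p , _)) (inj₂ (q , _)) = Fin.toℕ-injective (ℕ.suc-injective (trans p (sym q)))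

  Next-≢ : ∀ {i j} → Next i j → i ≢ j
  Next-≢ (inj₁ p)       refl = ℕ.1+n≢n p
  Next-≢ (inj₂ (p , q)) refl = ℕ.<⇒≢ (ℕ.≤-trans (ℕ.s≤s (ℕ.s≤s ℕ.z≤n)) 3≤len) (trans (cong suc (sym q)) p)

  next≢prev : ∀ {i j k} → Next j i → Next i k → j ≢ k
  next≢prev {i} {j} (inj₁ p) (inj₁ q) refl = ℕ.<⇒≢ (ℕ.≤-trans (ℕ.n<1+n (toℕ j)) (ℕ.≤-trans (ℕ.n≤1+n _) (ℕ.≤-refl))) (sym (trans (cong suc p) q))
  next≢prev (inj₁ p) (inj₂ (q , r)) refl = ℕ.<⇒≢ 3≤len (trans (cong (2 ℕ.+_) (sym r)) (trans (cong suc p) q))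
  next≢prev (inj₂ (p , r)) (inj₁ q) refl = ℕ.<⇒≢ 3≤len (trans (trans (cong (2 ℕ.+_) (sym r)) (cong suc q)) p)
  next≢prev (inj₂ (p , r)) (inj₂ (q , s)) refl = ℕ.<⇒≢ (ℕ.≤-trans (ℕ.s≤s (ℕ.s≤s ℕ.z≤n)) 3≤len) (trans (cong suc (sym s)) p)

  Next-edge : ∀ {i j} → Next i j → E (vertex i) (vertex j) ≡ true
  Next-edge h = adj-true G (adjacent (Next-≢ h , inj₁ h))

  K : Sub N
  K = image vertex

  HasEdge-∈ : ∀ {u v} → HasEdge u v → u ∈ K × v ∈ K
  HasEdge-∈ (i , j , _ , refl , refl) = image-∈ vertex i , image-∈ vertex j

  HasEdge-two : ∀ {u x y z} → HasEdge u x → HasEdge u y → x ≢ y → HasEdge u z → z ≡ x ⊎ z ≡ y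
  HasEdge-two (i , j , (_ , a) , refl , refl) (i′ , j′ , (_ , a′) , e′ , refl) x≢y (i″ , j″ , (_ , a″) , e″ , refl)
    with injective e′ | injective e″
  ... | refl | refl with a | a′ | a″
  ... | inj₁ p | inj₁ q | _      = ⊥-elim (x≢y (cong vertex (Next-unique p q)))
  ... | inj₂ p | inj₂ q | _      = ⊥-elim (x≢y (cong vertex (Prev-unique p q)))
  ... | inj₁ p | inj₂ q | inj₁ r = inj₁ (cong vertex (Next-unique r p))
  ... | inj₁ p | inj₂ q | inj₂ r = inj₂ (cong vertex (Prev-unique r q))
  ... | inj₂ p | inj₁ q | inj₁ r = inj₂ (cong vertex (Next-unique r q))
  ... | inj₂ p | inj₁ q | inj₂ r = inj₁ (cong vertex (Prev-unique r p))

  -- Walking forward from j, one meets the predecessor p of i before i.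
  module Forward {i p : Fin len} (p→i : Next p i) {A : Sub N} (closed : Closed (K ∖ ⁅ vertex i ⁆) A) where

    advance : ∀ {j k} → Next j k → k ≢ i → vertex j ∈ A → vertex k ∈ A
    advance {k = k} j→k k≢i j∈A = closed j∈A (∈-∖x (image-∈ vertex k) (k≢i ∘ injective)) (Next-edge j→k)

    arrive : ∀ {j} → Next j i → vertex j ∈ A → vertex p ∈ A
    arrive j→i j∈A = subst (λ z → vertex z ∈ A) (Prev-unique j→i p→i) j∈A

    below : ∀ m j → toℕ j ℕ.< toℕ i → toℕ i ℕ.≤ m ℕ.+ toℕ j → vertex j ∈ A → vertex p ∈ A
    below zero    j j<i i≤ j∈A = ⊥-elim (ℕ.<⇒≱ j<i i≤)
    below (suc m) j j<i i≤ j∈A with next j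
    ... | k , inj₂ (q , _) = ⊥-elim (ℕ.<⇒≢ (ℕ.<-≤-trans (ℕ.s≤s j<i) (Fin.toℕ<n i)) q)
    ... | k , inj₁ q with k Fin.≟ i
    ... | yes refl = arrive (inj₁ q) j∈A
    ... | no k≢i   = below m k (ℕ.≤∧≢⇒< (subst (ℕ._≤ toℕ i) q j<i) (k≢i ∘ Fin.toℕ-injective))
      (subst (toℕ i ℕ.≤_) (trans (sym (ℕ.+-suc m (toℕ j))) (cong (m ℕ.+_) q)) i≤) (advance (inj₁ q) k≢i j∈A)

    above : ∀ m j → toℕ i ℕ.< toℕ j → len ℕ.≤ m ℕ.+ toℕ j → vertex j ∈ A → vertex p ∈ A
    above zero    j i<j len≤ j∈A = ⊥-elim (ℕ.<⇒≱ (Fin.toℕ<n j) len≤)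
    above (suc m) j i<j len≤ j∈A with next j
    ... | k , inj₁ q = above m k (ℕ.<-trans i<j (ℕ.≤-reflexive q))
      (subst (len ℕ.≤_) (trans (sym (ℕ.+-suc m (toℕ j))) (cong (m ℕ.+_) q)) len≤)
      (advance (inj₁ q) (λ e → ℕ.<⇒≢ (ℕ.<-trans i<j (ℕ.≤-reflexive q)) (cong toℕ (sym e))) j∈A)
    ... | k , inj₂ (q , r) with k Fin.≟ i
    ... | yes refl = arrive (inj₂ (q , r)) j∈A
    ... | no k≢i   = below (toℕ i) k (ℕ.≤∧≢⇒< (subst (ℕ._≤ toℕ i) (sym r) ℕ.z≤n) (k≢i ∘ Fin.toℕ-injective))
      (ℕ.m≤m+n (toℕ i) (toℕ k)) (advance (inj₂ (q , r)) k≢i j∈A)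

    reach : ∀ j → j ≢ i → vertex j ∈ A → vertex p ∈ A
    reach j j≢i = Sum.[ (λ j≤i → below (toℕ i) j (ℕ.≤∧≢⇒< j≤i (j≢i ∘ Fin.toℕ-injective)) (ℕ.m≤m+n (toℕ i) (toℕ j))) ,
                        (λ i≤j → above len j (ℕ.≤∧≢⇒< i≤j (j≢i ∘ sym ∘ Fin.toℕ-injective)) (ℕ.m≤m+n len (toℕ j))) ]′
                      (ℕ.≤-total (toℕ j) (toℕ i))

  around : ∀ {x} → x ∈ K → ∃ λ y → ∃ λ z → y ∈ K ∖ ⁅ x ⁆ × z ∈ K ∖ ⁅ x ⁆ × y ≢ z × E x y ≡ true × E x z ≡ true ×
    (∀ {v} → v ∈ K ∖ ⁅ x ⁆ → Linked (K ∖ ⁅ x ⁆) v y)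
  around x∈K with ∈-image vertex x∈K
  ... | i , refl with prev i | next i
  ... | p , p→i | s , i→s = vertex p , vertex s ,
    ∈-∖x (image-∈ vertex p) (Next-≢ p→i ∘ injective) , ∈-∖x (image-∈ vertex s) (Next-≢ i→s ∘ sym ∘ injective) ,
    next≢prev p→i i→s ∘ injective , flip (Next-edge p→i) , Next-edge i→s , linked
    where
    linked : ∀ {v} → v ∈ K ∖ ⁅ vertex i ⁆ → Linked (K ∖ ⁅ vertex i ⁆) v (vertex p)
    linked v∈ A closed v∈A with ∈-image vertex (∖-⊆ v∈)
    ... | j , refl = Forward.reach p→i closed j (λ { refl → proj₂ (∖x-∈ v∈) refl }) v∈A

  cycleSet : ∀ {c} → c ∈ K → CycleSet K c
  cycleSet {c} c∈K = record { root = c∈K ; joined = joined ; around = around }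
    where
    joined : ∀ {v} → v ∈ K → Linked K c v
    joined {v} v∈K = Linked-sym v∈K to-c
      where
      to-c : Linked K v c
      to-c A closed v∈A with v Fin.≟ c | around c∈K
      ... | yes refl | _ = v∈A
      ... | no v≢c   | y , _ , _ , _ , _ , ey , _ , linked =
        closed (linked (∈-∖x v∈K v≢c) A (Closed-⊆ ∖-⊆ closed) v∈A) c∈K (flip ey)

module UnicyclicGraph {N} (G : Graph N) (connected : Connected G) (unicyclic : Unicyclic G) where
  E = adj G
  E-sym = adj-sym G
  E-irr = adj-irr G
  open Connectivity E E-sym public
  open SimplePaths G public
  open TheCycle G (proj₁ unicyclic) public

  edge-≢ : ∀ {u v} → E u v ≡ true → u ≢ v
  edge-≢ {u} e refl with trans (sym e) (E-irr u)
  ... | ()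

  Conn-full : ∀ r → Conn ⁅ r ⁆ full
  Conn-full r {A} {u} _ u∈A avoid = go (proj₂ connected u r) u∈A
    where
    go : ∀ {u} → Star (Graph._~_ G) u r → u ∈ A → ∃ λ a → ∃ λ b → a ∈ A × b ∈ full × b ∉ A × E a b ≡ true
    go Star.ε u∈A = ∈-∉ (∈-⁅⁆ r) (avoid u∈A)
    go {u} (_◅_ {j = w} u~w path) u∈A with ∈? A w
    ... | inj₁ w∈A = go path w∈A
    ... | inj₂ w∉A = u , w , u∈A , ∈-full , w∉A , adj-true G u~w

  -- The form in which uniqueness of the cycle is used: any cycle that can be closed at `w` has the
  -- edges of the given one.
  closing : ∀ {S w x y} → y ∈ S → w ∉ S → x ≢ y → Linked S y x → E w x ≡ true → E w y ≡ true →
    HasEdge w x × HasEdge w y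
  closing {S} {w} {x} {y} y∈S w∉S x≢y linked ex ey with close y∈S w∉S x≢y linked ex ey
  ... | d , hx , hy = Equivalence.from (proj₂ unicyclic d w x) hx , Equivalence.from (proj₂ unicyclic d w y) hy

  -- A chord at `a` and an edge of the cycle at `a` end at two vertices that are linked by the cycle
  -- without `a`. They lie on a common cycle, which by uniqueness is the given one.
  chordless : ∀ {a b} → a ∈ K → b ∈ K → E a b ≡ true → HasEdge a b
  chordless {a} {b} a∈K b∈K e with around a∈K
  ... | y , z , y∈ , z∈ , y≢z , ey , ez , linked with b Fin.≟ y
  ... | yes refl = proj₂ (closing y∈ (∉-∖ʳ (∈-⁅⁆ a)) (y≢z ∘ sym) (Linked-sym z∈ (linked z∈)) ez e)
  ... | no b≢y   = proj₁ (closing y∈ (∉-∖ʳ (∈-⁅⁆ a)) b≢y (Linked-sym b∈ (linked b∈)) e ey)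
    where
    b∈ : b ∈ K ∖ ⁅ a ⁆
    b∈ = ∈-∖x b∈K (edge-≢ e ∘ sym)

  TwoNeighbours : Sub N → Fin N → Set
  TwoNeighbours S u = ∃ λ x → ∃ λ y → x ∈ S × y ∈ S × x ≢ y × E u x ≡ true × E u y ≡ true

  degree? : ∀ S u → AtMostOne S u ⊎ TwoNeighbours S u
  degree? S u with some? (S ∩ E u)
  ... | inj₂ none = inj₁ λ {x} x∈S _ ex _ → ∈-∉ (∈-∩ x∈S (in! ex)) (none x)
  ... | inj₁ (x , x∈) with some? ((S ∩ E u) ∖ ⁅ x ⁆)
  ... | inj₁ (y , y∈) = let p , y≢x = ∖x-∈ y∈ in
    inj₂ (x , y , ∩-⊆ˡ x∈ , ∩-⊆ˡ p , y≢x ∘ sym , holds (proj₂ (∩-∈ x∈)) , holds (proj₂ (∩-∈ p)))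
  ... | inj₂ none = inj₁ λ y∈S z∈S ey ez → trans (only y∈S ey) (sym (only z∈S ez))
    where
    only : ∀ {y} → y ∈ S → E u y ≡ true → y ≡ x
    only {y} y∈S ey with y Fin.≟ x
    ... | yes e  = e
    ... | no y≢x = ∈-∉ (∈-∖x (∈-∩ y∈S (in! ey)) y≢x) (none y)

  root : Fin N
  root = vertex (Fin.fromℕ< (ℕ.≤-trans (ℕ.s≤s ℕ.z≤n) 3≤len))

  root∈K : root ∈ K
  root∈K = image-∈ vertex _

  -- The graph is built up from `K`, one vertex at a time. If the new vertex `b` were in `S`, two
  -- neighbours of it would already be in the connected part `T`, so `b` would close a cycle and
  -- belong to `K`, hence to `T`.
  min-degree-two-⊆ : ∀ {S} → (∀ {u} → u ∈ S → TwoNeighbours S u) → S ⊆ K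
  min-degree-two-⊆ {S} two = proj₂ (proj₂ (grow Inside Inside-cong (Conn-full root) extend root∈K (λ _ → ∈-full) base)) S two (λ _ → ∈-full)
    where
    Inside : Sub N → Set
    Inside T = Conn ⁅ root ⁆ T × K ⊆ T × (∀ S → (∀ {u} → u ∈ S → TwoNeighbours S u) → S ⊆ T → S ⊆ K)
    Inside-cong : ∀ {T T′} → T ≗ T′ → Inside T → Inside T′
    Inside-cong T≗ (conn , K⊆T , h) = Conn-cong T≗ conn , ⊆-trans K⊆T (≗⇒⊆ T≗) ,
      λ S two S⊆ → h S two (⊆-trans S⊆ (≗⇒⊆ (sym ∘ T≗)))
    base : Inside K
    base = Linked⇒Conn (λ v∈K → Linked-sym root∈K (CycleSet.joined (cycleSet root∈K) v∈K)) , ⊆-refl , λ _ _ S⊆K → S⊆K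
    extend : ∀ {T a b} → T ⊆ full → root ∈ T → a ∈ T → b ∈ full → b ∉ T → E a b ≡ true → Inside T → Inside (T ∪ ⁅ b ⁆)
    extend {T} {a} {b} _ r∈T a∈T _ b∉T e (conn , K⊆T , h) = Conn-grow conn a∈T b∉T e , (λ v∈K → ∈-∪ˡ (K⊆T v∈K)) , λ S two S⊆ →
      h S two λ {v} v∈S → Sum.[ id , (λ v∈b → ⊥-elim (absurd S two S⊆ (subst (_∈ S) (⁅⁆-∈ v∈b) v∈S))) ]′ (∪-∈ (S⊆ v∈S))
      where
      absurd : ∀ S → (∀ {u} → u ∈ S → TwoNeighbours S u) → S ⊆ T ∪ ⁅ b ⁆ → b ∈ S → ⊥
      absurd S two S⊆ b∈S with two b∈S
      ... | x , y , x∈S , y∈S , x≢y , ex , ey =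
        ∈-∉ (K⊆T (proj₁ (HasEdge-∈ (proj₁ (closing y∈T b∉T x≢y linked ex ey))))) b∉T
        where
        inT : ∀ {z} → z ∈ S → E b z ≡ true → z ∈ T
        inT z∈S ez = Sum.[ id , (λ z∈b → ⊥-elim (edge-≢ ez (sym (⁅⁆-∈ z∈b)))) ]′ (∪-∈ (S⊆ z∈S))
        x∈T : x ∈ T
        x∈T = inT x∈S ex
        y∈T : y ∈ T
        y∈T = inT y∈S ey
        linked : Linked T y x
        linked A closed y∈A = Linked-sym x∈T (Conn⇒Linked conn x∈T) A closed (Conn⇒Linked conn y∈T A closed y∈A)

  -- Inside the chordless cycle a vertex has only two neighbours, so a vertex of `S` has both of
  -- them in `S`. Thus `S` is closed in `K` and, being nonempty, is all of it.
  min-degree-two : ∀ {S v} → v ∈ S → (∀ {u} → u ∈ S → TwoNeighbours S u) → S ≗ K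
  min-degree-two {S} {v} v∈S two = ⊆-antisym S⊆K λ u∈K →
    CycleSet.joined (cycleSet v∈K) u∈K S closed v∈S
    where
    S⊆K : S ⊆ K
    S⊆K = min-degree-two-⊆ two
    v∈K : v ∈ K
    v∈K = S⊆K v∈S
    closed : Closed K S
    closed a∈S b∈K e with two a∈S
    ... | x , y , x∈S , y∈S , x≢y , ex , ey with HasEdge-two (chordless (S⊆K a∈S) (S⊆K x∈S) ex)
                                                  (chordless (S⊆K a∈S) (S⊆K y∈S) ey) x≢y (chordless (S⊆K a∈S) b∈K e)
    ... | inj₁ refl = x∈S
    ... | inj₂ refl = y∈S

  low-degree : ∀ {S v} → v ∈ S → (∃ λ u → u ∈ S × AtMostOne S u) ⊎ S ≗ K
  low-degree {S} v∈S with search (λ u → choose u)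
    where
    choose : ∀ u → (u ∈ S × AtMostOne S u) ⊎ (u ∈ S → TwoNeighbours S u)
    choose u with ∈? S u | degree? S u
    ... | inj₂ u∉S | _        = inj₂ λ u∈S → ∈-∉ u∈S u∉S
    ... | inj₁ u∈S | inj₁ one = inj₁ (u∈S , one)
    ... | inj₁ _   | inj₂ two = inj₂ λ _ → two
  ... | inj₁ found = inj₁ found
  ... | inj₂ two   = inj₂ (min-degree-two v∈S (λ {u} → two u))

  forest : ∀ {c} → c ∈ K → Forest (full ∖ ⁅ c ⁆)
  forest c∈K S⊆ v∈S with low-degree v∈S
  ... | inj₁ found = found
  ... | inj₂ S≗K   = ⊥-elim (proj₂ (∖x-∈ (S⊆ (≗⇒⊆ (sym ∘ S≗K) c∈K))) refl)

  pseudoforest : ∀ {c} → c ∈ K → Pseudoforest full c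
  pseudoforest {c} c∈K S⊆ v∈S with low-degree v∈S
  ... | inj₁ found = inj₁ found
  ... | inj₂ S≗K with around c∈K
  ... | y , z , y∈ , z∈ , y≢z , ey , ez , _ = inj₂ (K⊆S c∈K , y , z , K⊆S (∖-⊆ y∈) , K⊆S (∖-⊆ z∈) , y≢z ,
    edge-≢ ey ∘ sym , edge-≢ ez ∘ sym , ey , ez , λ w∈S ew →
      HasEdge-two (chordless c∈K (∖-⊆ y∈) ey) (chordless c∈K (∖-⊆ z∈) ez) y≢z (chordless c∈K (≗⇒⊆ S≗K w∈S) ew))
    where
    K⊆S : K ⊆ _
    K⊆S = ≗⇒⊆ (sym ∘ S≗K)

-- Matchings of well-covered graphs

odd≢even : ∀ a b → suc (a ℕ.+ a) ≢ b ℕ.+ b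
odd≢even zero    (suc b) e = ℕ.0≢1+n (trans (ℕ.suc-injective e) (ℕ.+-suc b b))
odd≢even (suc a) (suc b) e = odd≢even a b (ℕ.suc-injective (ℕ.suc-injective
  (trans (cong (2 ℕ.+_) (sym (ℕ.+-suc a a))) (trans e (cong suc (ℕ.+-suc b b))))))

Even : ℕ → Set
Even k = ∃ λ j → k ≡ j ℕ.+ j

clash : ∀ {A : Set} {b : Bool} → b ≡ true → b ≡ false → A
clash refl ()

module Covering {N} (G : Graph N) (well-covered : WellCovered G) where
  private
    E = adj G
    E-sym = adj-sym G
    E-irr = adj-irr G

  Indep : Sub N → Set
  Indep B = ∀ {u v} → u ∈ B → v ∈ B → E u v ≡ false

  Maximal : Sub N → Set
  Maximal B = Indep B × (∀ {v} → v ∉ B → ∃ λ u → u ∈ B × E v u ≡ true)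

  opaque
    unfolding card

    card-tabulate : ∀ {n} (B : Sub n) → Subset.∣ Vec.tabulate B ∣ ≡ card B
    card-tabulate {zero}  B = refl
    card-tabulate {suc n} B with B zero
    ... | true  = cong suc (card-tabulate (B ∘ suc))
    ... | false = card-tabulate (B ∘ suc)

  private
    to : ∀ {B : Sub N} {v} → v ∈ B → v Subset.∈ Vec.tabulate B
    to {B} {v} (in! p) = Vec.lookup⇒[]= v (Vec.tabulate B) (trans (Vec.lookup∘tabulate B v) p)

    from : ∀ {B : Sub N} {v} → v Subset.∈ Vec.tabulate B → v ∈ B
    from {B} {v} p = in! (trans (sym (Vec.lookup∘tabulate B v)) (Vec.[]=⇒lookup p))

    maximal : ∀ {B} → Maximal B → MaximalIndependent G (Vec.tabulate B)
    maximal {B} (indep , dominating) =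
      (λ u v u∈ v∈ u~v → clash (adj-true G u~v) (indep (from u∈) (from v∈))) ,
      λ T T-indep B⊆T {t} t∈T → Sum.[ to , (λ t∉B → let u , u∈B , e = dominating t∉B in
        ⊥-elim (T-indep t u t∈T (B⊆T (to u∈B)) (true-adj G e))) ]′ (∈? B t)

  same-size : ∀ {B B′} → Maximal B → Maximal B′ → card B ≡ card B′
  same-size {B} {B′} m m′ = trans (sym (card-tabulate B))
    (trans (well-covered _ _ (maximal m) (maximal m′)) (card-tabulate B′))

  Indep-insert : ∀ {B v} → Indep B → (∀ {p} → p ∈ B → E v p ≡ false) → Indep (B ∪ ⁅ v ⁆)
  Indep-insert {B} {v} indep apart x∈ y∈ with ∪-∈ x∈ | ∪-∈ y∈
  ... | inj₁ x∈B | inj₁ y∈B = indep x∈B y∈B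
  ... | inj₁ x∈B | inj₂ y∈v with ⁅⁆-∈ y∈v
  ... | refl = trans (E-sym _ v) (apart x∈B)
  Indep-insert {B} {v} indep apart x∈ y∈ | inj₂ x∈v | inj₁ y∈B with ⁅⁆-∈ x∈v
  ... | refl = apart y∈B
  Indep-insert {B} {v} indep apart x∈ y∈ | inj₂ x∈v | inj₂ y∈v with ⁅⁆-∈ x∈v | ⁅⁆-∈ y∈v
  ... | refl | refl = E-irr v

  Indep-⁅⁆ : ∀ {v} → Indep ⁅ v ⁆
  Indep-⁅⁆ x∈ y∈ with ⁅⁆-∈ x∈ | ⁅⁆-∈ y∈
  ... | refl | refl = E-irr _

  extension : ∀ {B} → Indep B → ∃ λ M → B ⊆ M × Maximal M
  extension {B} indep = go (card (full ∖ B)) ℕ.≤-refl indep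
    where
    go : ∀ m {B} → card (full ∖ B) ℕ.≤ m → Indep B → ∃ λ M → B ⊆ M × Maximal M
    go m {B} c≤ indep with search candidate
      where
      candidate : ∀ v → (v ∉ B × (∀ {p} → p ∈ B → E v p ≡ false)) ⊎ (v ∉ B → ∃ λ u → u ∈ B × E v u ≡ true)
      candidate v with some? (B ∩ E v)
      ... | inj₁ (u , u∈) = inj₂ λ _ → u , ∩-⊆ˡ u∈ , holds (proj₂ (∩-∈ u∈))
      ... | inj₂ none with ∈? B v
      ... | inj₁ v∈B = inj₂ λ v∉B → ∈-∉ v∈B v∉B
      ... | inj₂ v∉B = inj₁ (v∉B , λ {p} p∈B → Bool.¬-not λ e → ∈-∉ (∈-∩ p∈B (in! e)) (none p))
    ... | inj₂ dominating = B , ⊆-refl , indep , λ {v} → dominating v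
    ... | inj₁ (v , v∉B , apart) with m
    ... | zero  = ∈-∉ (∈-∖ ∈-full v∉B) (card≡0 _ (ℕ.n≤0⇒n≡0 c≤) v)
    ... | suc m = let M , B⊆M , max = go m smaller (Indep-insert indep apart) in M , (λ p → B⊆M (∈-∪ˡ p)) , max
      where
      smaller : card (full ∖ (B ∪ ⁅ v ⁆)) ℕ.≤ m
      smaller = ℕ.≤-trans
        (card-mono _ _ λ p → let q , r = ∖-∈ p in
          ∈-∖x (∈-∖ q (¬∈⇒∉ λ s → ∈-∉ (∈-∪ˡ s) r)) (∈-∉-≢ (∈-∪ʳ (∈-⁅⁆ v)) r ∘ sym))
        (ℕ.≤-pred (subst (ℕ._≤ suc m) (card-remove (full ∖ B) v (∈-∖ ∈-full v∉B)) c≤))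

  no-larger : ∀ {M B} → Maximal M → Indep B → ¬ (card M ℕ.< card B)
  no-larger max indep M<B with extension indep
  ... | M′ , B⊆M′ , max′ = ℕ.<⇒≱ M<B (ℕ.≤-trans (card-mono _ _ B⊆M′) (ℕ.≤-reflexive (same-size max′ max)))

  -- A perfect matching of `S` together with an independent set `J` that has one vertex in each
  -- matched pair. For `S = full`, well-coveredness then makes every maximal independent set at
  -- least as large as `J`, half the number of vertices.
  record Matched (S : Sub N) : Set where
    field
      mate      : Fin N → Fin N
      J         : Sub N
      mate-∈    : ∀ {v} → v ∈ S → mate v ∈ S
      mate-mate : ∀ {v} → v ∈ S → mate (mate v) ≡ v
      mate-edge : ∀ {v} → v ∈ S → E v (mate v) ≡ true
      J⊆S       : J ⊆ S
      J-mate    : ∀ {v} → v ∈ S → J (mate v) ≡ not (J v)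
      J-indep   : Indep J

  Matched-cong : ∀ {S T} → S ≗ T → Matched S → Matched T
  Matched-cong S≗T M = record
    { mate = mate ; J = J
    ; mate-∈ = λ p → ≗⇒⊆ S≗T (mate-∈ (back p)) ; mate-mate = λ p → mate-mate (back p) ; mate-edge = λ p → mate-edge (back p)
    ; J⊆S = λ p → ≗⇒⊆ S≗T (J⊆S p) ; J-mate = λ p → J-mate (back p) ; J-indep = J-indep }
    where
    open Matched M
    back = ≗⇒⊆ (sym ∘ S≗T)

  matched-none : ∀ {S} → (∀ v → v ∉ S) → Matched S
  matched-none none = record
    { mate = id ; J = λ _ → false
    ; mate-∈ = id ; mate-mate = λ _ → refl ; mate-edge = λ {v} p → ∈-∉ p (none v)
    ; J⊆S = λ { (in! ()) } ; J-mate = λ {v} p → ∈-∉ p (none v) ; J-indep = λ { (in! ()) } }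

  module AddPair {S u v} (M : Matched S) (u∉S : u ∉ S) (v∉S : v ∉ S) (e : E v u ≡ true)
    (apart : ∀ {s} → s ∈ Matched.J M → E v s ≡ false) where
    open Matched M

    v≢u : v ≢ u
    v≢u refl = clash e (E-irr v)

    mate′ : Fin N → Fin N
    mate′ w = if does (w Fin.≟ u) then v else if does (w Fin.≟ v) then u else mate w

    mate′-u : mate′ u ≡ v
    mate′-u rewrite dec-true (u Fin.≟ u) refl = refl

    mate′-v : mate′ v ≡ u
    mate′-v rewrite dec-false (v Fin.≟ u) v≢u | dec-true (v Fin.≟ v) refl = refl

    mate′-S : ∀ {w} → w ∈ S → mate′ w ≡ mate w
    mate′-S {w} w∈S rewrite dec-false (w Fin.≟ u) (∈-∉-≢ w∈S u∉S) | dec-false (w Fin.≟ v) (∈-∉-≢ w∈S v∉S) = refl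

    cases : ∀ {w} → w ∈ S ∪ ⁅ u ⁆ ∪ ⁅ v ⁆ → w ∈ S ⊎ w ≡ u ⊎ w ≡ v
    cases w∈ = Sum.[ (λ p → Sum.map₂ (λ q → inj₁ (⁅⁆-∈ q)) (∪-∈ p)) , (λ p → inj₂ (inj₂ (⁅⁆-∈ p))) ]′ (∪-∈ w∈)

    J′ : Sub N
    J′ = J ∪ ⁅ v ⁆

    J′-u : J′ u ≡ false
    J′-u = fails (¬∈⇒∉ λ p → Sum.[ (λ q → ∈-∉ (J⊆S q) u∉S) , (λ q → v≢u (sym (⁅⁆-∈ q))) ]′ (∪-∈ p))

    J′-v : J′ v ≡ true
    J′-v = holds (∈-∪ʳ (∈-⁅⁆ v))

    J′-S : ∀ {w} → w ∈ S → J′ w ≡ J w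
    J′-S w∈S = ∪-skip (∈-∉-≢ w∈S v∉S)

    in-S : S ⊆ S ∪ ⁅ u ⁆ ∪ ⁅ v ⁆
    in-S p = ∈-∪ˡ (∈-∪ˡ p)

    added : Matched (S ∪ ⁅ u ⁆ ∪ ⁅ v ⁆)
    added = record
      { mate = mate′ ; J = J′ ; mate-∈ = m-∈ ; mate-mate = m-m ; mate-edge = m-e
      ; J⊆S = λ p → Sum.[ (λ q → in-S (J⊆S q)) , ∈-∪ʳ ]′ (∪-∈ p)
      ; J-mate = j-m ; J-indep = Indep-insert J-indep apart }
      where
      m-∈ : ∀ {w} → w ∈ S ∪ ⁅ u ⁆ ∪ ⁅ v ⁆ → mate′ w ∈ S ∪ ⁅ u ⁆ ∪ ⁅ v ⁆
      m-∈ p with cases p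
      ... | inj₁ w∈S         = subst (_∈ S ∪ ⁅ u ⁆ ∪ ⁅ v ⁆) (sym (mate′-S w∈S)) (in-S (mate-∈ w∈S))
      ... | inj₂ (inj₁ refl) = subst (_∈ S ∪ ⁅ u ⁆ ∪ ⁅ v ⁆) (sym mate′-u) (∈-∪ʳ (∈-⁅⁆ v))
      ... | inj₂ (inj₂ refl) = subst (_∈ S ∪ ⁅ u ⁆ ∪ ⁅ v ⁆) (sym mate′-v) (∈-∪ˡ (∈-∪ʳ (∈-⁅⁆ u)))
      m-m : ∀ {w} → w ∈ S ∪ ⁅ u ⁆ ∪ ⁅ v ⁆ → mate′ (mate′ w) ≡ w
      m-m p with cases p
      ... | inj₁ w∈S         = trans (cong mate′ (mate′-S w∈S)) (trans (mate′-S (mate-∈ w∈S)) (mate-mate w∈S))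
      ... | inj₂ (inj₁ refl) = trans (cong mate′ mate′-u) mate′-v
      ... | inj₂ (inj₂ refl) = trans (cong mate′ mate′-v) mate′-u
      m-e : ∀ {w} → w ∈ S ∪ ⁅ u ⁆ ∪ ⁅ v ⁆ → E w (mate′ w) ≡ true
      m-e p with cases p
      ... | inj₁ w∈S         = trans (cong (E _) (mate′-S w∈S)) (mate-edge w∈S)
      ... | inj₂ (inj₁ refl) = trans (cong (E u) mate′-u) (trans (E-sym u v) e)
      ... | inj₂ (inj₂ refl) = trans (cong (E v) mate′-v) e
      j-m : ∀ {w} → w ∈ S ∪ ⁅ u ⁆ ∪ ⁅ v ⁆ → J′ (mate′ w) ≡ not (J′ w)
      j-m p with cases p
      ... | inj₁ w∈S         = trans (cong J′ (mate′-S w∈S)) (trans (J′-S (mate-∈ w∈S)) (trans (J-mate w∈S) (cong not (sym (J′-S w∈S)))))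
      ... | inj₂ (inj₁ refl) = trans (cong J′ mate′-u) (trans J′-v (cong not (sym J′-u)))
      ... | inj₂ (inj₂ refl) = trans (cong J′ mate′-v) (trans J′-u (cong not (sym J′-v)))

  -- T is an independent set dominating the complement of S; two leaves of S with a common
  -- neighbour u could replace u in a maximal independent set containing T ∪ {u}.
  no-twins : ∀ {S T u v w} → Indep T → (∀ {s t} → s ∈ S → t ∈ T → E s t ≡ false) →
    (∀ {r} → r ∉ S → r ∉ T → ∃ λ t → t ∈ T × E r t ≡ true) → u ∈ S → v ∈ S → w ∈ S → v ≢ w →
    E v u ≡ true → E w u ≡ true → (∀ {r} → r ∈ S → E v r ≡ true → r ≡ u) → (∀ {r} → r ∈ S → E w r ≡ true → r ≡ u) → ⊥
  no-twins {S} {T} {u} {v} {w} T-indep apart dominated u∈S v∈S w∈S v≢w ev ew only-v only-w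
    with extension (Indep-insert T-indep (λ t∈T → apart u∈S t∈T))
  ... | M , T∪u⊆M , max@(indep , _) = no-larger max
      (Indep-insert (Indep-insert (λ p q → indep (∖-⊆ p) (∖-⊆ q)) (away v∈S only-v))
        (λ p → Sum.[ away w∈S only-w , (λ q → trans (cong (E w) (⁅⁆-∈ q)) (Bool.¬-not λ e → clash ev (subst (λ z → E v z ≡ false) (only-w v∈S e) (E-irr v)))) ]′ (∪-∈ p)))
      (ℕ.≤-reflexive (sym larger))
    where
    M₀ = M ∖ ⁅ u ⁆
    u∈M : u ∈ M
    u∈M = T∪u⊆M (∈-∪ʳ (∈-⁅⁆ u))
    away : ∀ {z} → z ∈ S → (∀ {r} → r ∈ S → E z r ≡ true → r ≡ u) → ∀ {p} → p ∈ M₀ → E z p ≡ false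
    away {z} z∈S only {p} p∈ with ∈? S p | ∈? T p
    ... | inj₁ p∈S | _        = Bool.¬-not λ e → proj₂ (∖x-∈ p∈) (only p∈S e)
    ... | inj₂ p∉S | inj₁ p∈T = apart z∈S p∈T
    ... | inj₂ p∉S | inj₂ p∉T = let t , t∈T , e = dominated p∉S p∉T in clash e (indep (∖-⊆ p∈) (T∪u⊆M (∈-∪ˡ t∈T)))
    outside : ∀ {z} → E z u ≡ true → z ∉ M
    outside e = ¬∈⇒∉ λ z∈M → clash e (indep z∈M u∈M)
    larger : card (M₀ ∪ ⁅ v ⁆ ∪ ⁅ w ⁆) ≡ suc (card M)
    larger = trans (card-insert (M₀ ∪ ⁅ v ⁆) w (¬∈⇒∉ λ p → Sum.[ (λ q → ∈-∉ (∖-⊆ q) (outside ew)) , (λ q → v≢w (sym (⁅⁆-∈ q))) ]′ (∪-∈ p)))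
      (cong suc (trans (card-insert M₀ v (∉-∖ˡ (outside ev))) (sym (card-remove M u u∈M))))

module Structure {N} (G : Graph N) (connected : Connected G) (unicyclic : Unicyclic G) (well-covered : WellCovered G) where
  open UnicyclicGraph G connected unicyclic public
  open Covering G well-covered public

  opaque
    prefix : ℕ → Sub N
    prefix i v = does (Fin.any? λ j → (suc (toℕ j) ℕ.≤? i) ×-dec (vertex j Fin.≟ v))

    ∈-prefix : ∀ {i} j → toℕ j ℕ.< i → vertex j ∈ prefix i
    ∈-prefix {i} j j<i = in! (dec-true (Fin.any? λ k → (suc (toℕ k) ℕ.≤? i) ×-dec (vertex k Fin.≟ vertex j)) (j , j<i , refl))

    prefix-∈ : ∀ {i v} → v ∈ prefix i → ∃ λ j → toℕ j ℕ.< i × vertex j ≡ v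
    prefix-∈ {i} {v} (in! p) = does-true (Fin.any? λ j → (suc (toℕ j) ℕ.≤? i) ×-dec (vertex j Fin.≟ v)) p

  -- The cycle is matched in consecutive pairs, with `J` at the even positions. These are
  -- independent because there are no chords and, at the closing edge, because the length is even.
  matched-prefix : ∀ {k} → len ≡ k ℕ.+ k → ∀ i → i ℕ.+ i ℕ.≤ len →
    ∃ λ (M : Matched (prefix (i ℕ.+ i))) → ∀ {s} → s ∈ Matched.J M → ∃ λ j → ∃ λ r → toℕ j ≡ r ℕ.+ r × vertex j ≡ s
  matched-prefix len≡ zero    _ = matched-none (λ v → ¬∈⇒∉ λ p → ℕ.n≮0 (proj₁ (proj₂ (prefix-∈ p)))) , λ { (in! ()) }
  matched-prefix {k} len≡ (suc i) i≤ with matched-prefix {k} len≡ i (ℕ.≤-trans (ℕ.+-mono-≤ (ℕ.n≤1+n i) (ℕ.n≤1+n i)) i≤)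
  ... | M , even = Matched-cong covers added ,
      λ s∈ → Sum.[ even , (λ q → j₀ , i , Fin.toℕ-fromℕ< i₀< , sym (⁅⁆-∈ q)) ]′ (∪-∈ s∈)
    where
    2+i+i≤ : 2 ℕ.+ (i ℕ.+ i) ℕ.≤ len
    2+i+i≤ = subst (ℕ._≤ len) (cong suc (ℕ.+-suc i i)) i≤
    i₀< : i ℕ.+ i ℕ.< len
    i₀< = ℕ.≤-trans (ℕ.n≤1+n _) 2+i+i≤
    j₀ j₁ : Fin len
    j₀ = Fin.fromℕ< i₀<
    j₁ = Fin.fromℕ< 2+i+i≤
    new : ∀ {j} → i ℕ.+ i ℕ.≤ toℕ j → vertex j ∉ prefix (i ℕ.+ i)
    new {j} i≤j = ¬∈⇒∉ λ p → let j′ , j′< , e = prefix-∈ p in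
      ℕ.<⇒≱ j′< (ℕ.≤-trans i≤j (ℕ.≤-reflexive (cong toℕ (sym (injective e)))))
    apart : ∀ {s} → s ∈ Matched.J M → E (vertex j₀) s ≡ false
    apart s∈J with even s∈J
    ... | j , r , j≡ , refl = Bool.¬-not λ e → nonadjacent (chordless (image-∈ vertex j₀) (image-∈ vertex j) e)
      where
      impossible : Next j₀ j ⊎ Next j j₀ → ⊥
      impossible (inj₁ (inj₁ p))       = odd≢even i r (trans (cong suc (sym (Fin.toℕ-fromℕ< i₀<))) (trans p j≡))
      impossible (inj₁ (inj₂ (p , _))) = odd≢even i k (trans (cong suc (sym (Fin.toℕ-fromℕ< i₀<))) (trans p len≡))
      impossible (inj₂ (inj₁ p))       = odd≢even r i (trans (cong suc (sym j≡)) (trans p (Fin.toℕ-fromℕ< i₀<)))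
      impossible (inj₂ (inj₂ (p , _))) = odd≢even r k (trans (cong suc (sym j≡)) (trans p len≡))
      nonadjacent : HasEdge (vertex j₀) (vertex j) → ⊥
      nonadjacent (a , b , (_ , adjacent) , e₁ , e₂) with injective e₁ | injective e₂
      ... | refl | refl = impossible adjacent
    open AddPair M (new (ℕ.≤-trans (ℕ.n≤1+n _) (ℕ.≤-reflexive (sym (Fin.toℕ-fromℕ< 2+i+i≤)))))
      (new (ℕ.≤-reflexive (sym (Fin.toℕ-fromℕ< i₀<))))
      (Next-edge {j₀} {j₁} (inj₁ (trans (cong suc (Fin.toℕ-fromℕ< i₀<)) (sym (Fin.toℕ-fromℕ< 2+i+i≤))))) apart
    covers : prefix (i ℕ.+ i) ∪ ⁅ vertex j₁ ⁆ ∪ ⁅ vertex j₀ ⁆ ≗ prefix (suc i ℕ.+ suc i)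
    covers = ⊆-antisym
      (λ p → Sum.[ (λ q → Sum.[ (λ r → let j , j< , e = prefix-∈ r in subst (_∈ prefix (suc i ℕ.+ suc i)) e
                       (∈-prefix j (ℕ.≤-trans j< (ℕ.+-mono-≤ (ℕ.n≤1+n i) (ℕ.n≤1+n i))))) ,
                     (λ r → subst (_∈ prefix (suc i ℕ.+ suc i)) (sym (⁅⁆-∈ r)) (∈-prefix j₁
                       (ℕ.≤-reflexive (trans (cong suc (Fin.toℕ-fromℕ< 2+i+i≤)) (cong suc (sym (ℕ.+-suc i i))))))) ]′ (∪-∈ q)) ,
                   (λ q → subst (_∈ prefix (suc i ℕ.+ suc i)) (sym (⁅⁆-∈ q)) (∈-prefix j₀
                       (ℕ.≤-trans (ℕ.≤-reflexive (cong suc (Fin.toℕ-fromℕ< i₀<))) (ℕ.s≤s (ℕ.+-monoʳ-≤ i (ℕ.n≤1+n i)))))) ]′ (∪-∈ p))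
      (λ p → let j , j< , e = prefix-∈ p in subst (_∈ prefix (i ℕ.+ i) ∪ ⁅ vertex j₁ ⁆ ∪ ⁅ vertex j₀ ⁆) e
        (back j (subst (suc (toℕ j) ℕ.≤_) (cong suc (ℕ.+-suc i i)) j<)))
      where
      back : ∀ j → toℕ j ℕ.< 2 ℕ.+ (i ℕ.+ i) → vertex j ∈ prefix (i ℕ.+ i) ∪ ⁅ vertex j₁ ⁆ ∪ ⁅ vertex j₀ ⁆
      back j j< with ℕ.m≤n⇒m<n∨m≡n (ℕ.≤-pred j<)
      ... | inj₂ e = ∈-∪ˡ (∈-∪ʳ (subst (λ z → vertex z ∈ ⁅ vertex j₁ ⁆) (Fin.toℕ-injective (trans (Fin.toℕ-fromℕ< 2+i+i≤) (sym e))) (∈-⁅⁆ _)))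
      ... | inj₁ h with ℕ.m≤n⇒m<n∨m≡n (ℕ.≤-pred h)
      ... | inj₂ e = ∈-∪ʳ (subst (λ z → vertex z ∈ ⁅ vertex j₀ ⁆) (Fin.toℕ-injective (trans (Fin.toℕ-fromℕ< i₀<) (sym e))) (∈-⁅⁆ _))
      ... | inj₁ h′ = ∈-∪ˡ (∈-∪ˡ (∈-prefix j h′))

  matched-cycle : Even (card K) → Matched K
  matched-cycle (k , c) = Matched-cong (⊆-antisym
      (λ p → let j , _ , e = prefix-∈ p in subst (_∈ K) e (image-∈ vertex j))
      (λ p → let j , e = ∈-image vertex p in subst (_∈ prefix (k ℕ.+ k)) e (∈-prefix j (subst (toℕ j ℕ.<_) len≡ (Fin.toℕ<n j)))))
    (proj₁ (matched-prefix {k} len≡ k (ℕ.≤-reflexive (sym len≡))))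
    where
    len≡ : len ≡ k ℕ.+ k
    len≡ = trans (sym (card-image vertex injective)) c

  -- A leaf `v` of `S` is matched with its neighbour `u`, both are removed, and `v` joins the
  -- independent set `T` that dominates everything removed. Another vertex isolated by this would be
  -- a second leaf at `u`, which `no-twins` excludes, so `busy` persists. When no leaf is left `S`
  -- is the cycle, and its even size allows it to be matched.
  strip : ∀ m {S T} → card S ℕ.≤ m → Even (card S) → Indep T → (∀ {s} → s ∈ S → s ∉ T) →
    (∀ {s t} → s ∈ S → t ∈ T → E s t ≡ false) → (∀ {r} → r ∉ S → r ∉ T → ∃ λ t → t ∈ T × E r t ≡ true) →
    (∀ {s} → s ∈ S → ∃ λ r → r ∈ S × E s r ≡ true) → Matched S
  strip m {S} {T} c≤m even T-indep disjoint apart dominated busy with some? S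
  ... | inj₂ none = matched-none none
  ... | inj₁ (s , s∈S) with low-degree s∈S
  ... | inj₂ S≗K = Matched-cong (sym ∘ S≗K) (matched-cycle (subst Even (card-cong S≗K) even))
  ... | inj₁ (v , v∈S , one) with busy v∈S | m
  ... | _ | zero = ∈-∉ v∈S (card≡0 S (ℕ.n≤0⇒n≡0 c≤m) v)
  ... | u , u∈S , e | suc m = Matched-cong covers (AddPair.added M u∉S′ v∉S′ e λ s∈J → apart-v (Matched.J⊆S M s∈J))
    where
    S′ = S ∖ ⁅ u ⁆ ∖ ⁅ v ⁆
    v≢u : v ≢ u
    v≢u = edge-≢ e
    v∈S∖u : v ∈ S ∖ ⁅ u ⁆
    v∈S∖u = ∈-∖x v∈S v≢u
    c′ : card S ≡ 2 ℕ.+ card S′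
    c′ = trans (card-remove S u u∈S) (cong suc (card-remove (S ∖ ⁅ u ⁆) v v∈S∖u))
    u∉S′ : u ∉ S′
    u∉S′ = ∉-∖ˡ (∉-∖ʳ (∈-⁅⁆ u))
    v∉S′ : v ∉ S′
    v∉S′ = ∉-∖ʳ (∈-⁅⁆ v)
    S′⊆S : S′ ⊆ S
    S′⊆S p = ∖-⊆ (∖-⊆ p)
    apart-v : ∀ {s} → s ∈ S′ → E v s ≡ false
    apart-v p = Bool.¬-not λ e′ → proj₂ (∖x-∈ (∖-⊆ p)) (one (S′⊆S p) u∈S e′ e)
    halve : Even (card S) → Even (card S′)
    halve (zero  , h) = ⊥-elim (ℕ.0≢1+n (trans (sym h) c′))
    halve (suc j , h) = j , ℕ.suc-injective (ℕ.suc-injective (trans (sym c′) (trans h (cong suc (ℕ.+-suc j j)))))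
    busy′ : ∀ {s} → s ∈ S′ → ∃ λ r → r ∈ S′ × E s r ≡ true
    busy′ {w} w∈S′ with some? (S′ ∩ E w)
    ... | inj₁ (r , r∈) = r , ∩-⊆ˡ r∈ , holds (proj₂ (∩-∈ r∈))
    ... | inj₂ none = ⊥-elim (no-twins T-indep apart dominated u∈S v∈S (S′⊆S w∈S′) (proj₂ (∖x-∈ w∈S′) ∘ sym) e
        (let r , r∈S , er = busy (S′⊆S w∈S′) in subst (λ z → E w z ≡ true) (only-w r∈S er) er)
        (λ r∈S er → one r∈S u∈S er e) only-w)
      where
      only-w : ∀ {r} → r ∈ S → E w r ≡ true → r ≡ u
      only-w {r} r∈S er with r Fin.≟ u | r Fin.≟ v
      ... | yes r≡u | _        = r≡u
      ... | no _    | yes refl = clash (flip er) (apart-v w∈S′)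
      ... | no r≢u  | no r≢v   = ∈-∉ (∈-∩ (∈-∖x (∈-∖x r∈S r≢u) r≢v) (in! er)) (none r)
    M : Matched S′
    M = strip m (ℕ.≤-trans (ℕ.n≤1+n _) (ℕ.≤-pred (subst (ℕ._≤ suc m) c′ c≤m))) (halve even)
      (Indep-insert T-indep (λ t∈T → apart v∈S t∈T))
      (λ p → ¬∈⇒∉ λ q → Sum.[ (λ r → ∈-∉ r (disjoint (S′⊆S p))) , (λ r → proj₂ (∖x-∈ p) (⁅⁆-∈ r)) ]′ (∪-∈ q))
      (λ {s} p q → Sum.[ apart (S′⊆S p) , (λ r → trans (cong (E s) (⁅⁆-∈ r)) (trans (E-sym s v) (apart-v p))) ]′ (∪-∈ q))
      dominated′ busy′
      where
      dominated′ : ∀ {r} → r ∉ S′ → r ∉ T ∪ ⁅ v ⁆ → ∃ λ t → t ∈ T ∪ ⁅ v ⁆ × E r t ≡ true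
      dominated′ {r} r∉S′ r∉ with ∈? S r | r Fin.≟ u
      ... | inj₂ r∉S | _        = let t , t∈T , et = dominated r∉S (¬∈⇒∉ λ q → ∈-∉ (∈-∪ˡ q) r∉) in t , ∈-∪ˡ t∈T , et
      ... | inj₁ _   | yes refl = v , ∈-∪ʳ (∈-⁅⁆ v) , flip e
      ... | inj₁ r∈S | no r≢u   = ∈-∉ (∈-∖x (∈-∖x r∈S r≢u) (∈-∉-≢ (∈-∪ʳ (∈-⁅⁆ v)) r∉ ∘ sym)) r∉S′
    covers : S′ ∪ ⁅ u ⁆ ∪ ⁅ v ⁆ ≗ S
    covers = ⊆-antisym
      (λ p → Sum.[ (λ q → Sum.[ S′⊆S , (λ r → subst (_∈ S) (sym (⁅⁆-∈ r)) u∈S) ]′ (∪-∈ q)) ,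
                   (λ q → subst (_∈ S) (sym (⁅⁆-∈ q)) v∈S) ]′ (∪-∈ p))
      (λ {r} p → back r p (r Fin.≟ u) (r Fin.≟ v))
      where
      back : ∀ r → r ∈ S → Dec (r ≡ u) → Dec (r ≡ v) → r ∈ S′ ∪ ⁅ u ⁆ ∪ ⁅ v ⁆
      back r r∈S (yes refl) _          = ∈-∪ˡ (∈-∪ʳ (∈-⁅⁆ u))
      back r r∈S (no _)     (yes refl) = ∈-∪ʳ (∈-⁅⁆ v)
      back r r∈S (no r≢u)   (no r≢v)   = ∈-∪ˡ (∈-∪ˡ (∈-∖x (∈-∖x r∈S r≢u) r≢v))

  -- Favaron's property of the matched edges of a very well-covered graph.
  exchange : (M : Matched full) → let open Matched M in ∀ {a x y} → E a x ≡ true → E (mate a) y ≡ true →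
    x ≢ mate a → y ≢ a → E x y ≡ true
  exchange M {a} {x} {y} ex ey x≢b y≢a with E x y in exy
  ... | true  = refl
  -- If `x` and `y` were not adjacent, they would extend to a maximal independent set `M₁` missing
  -- both `a` and `b`. Moving each vertex of `M₁` to the member of `J` in its pair is injective, as
  -- `M₁` has at most one vertex in each pair, and misses the pair of `a`. So `M₁` is smaller than
  -- `J`.
  ... | false = ⊥-elim (no-larger max J-indep smaller)
    where
    open Matched M
    b = mate a
    B-indep : Indep (⁅ x ⁆ ∪ ⁅ y ⁆)
    B-indep = Indep-insert Indep-⁅⁆ λ p → trans (cong (E y) (⁅⁆-∈ p)) (trans (E-sym y x) exy)
    M₁ = proj₁ (extension B-indep)
    B⊆M₁ = proj₁ (proj₂ (extension B-indep))
    max : Maximal M₁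
    max = proj₂ (proj₂ (extension B-indep))
    a∉ : a ∉ M₁
    a∉ = ¬∈⇒∉ λ p → clash ex (proj₁ max p (B⊆M₁ (∈-∪ˡ (∈-⁅⁆ x))))
    b∉ : b ∉ M₁
    b∉ = ¬∈⇒∉ λ p → clash ey (proj₁ max p (B⊆M₁ (∈-∪ʳ (∈-⁅⁆ y))))
    g : Fin N → Fin N
    g s = if J s then s else mate s
    g-∈ : ∀ s → g s ∈ J
    g-∈ s with J s in eq
    ... | true  = in! eq
    ... | false = in! (trans (J-mate ∈-full) (cong not eq))
    g-cases : ∀ s → g s ≡ s ⊎ g s ≡ mate s
    g-cases s with J s
    ... | true  = inj₁ refl
    ... | false = inj₂ refl
    g-injective : ∀ {r s} → r ∈ M₁ → s ∈ M₁ → g r ≡ g s → r ≡ s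
    g-injective {r} {s} r∈ s∈ e with g-cases r | g-cases s
    ... | inj₁ p | inj₁ q = trans (sym p) (trans e q)
    ... | inj₁ p | inj₂ q = clash (mate-edge {s} ∈-full) (subst (λ z → E s z ≡ false) (trans (sym p) (trans e q)) (proj₁ max s∈ r∈))
    ... | inj₂ p | inj₁ q = clash (mate-edge {r} ∈-full) (subst (λ z → E r z ≡ false) (trans (sym q) (trans (sym e) p)) (proj₁ max r∈ s∈))
    ... | inj₂ p | inj₂ q = trans (sym (mate-mate {r} ∈-full)) (trans (cong mate (trans (sym p) (trans e q))) (mate-mate {s} ∈-full))
    g≢ : ∀ {s} → s ∈ M₁ → g s ≢ g a
    g≢ {s} s∈ e with g-cases s | g-cases a
    ... | inj₁ p | inj₁ q = ∈-∉ s∈ (subst (_∉ M₁) (trans (sym q) (trans (sym e) p)) a∉)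
    ... | inj₁ p | inj₂ q = ∈-∉ s∈ (subst (_∉ M₁) (trans (sym q) (trans (sym e) p)) b∉)
    ... | inj₂ p | inj₁ q = ∈-∉ s∈ (subst (_∉ M₁) (trans (cong mate (trans (sym q) (trans (sym e) p))) (mate-mate {s} ∈-full)) b∉)
    ... | inj₂ p | inj₂ q = ∈-∉ s∈ (subst (_∉ M₁)
        (trans (sym (mate-mate {a} ∈-full)) (trans (cong mate (trans (sym q) (trans (sym e) p))) (mate-mate {s} ∈-full))) a∉)
    smaller : card M₁ ℕ.< card J
    smaller = subst (card M₁ ℕ.<_) (sym (card-remove J (g a) (g-∈ a)))
      (ℕ.s≤s (card-injection g (λ {s} s∈ → ∈-∖x (g-∈ s) (g≢ s∈)) g-injective))

  matched : ∀ k → N ≡ k ℕ.+ k → Matched full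
  matched k N≡ = strip N (ℕ.≤-reflexive card-full) (k , trans card-full N≡) (λ { (in! ()) }) (λ _ → out! refl) (λ { _ (in! ()) })
    (λ { (out! ()) }) λ {s} _ → neighbour s
    where
    neighbour : ∀ s → ∃ λ r → r ∈ full × E s r ≡ true
    neighbour s with around root∈K
    ... | y , _ , y∈ , _ , _ , ey , _ with s Fin.≟ root
    ... | yes refl = y , ∈-full , ey
    ... | no s≢r with Conn-full root {⁅ s ⁆} (λ _ → ∈-full) (∈-⁅⁆ s) (λ p → ∉-⁅⁆ (λ e → s≢r (trans (sym (⁅⁆-∈ p)) e)))
    ... | a , r , a∈ , _ , _ , e = r , ∈-full , subst (λ z → E z r ≡ true) (⁅⁆-∈ a∈) e

-- Reduction to a graph star

card-∪⁅⁆ : ∀ {n} (S : Sub n) x → card (S ∪ ⁅ x ⁆) ℕ.≤ suc (card S)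
card-∪⁅⁆ S x with ∈? S x
... | inj₂ x∉S = ℕ.≤-reflexive (card-insert S x x∉S)
... | inj₁ x∈S = ℕ.≤-trans (card-mono _ _ λ p → Sum.[ id , (λ q → subst (_∈ S) (sym (⁅⁆-∈ q)) x∈S) ]′ (∪-∈ p)) (ℕ.n≤1+n _)

card-⁅⁆ : ∀ {n} (x : Fin n) → card ⁅ x ⁆ ≡ 1
card-⁅⁆ x = trans (card-remove ⁅ x ⁆ x (∈-⁅⁆ x)) (cong suc (card-none λ v → ¬∈⇒∉ λ p → ∈-∉ (∖-⊆ p) (proj₂ (∖-∈ p))))

triangle : ∀ {n} (E : Adj n) (E-sym : Sym E) {b x y} → E b x ≡ true → E b y ≡ true → E x y ≡ true →
  b ≢ x → b ≢ y → x ≢ y → Connectivity.CycleSet E E-sym (⁅ b ⁆ ∪ ⁅ x ⁆ ∪ ⁅ y ⁆) b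
triangle {n} E E-sym {b} {x} {y} bx by xy b≢x b≢y x≢y = record { root = b∈ ; joined = joined ; around = around }
  where
  open Connectivity E E-sym
  K = ⁅ b ⁆ ∪ ⁅ x ⁆ ∪ ⁅ y ⁆
  b∈ : b ∈ K
  b∈ = ∈-∪ˡ (∈-∪ˡ (∈-⁅⁆ b))
  x∈ : x ∈ K
  x∈ = ∈-∪ˡ (∈-∪ʳ (∈-⁅⁆ x))
  y∈ : y ∈ K
  y∈ = ∈-∪ʳ (∈-⁅⁆ y)
  cases : ∀ {v} → v ∈ K → v ≡ b ⊎ v ≡ x ⊎ v ≡ y
  cases p = Sum.[ (λ q → Sum.[ (λ r → inj₁ (⁅⁆-∈ r)) , (λ r → inj₂ (inj₁ (⁅⁆-∈ r))) ]′ (∪-∈ q)) , (λ q → inj₂ (inj₂ (⁅⁆-∈ q))) ]′ (∪-∈ p)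
  joined : ∀ {v} → v ∈ K → Linked K b v
  joined p A closed b∈A with cases p
  ... | inj₁ refl        = b∈A
  ... | inj₂ (inj₁ refl) = closed b∈A x∈ bx
  ... | inj₂ (inj₂ refl) = closed b∈A y∈ by
  corner : ∀ {u p r} → p ∈ K → r ∈ K → p ≢ u → r ≢ u → p ≢ r → E u p ≡ true → E u r ≡ true → E r p ≡ true →
    (∀ {v} → v ∈ K → v ≢ u → v ≡ p ⊎ v ≡ r) → ∃ λ y → ∃ λ z → y ∈ K ∖ ⁅ u ⁆ × z ∈ K ∖ ⁅ u ⁆ × y ≢ z ×
      E u y ≡ true × E u z ≡ true × (∀ {v} → v ∈ K ∖ ⁅ u ⁆ → Linked (K ∖ ⁅ u ⁆) v y)
  corner {u} {p} {r} p∈ r∈ p≢u r≢u p≢r up ur rp only = p , r , p∈′ , ∈-∖x r∈ r≢u , p≢r , up , ur , linked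
    where
    p∈′ : p ∈ K ∖ ⁅ u ⁆
    p∈′ = ∈-∖x p∈ p≢u
    linked : ∀ {v} → v ∈ K ∖ ⁅ u ⁆ → Linked (K ∖ ⁅ u ⁆) v p
    linked v∈ A closed v∈A with only (∖-⊆ v∈) (proj₂ (∖x-∈ v∈))
    ... | inj₁ refl = v∈A
    ... | inj₂ refl = closed v∈A p∈′ rp
  around : ∀ {u} → u ∈ K → ∃ λ y → ∃ λ z → y ∈ K ∖ ⁅ u ⁆ × z ∈ K ∖ ⁅ u ⁆ × y ≢ z ×
      E u y ≡ true × E u z ≡ true × (∀ {v} → v ∈ K ∖ ⁅ u ⁆ → Linked (K ∖ ⁅ u ⁆) v y)
  around u∈ with cases u∈
  ... | inj₁ refl = corner x∈ y∈ (b≢x ∘ sym) (b≢y ∘ sym) x≢y bx by (flip xy)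
    λ p ne → Sum.[ ⊥-elim ∘ ne , id ]′ (cases p)
  ... | inj₂ (inj₁ refl) = corner b∈ y∈ b≢x (x≢y ∘ sym) b≢y (flip bx) xy (flip by)
    λ p ne → Sum.[ inj₁ , Sum.[ ⊥-elim ∘ ne , inj₂ ]′ ]′ (cases p)
  ... | inj₂ (inj₂ refl) = corner b∈ x∈ b≢y x≢y b≢x (flip by) (flip xy) (flip bx)
    λ p ne → Sum.[ inj₁ , Sum.[ inj₂ , ⊥-elim ∘ ne ]′ ]′ (cases p)

module Reduction {N} (G : Graph N) (connected : Connected G) (unicyclic : Unicyclic G) (well-covered : WellCovered G)
  (M : Covering.Matched G well-covered full) (4<N : 4 ℕ.< N) where
  open Structure G connected unicyclic well-covered
  open Matched M

  mate-mate′ : ∀ v → mate (mate v) ≡ v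
  mate-mate′ v = mate-mate {v} ∈-full

  mate-edge′ : ∀ v → E v (mate v) ≡ true
  mate-edge′ v = mate-edge {v} ∈-full

  spread : ∀ {A v} → v ∈ A → Closed full A → ∀ r → r ∈ A
  spread v∈A closed r = Conn⇒Linked (Conn-full r) ∈-full _ closed v∈A

  -- By connectedness a nonempty closed set contains all the vertices, of which there are more than
  -- 4. This excludes a single edge and the 4-cycle.
  too-small : ∀ {A v} → v ∈ A → Closed full A → ¬ (card A ℕ.≤ 4)
  too-small {A} v∈A closed A≤4 = ℕ.<⇒≱ {4} {N} 4<N (ℕ.≤-trans (subst (ℕ._≤ card A) card-full (card-mono full A (λ {r} _ → spread v∈A closed r))) A≤4)

  Leafy : Fin N → Set
  Leafy v = ∀ {u} → E v u ≡ true → u ≡ mate v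

  Inner : Fin N → Set
  Inner v = ∃ λ u → E v u ≡ true × u ≢ mate v

  leafy? : ∀ v → Leafy v ⊎ Inner v
  leafy? v with some? (E v ∖ ⁅ mate v ⁆)
  ... | inj₁ (u , p) = inj₂ (u , holds (∖-⊆ p) , proj₂ (∖x-∈ p))
  ... | inj₂ none    = inj₁ λ {u} e → leaf u e (u Fin.≟ mate v)
    where
    leaf : ∀ u → E v u ≡ true → Dec (u ≡ mate v) → u ≡ mate v
    leaf u e (yes p) = p
    leaf u e (no ne) = ∈-∉ (∈-∖x (in! e) ne) (none u)

  inner-not-leafy : ∀ {v} → Inner v → Leafy v → ⊥
  inner-not-leafy (_ , e , ne) leafy = ne (leafy e)

  cycle-inner : ∀ {v} → v ∈ K → Inner v
  cycle-inner {v} v∈K with leafy? v | around v∈K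
  ... | inj₂ inner | _ = inner
  ... | inj₁ leafy | y , z , _ , _ , y≢z , ey , ez , _ = ⊥-elim (y≢z (trans (leafy ey) (sym (leafy ez))))

  leaves : Sub N
  leaves v = Sum.[ (λ _ → true) , (λ _ → false) ]′ (leafy? v)

  leaves-∈ : ∀ {v} → v ∈ leaves → Leafy v
  leaves-∈ {v} (in! p) = go (leafy? v) p
    where
    go : (d : Leafy v ⊎ Inner v) → Sum.[ (λ _ → true) , (λ _ → false) ]′ d ≡ true → Leafy v
    go (inj₁ leafy) _ = leafy

  leaves-∉ : ∀ {v} → v ∉ leaves → Inner v
  leaves-∉ {v} (out! p) = go (leafy? v) p
    where
    go : (d : Leafy v ⊎ Inner v) → Sum.[ (λ _ → true) , (λ _ → false) ]′ d ≡ false → Inner v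
    go (inj₂ inner) _ = inner

  inner-∉ : ∀ {v} → Inner v → v ∉ leaves
  inner-∉ inner = ¬∈⇒∉ λ p → inner-not-leafy inner (leaves-∈ p)

  leafy-∈ : ∀ {v} → Leafy v → v ∈ leaves
  leafy-∈ {v} leafy = Sum.[ id , (λ p → ⊥-elim (inner-not-leafy (leaves-∉ p) leafy)) ]′ (∈? leaves v)

  not-both : ∀ {v} → Leafy v → Leafy (mate v) → ⊥
  not-both {v} leafy leafy′ = too-small {⁅ v ⁆ ∪ ⁅ mate v ⁆} (∈-∪ˡ (∈-⁅⁆ v)) closed
    (ℕ.≤-trans (card-∪⁅⁆ ⁅ v ⁆ (mate v)) (ℕ.≤-trans (ℕ.s≤s (ℕ.≤-reflexive (card-⁅⁆ v))) (ℕ.m≤m+n 2 2)))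
    where
    closed : Closed full (⁅ v ⁆ ∪ ⁅ mate v ⁆)
    closed {p} {r} p∈ _ e with ∪-∈ p∈
    ... | inj₁ q with ⁅⁆-∈ q
    ... | refl = subst (_∈ ⁅ v ⁆ ∪ ⁅ mate v ⁆) (sym (leafy e)) (∈-∪ʳ (∈-⁅⁆ (mate v)))
    closed {p} {r} p∈ _ e | inj₂ q with ⁅⁆-∈ q
    ... | refl = subst (_∈ ⁅ v ⁆ ∪ ⁅ mate v ⁆) (sym (trans (leafy′ e) (mate-mate′ v))) (∈-∪ˡ (∈-⁅⁆ v))

  Pendant : Fin N → Set
  Pendant v = Leafy v ⊎ Leafy (mate v)

  leaves-mate : ∀ {v} → Pendant v → leaves (mate v) ≡ not (leaves v)
  leaves-mate {v} (inj₁ leafy) = trans (fails (¬∈⇒∉ λ p → not-both leafy (leaves-∈ p))) (cong not (sym (holds (leafy-∈ leafy))))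
  leaves-mate {v} (inj₂ leafy) = trans (holds (leafy-∈ leafy)) (cong not (sym (fails (¬∈⇒∉ λ p → not-both (leaves-∈ p) leafy))))

  pendant? : ∀ v → (Inner v × Inner (mate v)) ⊎ Pendant v
  pendant? v with leafy? v | leafy? (mate v)
  ... | inj₁ leafy | _          = inj₂ (inj₁ leafy)
  ... | inj₂ _     | inj₁ leafy = inj₂ (inj₂ leafy)
  ... | inj₂ inner | inj₂ inner′ = inj₁ (inner , inner′)

  pendant-star : (∀ v → Pendant v) → UnicyclicStar E
  pendant-star pendant = record
    { starred  = record { E-sym = E-sym ; E-irr = E-irr ; L = leaves ; mate = mate ; mate-L = λ v → leaves-mate (pendant v)
                        ; mate-mate = mate-mate′ ; mate-edge = mate-edge′ ; mate-only = λ v∈ e → leaves-∈ v∈ e }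
    ; c        = root
    ; K        = K
    ; cycleSet = cycleSet root∈K
    ; K⊆∁L     = λ v∈K → ∈-∁ (inner-∉ (cycle-inner v∈K))
    ; conn     = conn
    ; pseudo   = λ _ → pseudoforest root∈K (λ _ → ∈-full)
    ; forest   = λ S⊆ → forest root∈K (λ v∈S → ∈-∖ ∈-full (proj₂ (∖-∈ (S⊆ v∈S))))
    }
    where
    conn : Conn ⁅ root ⁆ (∁ leaves)
    -- The set `A` is enlarged by the leaves of its vertices. An edge of `G` leaving the enlarged
    -- set then has both ends in the base graph.
    conn {A} {u} A⊆ u∈A avoid with Conn-full root {λ v → A v ∨ A (mate v)} (λ _ → ∈-full) (in! (cong (_∨ A (mate u)) (holds u∈A)))
        (λ {v} p → ∉-⁅⁆ λ { refl → root∉ p })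
      where
      root∉ : root ∈ (λ v → A v ∨ A (mate v)) → ⊥
      root∉ (in! p) with ∈? A root
      ... | inj₁ r∈A = ∈-∉ (∈-⁅⁆ root) (avoid r∈A)
      ... | inj₂ r∉A = false≢true (trans (sym (fails (∁-∈ (A⊆ mate∈A))))
          (trans (leaves-mate (pendant root)) (cong not (fails (inner-∉ (cycle-inner root∈K))))))
        where
        false≢true : false ≡ true → ⊥
        false≢true ()
        mate∈A : mate root ∈ A
        mate∈A = in! (trans (cong (_∨ A (mate root)) (sym (fails r∉A))) p)
    ... | a , b , a∈ , _ , b∉ , e = locate (∈? A a)
      where
      b∉A : b ∉ A × mate b ∉ A
      b∉A = out! (proj₁ (∨-false (fails b∉))) , out! (proj₂ (∨-false (fails b∉)))
        where
        ∨-false : ∀ {p q} → p ∨ q ≡ false → p ≡ false × q ≡ false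
        ∨-false {false} e = refl , e
      locate : a ∈ A ⊎ a ∉ A → ∃ λ a → ∃ λ b → a ∈ A × b ∈ ∁ leaves × b ∉ A × E a b ≡ true
      locate (inj₁ a∈A) = a , b , a∈A , ∈-∁ (¬∈⇒∉ λ b∈L → ∈-∉ a∈A (subst (_∉ A) (sym (leaves-∈ b∈L (flip e))) (proj₂ b∉A))) , proj₁ b∉A , e
      locate (inj₂ a∉A) = ∈-∉ mate∈A (subst (_∉ A) (leaves-∈ a∈L e) (proj₁ b∉A))
        where
        mate∈A : mate a ∈ A
        mate∈A = in! (trans (cong (_∨ A (mate a)) (sym (fails a∉A))) (holds a∈))
        a∈L : a ∈ leaves
        a∈L = in! (trans (sym (Bool.not-involutive _)) (trans (cong not (sym (leaves-mate (pendant a)))) (cong not (fails (∁-∈ (A⊆ mate∈A))))))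

  -- Two inner mates lie on a 4-cycle, by the exchange property, which has to be the cycle of G.
  square : ∀ {v x y} → E v x ≡ true → x ≢ mate v → E (mate v) y ≡ true → y ≢ v → HasEdge v (mate v) × HasEdge v x
  square {v} {x} {y} ex x≢ ey y≢ = closing {⁅ mate v ⁆ ∪ ⁅ y ⁆ ∪ ⁅ x ⁆} x∈ v∉ (x≢ ∘ sym) linked (mate-edge′ v) ex
    where
    S = ⁅ mate v ⁆ ∪ ⁅ y ⁆ ∪ ⁅ x ⁆
    x∈ : x ∈ S
    x∈ = ∈-∪ʳ (∈-⁅⁆ x)
    v∉ : v ∉ S
    v∉ = ¬∈⇒∉ λ p → Sum.[ (λ q → Sum.[ (λ r → edge-≢ (mate-edge′ v) (⁅⁆-∈ r)) , (λ r → y≢ (sym (⁅⁆-∈ r))) ]′ (∪-∈ q)) ,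
                           (λ q → edge-≢ ex (⁅⁆-∈ q)) ]′ (∪-∈ p)
    linked : Linked S x (mate v)
    linked A closed x∈A = closed (closed x∈A (∈-∪ˡ (∈-∪ʳ (∈-⁅⁆ y))) (exchange M ex ey x≢ y≢)) (∈-∪ˡ (∈-∪ˡ (∈-⁅⁆ (mate v)))) (flip ey)

  -- By `square` every edge at `v` is on the cycle of `G`. Hence `v` has degree 2, and so has its
  -- mate.
  rigid : ∀ {v} → Inner v → Inner (mate v) → ∀ {z} → E v z ≡ true → HasEdge v z
  rigid {v} (x , ex , x≢) (y , ey , y≢) {z} ez with z Fin.≟ mate v
  ... | yes refl = proj₁ (square ex x≢ ey (λ e → y≢ (trans e (sym (mate-mate′ v)))))
  ... | no z≢    = proj₂ (square ez z≢ ey (λ e → y≢ (trans e (sym (mate-mate′ v)))))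

  HasEdge-sym : ∀ {u v} → HasEdge u v → HasEdge v u
  HasEdge-sym (i , j , (i≢j , e) , p , q) = j , i , (i≢j ∘ sym , Sum.swap e) , q , p

  module Exceptional {a} (inner-a : Inner a) (inner-b : Inner (mate a)) where
    b x y : Fin N
    b = mate a
    x = proj₁ inner-a
    y = proj₁ inner-b

    ex : E a x ≡ true
    ex = proj₁ (proj₂ inner-a)
    ey : E b y ≡ true
    ey = proj₁ (proj₂ inner-b)
    eb : E a b ≡ true
    eb = mate-edge′ a
    x≢b : x ≢ b
    x≢b = proj₂ (proj₂ inner-a)
    y≢a : y ≢ a
    y≢a e = proj₂ (proj₂ inner-b) (trans e (sym (mate-mate′ a)))
    exy : E x y ≡ true
    exy = exchange M ex ey x≢b y≢a
    a≢b : a ≢ b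
    a≢b = edge-≢ eb
    x≢a : x ≢ a
    x≢a = edge-≢ ex ∘ sym
    y≢b : y ≢ b
    y≢b = edge-≢ ey ∘ sym
    x≢y : x ≢ y
    x≢y = edge-≢ exy

    rigid-a : ∀ {z} → E a z ≡ true → HasEdge a z
    rigid-a = rigid inner-a inner-b
    rigid-b : ∀ {z} → E b z ≡ true → HasEdge b z
    rigid-b = rigid inner-b (subst Inner (sym (mate-mate′ a)) inner-a)

    a-only : ∀ {z} → E a z ≡ true → z ≡ b ⊎ z ≡ x
    a-only ez = HasEdge-two (rigid-a eb) (rigid-a ex) (x≢b ∘ sym) (rigid-a ez)
    b-only : ∀ {z} → E b z ≡ true → z ≡ a ⊎ z ≡ y
    b-only ez = HasEdge-two (rigid-b (flip eb)) (rigid-b ey) (y≢a ∘ sym) (rigid-b ez)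

    a∈K : a ∈ K
    a∈K = proj₁ (HasEdge-∈ (rigid-a ex))
    x∈K : x ∈ K
    x∈K = proj₂ (HasEdge-∈ (rigid-a ex))
    y∈K : y ∈ K
    y∈K = proj₂ (HasEdge-∈ (rigid-b ey))

    Q : Sub N
    Q = ⁅ a ⁆ ∪ ⁅ b ⁆ ∪ ⁅ x ⁆ ∪ ⁅ y ⁆
    a∈Q : a ∈ Q
    a∈Q = ∈-∪ˡ (∈-∪ˡ (∈-∪ˡ (∈-⁅⁆ a)))
    b∈Q : b ∈ Q
    b∈Q = ∈-∪ˡ (∈-∪ˡ (∈-∪ʳ (∈-⁅⁆ b)))
    x∈Q : x ∈ Q
    x∈Q = ∈-∪ˡ (∈-∪ʳ (∈-⁅⁆ x))
    y∈Q : y ∈ Q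
    y∈Q = ∈-∪ʳ (∈-⁅⁆ y)

    Q-cases : ∀ {v} → v ∈ Q → (v ≡ a ⊎ v ≡ b) ⊎ (v ≡ x ⊎ v ≡ y)
    Q-cases p = Sum.[ (λ q → Sum.[ (λ r → inj₁ (Sum.map ⁅⁆-∈ ⁅⁆-∈ (∪-∈ r))) , (λ r → inj₂ (inj₁ (⁅⁆-∈ r))) ]′ (∪-∈ q)) ,
                      (λ q → inj₂ (inj₂ (⁅⁆-∈ q))) ]′ (∪-∈ p)

    card-Q : card Q ℕ.≤ 4
    card-Q = ℕ.≤-trans (card-∪⁅⁆ _ y) (ℕ.s≤s (ℕ.≤-trans (card-∪⁅⁆ _ x) (ℕ.s≤s (ℕ.≤-trans (card-∪⁅⁆ _ b)
      (ℕ.s≤s (ℕ.≤-reflexive (card-⁅⁆ a)))))))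

    K⊆Q : K ⊆ Q
    K⊆Q v∈K = CycleSet.joined (cycleSet a∈K) v∈K Q closed a∈Q
      where
      -- Each of the four vertices has both its neighbours on the cycle within `Q`, so the cycle
      -- cannot leave `Q`.
      closed : Closed K Q
      closed p∈Q r∈K e with Q-cases p∈Q
      ... | inj₁ (inj₁ refl) = Sum.[ (λ { refl → b∈Q }) , (λ { refl → x∈Q }) ]′ (a-only e)
      ... | inj₁ (inj₂ refl) = Sum.[ (λ { refl → a∈Q }) , (λ { refl → y∈Q }) ]′ (b-only e)
      ... | inj₂ (inj₁ refl) = Sum.[ (λ { refl → a∈Q }) , (λ { refl → y∈Q }) ]′
        (HasEdge-two (HasEdge-sym (rigid-a ex)) (chordless x∈K y∈K exy) (y≢a ∘ sym) (chordless x∈K r∈K e))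
      ... | inj₂ (inj₂ refl) = Sum.[ (λ { refl → b∈Q }) , (λ { refl → x∈Q }) ]′
        (HasEdge-two (HasEdge-sym (rigid-b ey)) (chordless y∈K x∈K (flip exy)) (x≢b ∘ sym) (chordless y∈K r∈K e))

    mate-≢a : ∀ {v} → v ≢ b → mate v ≢ a
    mate-≢a v≢b e = v≢b (trans (sym (mate-mate′ _)) (cong mate e))
    mate-≢b : ∀ {v} → v ≢ a → mate v ≢ b
    mate-≢b v≢a e = v≢a (trans (sym (mate-mate′ _)) (trans (cong mate e) (mate-mate′ a)))

    xy-only : ∀ {v} → v ∈ K → v ≢ a → v ≢ b → v ≡ x ⊎ v ≡ y
    xy-only v∈K v≢a v≢b = Sum.[ Sum.[ ⊥-elim ∘ v≢a , ⊥-elim ∘ v≢b ]′ , id ]′ (Q-cases (K⊆Q v∈K))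

    -- A second pair of inner mates would consist of x and y, and then G is the 4-cycle itself.
    pendant : ∀ v → v ≢ a → v ≢ b → Pendant v
    pendant v v≢a v≢b with pendant? v
    ... | inj₂ p = p
    ... | inj₁ (inner , inner′) = ⊥-elim (too-small a∈Q closed card-Q)
      where
      v∈K : v ∈ K
      v∈K = cycle-vertex
        where
        cycle-vertex : v ∈ K
        cycle-vertex = proj₁ (HasEdge-∈ (rigid inner inner′ (mate-edge′ v)))
      m∈K : mate v ∈ K
      m∈K = proj₂ (HasEdge-∈ (rigid inner inner′ (mate-edge′ v)))
      rigid-v : ∀ {p r} → p ≡ v ⊎ p ≡ mate v → E p r ≡ true → HasEdge p r
      rigid-v (inj₁ refl) = rigid inner inner′
      rigid-v (inj₂ refl) = rigid inner′ (subst Inner (sym (mate-mate′ v)) inner)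
      v≢m : v ≢ mate v
      v≢m = edge-≢ (mate-edge′ v)
      which : (x ≡ v ⊎ x ≡ mate v) × (y ≡ v ⊎ y ≡ mate v)
      which with xy-only v∈K v≢a v≢b | xy-only m∈K (mate-≢a v≢b) (mate-≢b v≢a)
      ... | inj₁ p | inj₁ q = ⊥-elim (v≢m (trans p (sym q)))
      ... | inj₁ p | inj₂ q = inj₁ (sym p) , inj₂ (sym q)
      ... | inj₂ p | inj₁ q = inj₂ (sym q) , inj₁ (sym p)
      ... | inj₂ p | inj₂ q = ⊥-elim (v≢m (trans p (sym q)))
      closed : Closed full Q
      closed p∈Q _ e with Q-cases p∈Q
      ... | inj₁ (inj₁ refl) = K⊆Q (proj₂ (HasEdge-∈ (rigid-a e)))
      ... | inj₁ (inj₂ refl) = K⊆Q (proj₂ (HasEdge-∈ (rigid-b e)))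
      ... | inj₂ (inj₁ refl) = K⊆Q (proj₂ (HasEdge-∈ (rigid-v (proj₁ which) e)))
      ... | inj₂ (inj₂ refl) = K⊆Q (proj₂ (HasEdge-∈ (rigid-v (proj₂ which) e)))

    pair : Fin N → Fin N → Adj N
    pair p r u v = does (u Fin.≟ p) ∧ does (v Fin.≟ r) ∨ does (u Fin.≟ r) ∧ does (v Fin.≟ p)

    pair-sym : ∀ p r u v → pair p r u v ≡ pair p r v u
    pair-sym p r u v = trans (Bool.∨-comm (does (u Fin.≟ p) ∧ does (v Fin.≟ r)) _)
      (cong₂ _∨_ (Bool.∧-comm (does (u Fin.≟ r)) _) (Bool.∧-comm (does (u Fin.≟ p)) _))

    pair-refl : ∀ p r → pair p r p r ≡ true
    pair-refl p r rewrite dec-true (p Fin.≟ p) refl | dec-true (r Fin.≟ r) refl = refl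

    pair-∌ˡ : ∀ {p r u v} → u ≢ p → v ≢ p → pair p r u v ≡ false
    pair-∌ˡ {p} {r} {u} {v} u≢p v≢p rewrite dec-false (u Fin.≟ p) u≢p | dec-false (v Fin.≟ p) v≢p = Bool.∧-zeroʳ _

    pair-∌ʳ : ∀ {p r u v} → u ≢ r → v ≢ r → pair p r u v ≡ false
    pair-∌ʳ {p} {r} {u} {v} u≢r v≢r rewrite dec-false (u Fin.≟ r) u≢r | dec-false (v Fin.≟ r) v≢r =
      trans (Bool.∨-identityʳ _) (Bool.∧-zeroʳ _)

    pair-outside : ∀ {p r u v} → u ≢ p → u ≢ r → pair p r u v ≡ false
    pair-outside {p} {r} {u} u≢p u≢r rewrite dec-false (u Fin.≟ p) u≢p | dec-false (u Fin.≟ r) u≢r = refl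

    -- Replacing the edge ax by bx turns a into a leaf at b and the 4-cycle into the triangle b x y.
    E″ : Adj N
    E″ u v = if pair a x u v then false else if pair b x u v then true else E u v

    E″-sym : Sym E″
    E″-sym u v rewrite pair-sym a x u v | pair-sym b x u v | E-sym u v = refl

    E″-off-x : ∀ {u v} → u ≢ x → v ≢ x → E″ u v ≡ E u v
    E″-off-x {u} {v} u≢x v≢x rewrite pair-∌ʳ {a} {x} u≢x v≢x | pair-∌ʳ {b} {x} u≢x v≢x = refl

    E″-off-ab : ∀ {u v} → u ≢ a → u ≢ b → v ≢ a → v ≢ b → E″ u v ≡ E u v
    E″-off-ab {u} {v} u≢a u≢b v≢a v≢b rewrite pair-∌ˡ {a} {x} u≢a v≢a | pair-∌ˡ {b} {x} u≢b v≢b = refl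

    E″-ax : E″ a x ≡ false
    E″-ax rewrite pair-refl a x = refl

    E″-bx : E″ b x ≡ true
    E″-bx rewrite pair-outside {a} {x} {b} {x} (a≢b ∘ sym) (x≢b ∘ sym) | pair-refl b x = refl

    E″-irr : ∀ v → E″ v v ≡ false
    E″-irr v = go (v Fin.≟ x)
      where
      go : Dec (v ≡ x) → E″ v v ≡ false
      go (no v≢x)   = trans (E″-off-x v≢x v≢x) (E-irr v)
      go (yes refl) = trans (E″-off-ab x≢a x≢b x≢a x≢b) (E-irr x)

    leaves″ : Sub N
    leaves″ v = if does (v Fin.≟ a) then true else if does (v Fin.≟ b) then false else leaves v

    leaves″-a : leaves″ a ≡ true
    leaves″-a rewrite dec-true (a Fin.≟ a) refl = refl

    leaves″-b : leaves″ b ≡ false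
    leaves″-b rewrite dec-false (b Fin.≟ a) (a≢b ∘ sym) | dec-true (b Fin.≟ b) refl = refl

    leaves″-other : ∀ {v} → v ≢ a → v ≢ b → leaves″ v ≡ leaves v
    leaves″-other {v} v≢a v≢b rewrite dec-false (v Fin.≟ a) v≢a | dec-false (v Fin.≟ b) v≢b = refl

    ∁-≢a : ∀ {v} → v ∈ ∁ leaves″ → v ≢ a
    ∁-≢a v∈ refl = ∈-∉ (in! leaves″-a) (∁-∈ v∈)

    leaf-≢x : ∀ {v} → v ∈ leaves → v ≢ x
    leaf-≢x v∈ refl = inner-not-leafy (cycle-inner x∈K) (leaves-∈ v∈)

    only″ : ∀ {v u} → v ∈ leaves″ → E″ v u ≡ true → u ≡ mate v
    only″ {v} {u} v∈ e = go (v Fin.≟ a) (v Fin.≟ b)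
      where
      at-a : Dec (u ≡ x) → E″ a u ≡ true → u ≡ b
      at-a (yes refl) e = clash e E″-ax
      at-a (no u≢x)   e = Sum.[ id , ⊥-elim ∘ u≢x ]′ (a-only (trans (sym (E″-off-x (x≢a ∘ sym) u≢x)) e))
      at : v ≢ a → v ≢ b → v ∈ leaves → Dec (u ≡ x) → E v u ≡ true
      at v≢a v≢b v∈L (yes refl) = trans (sym (E″-off-ab v≢a v≢b x≢a x≢b)) e
      at v≢a v≢b v∈L (no u≢x)   = trans (sym (E″-off-x (leaf-≢x v∈L) u≢x)) e
      go : Dec (v ≡ a) → Dec (v ≡ b) → u ≡ mate v
      go (yes v≡a) _         = trans (at-a (u Fin.≟ x) (subst (λ z → E″ z u ≡ true) v≡a e)) (cong mate (sym v≡a))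
      go (no _)    (yes v≡b) = ∈-∉ (subst (_∈ leaves″) v≡b v∈) (out! leaves″-b)
      go (no v≢a)  (no v≢b)  = leaves-∈ v∈L (at v≢a v≢b v∈L (u Fin.≟ x))
        where
        v∈L : v ∈ leaves
        v∈L = in! (trans (sym (leaves″-other v≢a v≢b)) (holds v∈))

    starred″ : Starred E″
    starred″ = record
      { E-sym = E″-sym ; E-irr = E″-irr ; L = leaves″ ; mate = mate ; mate-L = mate-L ; mate-mate = mate-mate′
      ; mate-edge = edge ; mate-only = only″ }
      where
      mate-L : ∀ v → leaves″ (mate v) ≡ not (leaves″ v)
      mate-L v = go (v Fin.≟ a) (v Fin.≟ b)
        where
        go : Dec (v ≡ a) → Dec (v ≡ b) → leaves″ (mate v) ≡ not (leaves″ v)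
        go (yes refl) _          = trans leaves″-b (cong not (sym leaves″-a))
        go (no _)     (yes refl) = trans (cong leaves″ (mate-mate′ a)) (trans leaves″-a (cong not (sym leaves″-b)))
        go (no v≢a)   (no v≢b)   = trans (leaves″-other (mate-≢a v≢b) (mate-≢b v≢a))
          (trans (leaves-mate (pendant v v≢a v≢b)) (cong not (sym (leaves″-other v≢a v≢b))))
      edge : ∀ v → E″ v (mate v) ≡ true
      edge v = go (v Fin.≟ a) (v Fin.≟ b)
        where
        go : Dec (v ≡ a) → Dec (v ≡ b) → E″ v (mate v) ≡ true
        go (yes refl) _          = trans (E″-off-x (x≢a ∘ sym) (x≢b ∘ sym)) eb
        go (no _)     (yes refl) = trans (E″-off-x (x≢b ∘ sym) (λ e → x≢a (trans (sym e) (mate-mate′ a)))) (mate-edge′ b)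
        go (no v≢a)   (no v≢b)   = trans (E″-off-ab v≢a v≢b (mate-≢a v≢b) (mate-≢b v≢a)) (mate-edge′ v)

    private module C″ = Connectivity E″ E″-sym

    x∈∁ : x ∈ ∁ leaves″
    x∈∁ = ∈-∁ (out! (trans (leaves″-other x≢a x≢b) (fails (inner-∉ (cycle-inner x∈K)))))
    y∈∁ : y ∈ ∁ leaves″
    y∈∁ = ∈-∁ (out! (trans (leaves″-other y≢a y≢b) (fails (inner-∉ (cycle-inner y∈K)))))
    b∈∁ : b ∈ ∁ leaves″
    b∈∁ = ∈-∁ (out! leaves″-b)

    E″-by : E″ b y ≡ true
    E″-by = trans (E″-off-x (x≢b ∘ sym) (x≢y ∘ sym)) ey

    conn″ : C″.Conn ⁅ b ⁆ (∁ leaves″)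
    -- As before, `A` is enlarged by the mates of its vertices. The leaving edge belongs to `E` and
    -- has to be replaced when it ends at `a` or `b`.
    conn″ {A} {u} A⊆ u∈A avoid with Conn-full b {A ∪ (A ∘ mate)} (λ _ → ∈-full) (∈-∪ˡ u∈A)
        (λ p → ∉-⁅⁆ λ { refl → Sum.[ (λ q → ∈-∉ (∈-⁅⁆ b) (avoid q)) , (λ q → a∉A (subst (_∈ A) (mate-mate′ a) (in! (holds q)))) ]′ (∪-∈ p) })
      where
      a∉A : a ∈ A → ⊥
      a∉A p = ∁-≢a (A⊆ p) refl
    ... | p , r , p∈ , _ , r∉ , e = locate (∪-∈ p∈)
      where
      r∉A : r ∉ A
      r∉A = ¬∈⇒∉ λ q → ∈-∉ (∈-∪ˡ q) r∉
      mr∉A : mate r ∉ A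
      mr∉A = ¬∈⇒∉ λ q → ∈-∉ (∈-∪ʳ {T = A ∘ mate} {S = A} (in! (holds q))) r∉
      b∉A : b ∉ A
      b∉A = ¬∈⇒∉ λ q → ∈-∉ (∈-⁅⁆ b) (avoid q)
      locate : p ∈ A ⊎ p ∈ A ∘ mate → ∃ λ a → ∃ λ c → a ∈ A × c ∈ ∁ leaves″ × c ∉ A × E″ a c ≡ true
      locate (inj₁ p∈A) = go (r Fin.≟ a) (r Fin.≟ b)
        where
        p≢a : p ≢ a
        p≢a = ∁-≢a (A⊆ p∈A)
        p≢b : p ≢ b
        p≢b = ∈-∉-≢ p∈A b∉A
        go : Dec (r ≡ a) → Dec (r ≡ b) → ∃ λ a → ∃ λ c → a ∈ A × c ∈ ∁ leaves″ × c ∉ A × E″ a c ≡ true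
        -- The neighbours of `a` in `E` are `b` and `x`, so the edge comes from `x`, which `E″`
        -- joins to `b`. An edge ending at `b` comes in the same way from `y`.
        go (yes refl) _          = p , b , p∈A , b∈∁ , b∉A ,
          Sum.[ ⊥-elim ∘ p≢b , (λ p≡x → trans (cong (λ z → E″ z b) p≡x) (trans (E″-sym x b) E″-bx)) ]′ (a-only (flip e))
        go (no _)     (yes refl) = p , b , p∈A , b∈∁ , b∉A ,
          Sum.[ ⊥-elim ∘ p≢a , (λ p≡y → trans (cong (λ z → E″ z b) p≡y) (trans (E″-sym y b) E″-by)) ]′ (b-only (flip e))
        go (no r≢a)   (no r≢b)   = p , r , p∈A ,
          ∈-∁ (¬∈⇒∉ λ r∈L → ∈-∉ p∈A (subst (_∉ A) (sym (leaves-∈ (in! (trans (sym (leaves″-other r≢a r≢b)) (holds r∈L))) (flip e))) mr∉A)) ,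
          r∉A , trans (E″-off-ab p≢a p≢b r≢a r≢b) e
      locate (inj₂ q) = ∈-∉ m∈A (subst (_∉ A) (leaves-∈ p∈L e) r∉A)
        where
        m∈A : mate p ∈ A
        m∈A = in! (holds q)
        p≢b : p ≢ b
        p≢b p≡b = ∁-≢a (A⊆ m∈A) (trans (cong mate p≡b) (mate-mate′ a))
        p≢a : p ≢ a
        p≢a p≡a = ∈-∉ m∈A (subst (λ z → mate z ∉ A) (sym p≡a) b∉A)
        p∈L : p ∈ leaves
        p∈L = in! (trans (sym (Bool.not-involutive _)) (trans (cong not (sym (leaves-mate (pendant p p≢a p≢b))))
          (cong not (trans (sym (leaves″-other (mate-≢a p≢b) (mate-≢b p≢a))) (fails (∁-∈ (A⊆ m∈A)))))))

    -- Off `a` and `b` the two adjacencies agree, so the statement is inherited from `G` without the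
    -- vertex `b` of its cycle.
    forest″ : C″.Forest (∁ leaves″ ∖ ⁅ b ⁆)
    forest″ S⊆ v∈S with forest (proj₁ (HasEdge-∈ (rigid-b ey))) (λ p → ∈-∖ ∈-full (proj₂ (∖-∈ (S⊆ p)))) v∈S
    ... | u , u∈S , one = u , u∈S , λ p∈ r∈ ep er → one p∈ r∈ (transfer u∈S p∈ ep) (transfer u∈S r∈ er)
      where
      transfer : ∀ {u p} → u ∈ _ → p ∈ _ → E″ u p ≡ true → E u p ≡ true
      transfer u∈ p∈ = trans (sym (E″-off-ab (∁-≢a (∖-⊆ (S⊆ u∈))) (proj₂ (∖x-∈ (S⊆ u∈))) (∁-≢a (∖-⊆ (S⊆ p∈))) (proj₂ (∖x-∈ (S⊆ p∈)))))

    b-only″ : ∀ {w} → w ≢ a → E″ b w ≡ true → w ≡ x ⊎ w ≡ y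
    b-only″ {w} w≢a e = go (w Fin.≟ x)
      where
      go : Dec (w ≡ x) → w ≡ x ⊎ w ≡ y
      go (yes w≡x) = inj₁ w≡x
      go (no w≢x)  = Sum.[ ⊥-elim ∘ w≢a , inj₂ ]′ (b-only (trans (sym (E″-off-x (x≢b ∘ sym) w≢x)) e))

    -- Within the new base graph the only neighbours of `b` are `x` and `y`. A set that contains `b`
    -- but not both of them has `b` itself as a vertex of degree at most 1.
    pseudoforest″ : C″.Pseudoforest (∁ leaves″) b
    pseudoforest″ {S} {v} S⊆ v∈S with ∈? S b
    ... | inj₂ b∉S = inj₁ (forest″ (λ p → ∈-∖x (S⊆ p) (∈-∉-≢ p b∉S)) v∈S)
    ... | inj₁ b∈S with ∈? S x | ∈? S y
    ... | inj₁ x∈S | inj₁ y∈S = inj₂ (b∈S , x , y , x∈S , y∈S , x≢y , x≢b , y≢b , E″-bx , E″-by , λ w∈S → b-only″ (∁-≢a (S⊆ w∈S)))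
    ... | inj₂ x∉S | _ = inj₁ (b , b∈S , λ p∈ r∈ ep er → trans (is-y p∈ ep) (sym (is-y r∈ er)))
      where
      is-y : ∀ {w} → w ∈ S → E″ b w ≡ true → w ≡ y
      is-y w∈S e = Sum.[ ⊥-elim ∘ ∈-∉-≢ w∈S x∉S , id ]′ (b-only″ (∁-≢a (S⊆ w∈S)) e)
    ... | inj₁ _ | inj₂ y∉S = inj₁ (b , b∈S , λ p∈ r∈ ep er → trans (is-x p∈ ep) (sym (is-x r∈ er)))
      where
      is-x : ∀ {w} → w ∈ S → E″ b w ≡ true → w ≡ x
      is-x w∈S e = Sum.[ id , ⊥-elim ∘ ∈-∉-≢ w∈S y∉S ]′ (b-only″ (∁-≢a (S⊆ w∈S)) e)

    star″ : UnicyclicStar E″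
    star″ = record
      { starred  = starred″
      ; c        = b
      ; K        = ⁅ b ⁆ ∪ ⁅ x ⁆ ∪ ⁅ y ⁆
      ; cycleSet = triangle E″ E″-sym E″-bx E″-by (trans (E″-off-ab x≢a x≢b y≢a y≢b) exy) (x≢b ∘ sym) (y≢b ∘ sym) x≢y
      ; K⊆∁L     = λ p → Sum.[ (λ q → Sum.[ (λ r → subst (_∈ ∁ leaves″) (sym (⁅⁆-∈ r)) b∈∁) ,
                                            (λ r → subst (_∈ ∁ leaves″) (sym (⁅⁆-∈ r)) x∈∁) ]′ (∪-∈ q)) ,
                               (λ q → subst (_∈ ∁ leaves″) (sym (⁅⁆-∈ q)) y∈∁) ]′ (∪-∈ p)
      ; conn     = conn″
      ; pseudo   = pseudoforest″
      ; forest   = forest″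
      }

    -- Expanding at x, both graphs lose the same sets: the one with a (or b) isolated.
    module _ (t : ℚ) where
      private
        module W = Weighted E E-sym t
        module W″ = Weighted E″ E″-sym t

        off-x : ∀ {S} → x ∉ S → W.f S ≡ W″.f S
        off-x {S} x∉S = Z-adj E E″ (ind (- t) S) λ i j → cases i j (i Fin.≟ x) (j Fin.≟ x)
          where
          cases : ∀ i j → Dec (i ≡ x) → Dec (j ≡ x) → E i j ≡ E″ i j ⊎ ind (- t) S i ≡ 0ℚ ⊎ ind (- t) S j ≡ 0ℚ
          cases i j (yes refl) _          = inj₂ (inj₁ (ind-∉ {S = S} x∉S))
          cases i j (no _)     (yes refl) = inj₂ (inj₂ (ind-∉ {S = S} x∉S))
          cases i j (no i≢x)   (no j≢x)   = inj₁ (sym (E″-off-x i≢x j≢x))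

        S₁ S₂ : Sub N
        S₁ = full ∖ ⁅ x ⁆ ∖ E x
        S₂ = full ∖ ⁅ x ⁆ ∖ E″ x

        a∉S₁ : a ∉ S₁
        a∉S₁ = ∉-∖ʳ (in! (flip ex))
        b∈S₁ : b ∈ S₁
        b∈S₁ = ∈-∖ (∈-∖x ∈-full (x≢b ∘ sym)) (out! (Bool.¬-not λ e → Sum.[ x≢a , x≢y ]′ (b-only (flip e))))
        b∉S₂ : b ∉ S₂
        b∉S₂ = ∉-∖ʳ (in! (trans (E″-sym x b) E″-bx))
        a∈S₂ : a ∈ S₂
        a∈S₂ = ∈-∖ (∈-∖x ∈-full (x≢a ∘ sym)) (out! (trans (E″-sym x a) E″-ax))

        isolated₁ : (S₁ ∖ ⁅ b ⁆) ∖ E b ≗ S₁ ∖ ⁅ b ⁆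
        isolated₁ = ⊆-antisym ∖-⊆ λ {p} p∈ → ∈-∖ p∈ (¬∈⇒∉ λ e →
          Sum.[ ∈-∉-≢ (∖-⊆ p∈) a∉S₁ , (λ { refl → ∈-∉ (in! exy) (proj₂ (∖-∈ (∖-⊆ p∈))) }) ]′ (b-only (holds e)))

        isolated₂ : (S₂ ∖ ⁅ a ⁆) ∖ E″ a ≗ S₂ ∖ ⁅ a ⁆
        isolated₂ = ⊆-antisym ∖-⊆ λ {p} p∈ → ∈-∖ p∈ (¬∈⇒∉ λ e →
          let p≢x = proj₂ (∖x-∈ (∖-⊆ (∖-⊆ p∈))) in
          Sum.[ ∈-∉-≢ (∖-⊆ p∈) b∉S₂ , p≢x ]′ (a-only (trans (sym (E″-off-x (x≢a ∘ sym) p≢x)) (holds e))))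

        same : S₁ ∖ ⁅ b ⁆ ≗ S₂ ∖ ⁅ a ⁆
        same = ⊆-antisym
          (λ p∈ → let q , p≢b = ∖x-∈ p∈ ; r , p∉E = ∖-∈ q ; p≢a = ∈-∉-≢ q a∉S₁ in
            ∈-∖x (∈-∖ r (out! (trans (E″-off-ab x≢a x≢b p≢a p≢b) (fails p∉E)))) p≢a)
          (λ p∈ → let q , p≢a = ∖x-∈ p∈ ; r , p∉E = ∖-∈ q ; p≢b = ∈-∉-≢ q b∉S₂ in
            ∈-∖x (∈-∖ r (out! (trans (sym (E″-off-ab x≢a x≢b p≢a p≢b)) (fails p∉E)))) p≢b)

      exceptional-value : W.f full ≡ W″.f full
      exceptional-value = begin
        W.f full
          ≡⟨ W.f-remove {full} {x} ∈-full ⟩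
        W.f (full ∖ ⁅ x ⁆) - t * W.f S₁
          ≡⟨ cong₂ (λ F G → F - t * G) (off-x {full ∖ ⁅ x ⁆} (∉-∖ʳ (∈-⁅⁆ x))) reduced ⟩
        W″.f (full ∖ ⁅ x ⁆) - t * W″.f S₂
          ≡⟨ W″.f-remove {full} {x} ∈-full ⟨
        W″.f full ∎
        where
        open ≡-Reasoning
        agree : W.f (S₁ ∖ ⁅ b ⁆) ≡ W″.f (S₂ ∖ ⁅ a ⁆)
        agree = trans (off-x {S₁ ∖ ⁅ b ⁆} (∉-∖ˡ (∉-∖ˡ (∉-∖ʳ (∈-⁅⁆ x))))) (W″.f-cong same)
        reduced : W.f S₁ ≡ W″.f S₂
        reduced = trans (W.f-remove {S₁} {b} b∈S₁) (trans
          (cong₂ (λ F G → F - t * G) agree (trans (W.f-cong isolated₁) (trans agree (W″.f-cong (sym ∘ isolated₂)))))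
          (sym (W″.f-remove {S₂} {a} a∈S₂)))

  reduction : ∃ λ (E″ : Adj N) → UnicyclicStar E″ × (∀ q → Z E (ind q full) ≡ Z E″ (ind q full))
  reduction with search pendant?
  ... | inj₂ pendant = E , pendant-star pendant , λ _ → refl
  ... | inj₁ (a , inner-a , inner-b) = E″ , star″ , λ q →
      subst (λ r → Z E (ind r full) ≡ Z E″ (ind r full)) (neg-neg q) (exceptional-value (- q))
    where
    open Exceptional inner-a inner-b
    neg-neg : ∀ q → - (- q) ≡ q
    neg-neg = solve-∀ ℚ-ring

-- Comparison

star-parameter : ∀ q → q ≤ 0ℚ → 0ℚ < 1ℚ + q → ∃ λ t → (1ℚ + q) * (- t) ≡ q × 0ℚ ≤ t
star-parameter q q≤0 0<1+q = (- q) * i ,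
  trans (eq (1ℚ + q) q i) (trans (cong (_* q) (ℚ.*-inverseʳ (1ℚ + q))) (ℚ.*-identityˡ q)) ,
  0≤* (ℚ.neg-antimono-≤ q≤0) (ℚ.<⇒≤ (ℚ.positive⁻¹ i {{ℚ.1/pos⇒pos (1ℚ + q)}}))
  where
  instance
    pos-1+q : ℚ.Positive (1ℚ + q)
    pos-1+q = ℚ.positive 0<1+q
    nonZero-1+q : ℚ.NonZero (1ℚ + q)
    nonZero-1+q = ℚ.pos⇒nonZero (1ℚ + q)
  i = ℚ.1/ (1ℚ + q)
  eq : ∀ a q i → a * (- ((- q) * i)) ≡ a * i * q
  eq = solve-∀ ℚ-ring

module Comparison (k : ℕ) {N} (N≡ : N ≡ (3 ℕ.+ k) ℕ.+ (3 ℕ.+ k)) (G : Graph N) (v₀ : Fin N)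
  (E : Adj N) (star : UnicyclicStar E) (same : ∀ q → Z (adj G) (ind q full) ≡ Z E (ind q full)) where
  private
    poly-E : ∀ q → poly G q ≡ Z E (ind q full)
    poly-E q = trans (poly-Z G q) (same q)

    star-poly : ∀ (H : Graph (3 ℕ.+ k)) q t (tq : (1ℚ + q) * (- t) ≡ q) (0<1+q : 0ℚ < 1ℚ + q) → let open StarGraph H in
      poly (H ⋆) q ≡ (1ℚ + q) ^ (3 ℕ.+ k) * Values.f t (∁ L)
    star-poly H q t tq 0<1+q = trans (poly-Z (H ⋆) q) (trans (StarAt.star-value starred q t tq 0<1+q)
      (cong (λ j → (1ℚ + q) ^ j * Values.f t (∁ L)) (proj₁ (Starred.card-half starred {(3 ℕ.+ k)} refl))))
      where open StarGraph H

  cycle-≼ : (D.cycle (3 ℕ.+ k) ⋆) ≼ G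
  cycle-≼ = ≼-criterion G (D.cycle (3 ℕ.+ k) ⋆) E (UnicyclicStar.E-sym star) v₀ poly-E λ q q≤0 good →
    let 0<1+q = Root.good-range E (UnicyclicStar.E-sym star) v₀ good
        t , tq , 0≤t = star-parameter q q≤0 0<1+q
    in subst₂ _≤_ (sym (poly-E q))
         (sym (trans (star-poly (D.cycle (3 ℕ.+ k)) q t tq 0<1+q) (cong ((1ℚ + q) ^ (3 ℕ.+ k) *_) (CycleStar.base-value k t))))
         (StarBounds.star-upper star q t tq 0<1+q 0≤t {(3 ℕ.+ k)} N≡ good)

  -- The points considered lie beyond the largest root of the star of `U`, and positivity is
  -- available for that star. It makes `U-poly t k` positive through `base-bound`, and this is the
  -- hypothesis from which the lower bound derives everything it needs about `G`.
  ≼-U : G ≼ (D.U (3 ℕ.+ k) ⋆)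
  ≼-U = ≼-criterion (D.U (3 ℕ.+ k) ⋆) G (adj (D.U (3 ℕ.+ k) ⋆)) (adj-sym (D.U (3 ℕ.+ k) ⋆)) zero (poly-Z (D.U (3 ℕ.+ k) ⋆)) λ q q≤0 good →
    let open StarGraph (D.U (3 ℕ.+ k)) using (starred; L)
        0<1+q = Root.good-range (adj (D.U (3 ℕ.+ k) ⋆)) (adj-sym (D.U (3 ℕ.+ k) ⋆)) zero good
        t , tq , 0≤t = star-parameter q q≤0 0<1+q
        pos = StarAt.star-pos starred q t tq 0<1+q good
        bound = UStar.base-bound k t 0≤t pos
    in ℚ.≤-trans (ℚ.≤-reflexive (star-poly (D.U (3 ℕ.+ k)) q t tq 0<1+q))
         (ℚ.≤-trans (*-monoˡ (ℚ.<⇒≤ (0<^ (3 ℕ.+ k) 0<1+q)) bound)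
           (ℚ.≤-trans (StarBounds.star-lower star q t tq 0<1+q 0≤t {(3 ℕ.+ k)} N≡ k refl (UStar.1-t-pos k t 0≤t pos)
                         (ℚ.<-≤-trans (pos (∁ L) ⊆-refl) bound))
             (ℚ.≤-reflexive (sym (poly-E q)))))

Claim : ℕ → Set₁
Claim n = ∀ (G : Graph (2 ℕ.* n)) → Connected G → Unicyclic G → WellCovered G → (cycle n ⋆ ≼ G) × (G ≼ U n ⋆)

comparison : ∀ k → Claim (3 ℕ.+ k)
comparison k G connected unicyclic well-covered = compare (Reduction.reduction G connected unicyclic well-covered
    (Structure.matched G connected unicyclic well-covered (3 ℕ.+ k) N≡) 4<N)
  where
  N≡ : 2 ℕ.* (3 ℕ.+ k) ≡ (3 ℕ.+ k) ℕ.+ (3 ℕ.+ k)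
  N≡ = cong (3 ℕ.+ k ℕ.+_) (ℕ.+-identityʳ (3 ℕ.+ k))
  4<N : 4 ℕ.< 2 ℕ.* (3 ℕ.+ k)
  4<N = subst (5 ℕ.≤_) (sym N≡) (ℕ.≤-trans (ℕ.n≤1+n 5) (ℕ.+-mono-≤ (ℕ.m≤m+n 3 k) (ℕ.m≤m+n 3 k)))
  compare : (∃ λ (E : Adj (2 ℕ.* (3 ℕ.+ k))) → UnicyclicStar E × (∀ q → Z (adj G) (ind q full) ≡ Z E (ind q full))) →
    (cycle (3 ℕ.+ k) ⋆ ≼ G) × (G ≼ U (3 ℕ.+ k) ⋆)
  compare (E , star , same) = Comparison.cycle-≼ k N≡ G (proj₁ connected) E star same ,
                              Comparison.≼-U k N≡ G (proj₁ connected) E star same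

theorem3p12 : ∀ (n : ℕ) → 3 ℕ.≤ n →
    ∀ (G : Graph (2 ℕ.* n)) → Connected G → Unicyclic G → WellCovered G →
    (cycle n ⋆ ≼ G) × (G ≼ U n ⋆)
theorem3p12 n 3≤n = subst Claim (ℕ.m+[n∸m]≡n 3≤n) (comparison (n ℕ.∸ 3))
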